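{- Let $q=2^{2e+1}$ with $e\ge 1$. All Buekenhout-Tits unitals in $\mathrm{PG}(2,q^2)$ are $\mathrm{PGL}$-equivalent; that is, for any two Buekenhout-Tits unitals $U_1,U_2$ in $\mathrm{PG}(2,q^2)$ there is an element of $\mathrm{PGL}(3,q^2)$ mapping $U_1$ onto $U_2$.
   Context: A unital in $\mathrm{PG}(2,q^2)$ is a set of $q^3+1$ points such that every line meets it in $1$ or $q+1$ points. André/Bruck-Bose (ABB) construction: fix a hyperplane $\Sigma$ of $\mathrm{PG}(4,q)$ and a Desarguesian line spread $\mathcal{S}$ of $\Sigma\cong\mathrm{PG}(3,q)$. The plane $\mathrm{PG}(2,q^2)$ is modelled as follows: the points are the points of $\mathrm{PG}(4,q)\setminus\Sigma$ together with the lines of $\mathcal{S}$ (the latter being the points of a line $\ell_\infty$); the lines are $\ell_\infty$ and the planes of $\mathrm{PG}(4,q)$ not contained in $\Sigma$ that meet $\Sigma$ in a line of $\mathcal{S}$; incidence is natural. Let $\sigma=2^{e+1}$. A Tits ovoid of $\mathrm{PG}(3,q)$ is a point set projectively equivalent to $\{(0,0,0,1)\}\cup\{(1,s,t,s^{\sigma+2}+t^\sigma+st) : s,t\in\mathbb{F}_q\}$. An ovoidal cone in $\mathrm{PG}(4,q)$ with vertex a point $V$ and base an ovoid $\mathcal{O}$ (contained in a hyperplane not through $V$) is the union of the lines joining $V$ to the points of $\mathcal{O}$. A Buekenhout-Tits unital in $\mathrm{PG}(2,q^2)$ is a unital arising, via the ABB construction, from an ovoidal cone $\mathcal{C}$ with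 base a Tits ovoid such that $\mathcal{C}\cap\Sigma$ is a line of the spread $\mathcal{S}$: it consists of the points of $\mathcal{C}\setminus\Sigma$ together with the point of $\ell_\infty$ corresponding to the spread line $\mathcal{C}\cap\Sigma$. -}

module Defs where

open import Algebra.Bundles using (CommutativeRing; Semiring)
open import Algebra.Module.Bundles.Raw using (RawLeftModule)
open import Algebra.Module.Morphism.Structures using (module LeftModuleMorphisms)
open import Algebra.Morphism.Structures using (module RingMorphisms)
open import Algebra.Structures using (IsCommutativeRing)
open import Data.Empty using (⊥)
open import Data.Fin.Base using (Fin)
open import Data.Nat.Base as ℕ using (ℕ; suc)
open import Data.Product using (Σ; ∃; ∃₂; ∃!; _×_; _,_; proj₁; proj₂)
open import Data.Sum.Base using (_⊎_)
open import Data.Unit.Base using (⊤)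
open import Data.Vec.Base using (Vec; []; _∷_; map; zipWith; replicate)
open import Function.Bundles using (_⇔_; _↔_; Inverse)
open import Level using (0ℓ)
open import Relation.Binary.Bundles using (Setoid)
open import Relation.Binary.Definitions using (Reflexive; Symmetric; Transitive)
import Relation.Binary.Construct.On as On
open import Relation.Binary.PropositionalEquality using (_≡_; _≢_)
import Relation.Binary.PropositionalEquality.Properties as ≡
open import Relation.Nullary.Negation using (¬_)
open import Relation.Unary using (Pred)

------------------------------------------------------------------------
-- Fields

-- Equality is propositional; only fields of finite order occur below, so
-- nothing is lost by not working over a setoid.

record Field : Set₁ where
  infixl 6 _+_
  infixl 7 _*_
  infix  8 -_
  field
    Carrier           : Set
    _+_ _*_           : Carrier → Carrier → Carrier
    -_                : Carrier → Carrier
    0# 1#             : Carrier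
    isCommutativeRing : IsCommutativeRing _≡_ _+_ _*_ -_ 0# 1#
    0≢1               : 0# ≢ 1#
    invertible        : ∀ x → x ≢ 0# → ∃ λ y → x * y ≡ 1#

  commutativeRing : CommutativeRing 0ℓ 0ℓ
  commutativeRing = record { isCommutativeRing = isCommutativeRing }

  open CommutativeRing commutativeRing public using (rawRing; semiring)
  open import Algebra.Definitions.RawSemiring (Semiring.rawSemiring semiring) public using (_^_)

HasOrder : Field → ℕ → Set
HasOrder F q = Field.Carrier F ↔ Fin q

record Embedding (F K : Field) : Set where
  field
    ⟦_⟧                : Field.Carrier F → Field.Carrier K
    isRingMonomorphism :
      RingMorphisms.IsRingMonomorphism (Field.rawRing F) (Field.rawRing K) ⟦_⟧

------------------------------------------------------------------------
-- The vector space Fⁿ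

Vector : Field → ℕ → Set
Vector F n = Vec (Field.Carrier F) n

module _ (F : Field) where
  open Field F

  -- Module homomorphisms are defined for raw modules, so the laws are not
  -- recorded.
  vectorSpace : ℕ → RawLeftModule Carrier 0ℓ 0ℓ
  vectorSpace n = record
    { Carrierᴹ = Vec Carrier n
    ; _≈ᴹ_     = _≡_
    ; _+ᴹ_     = zipWith _+_
    ; _*ₗ_     = λ a → map (a *_)
    ; 0ᴹ       = replicate n 0#
    ; -ᴹ_      = map -_
    }

restrictScalars : {R S : Set} → (R → S) →
                  RawLeftModule S 0ℓ 0ℓ → RawLeftModule R 0ℓ 0ℓ
restrictScalars f M = record
  { Carrierᴹ = Carrierᴹ
  ; _≈ᴹ_     = _≈ᴹ_
  ; _+ᴹ_     = _+ᴹ_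
  ; _*ₗ_     = λ r x → f r *ₗ x
  ; 0ᴹ       = 0ᴹ
  ; -ᴹ_      = -ᴹ_
  }
  where open RawLeftModule M

module _ {F : Field} where
  open Field F

  linearCombination : ∀ {n k} → Vector F k → Vec (Vector F n) k → Vector F n
  linearCombination {n} []       []       = RawLeftModule.0ᴹ (vectorSpace F n)
  linearCombination {n} (c ∷ cs) (v ∷ vs) =
    c *ₗ v +ᴹ linearCombination cs vs
    where open RawLeftModule (vectorSpace F n)

------------------------------------------------------------------------
-- Projective spaces

-- The k-dimensional linear subspaces of Fⁿ, presented by a basis and
-- identified when they contain the same vectors.  The (k ∸ 1)-dimensional
-- projective subspaces of PG(n ∸ 1, F) are the elements of Subspace F n k.

record Subspace (F : Field) (n k : ℕ) : Set where
  open RawLeftModule using (0ᴹ)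
  field
    basis       : Vec (Vector F n) k
    independent : ∀ c → linearCombination {F} c basis ≡ 0ᴹ (vectorSpace F n) →
                  c ≡ 0ᴹ (vectorSpace F k)

module _ {F : Field} {n : ℕ} where

  infix 4 _∈_ _⊑_ _≈_

  _∈_ : ∀ {k} → Vector F n → Subspace F n k → Set
  v ∈ X = ∃ λ c → linearCombination {F} c (Subspace.basis X) ≡ v

  _⊑_ : ∀ {j k} → Subspace F n j → Subspace F n k → Set
  X ⊑ Y = ∀ v → v ∈ X → v ∈ Y

  _≈_ : ∀ {k} → Subspace F n k → Subspace F n k → Set
  X ≈ Y = X ⊑ Y × Y ⊑ X

subspaceSetoid : Field → ℕ → ℕ → Setoid 0ℓ 0ℓ
subspaceSetoid F n k = record
  { Carrier       = Subspace F n k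
  ; _≈_           = _≈_
  ; isEquivalence = record
    { refl  = (λ _ v∈X → v∈X) , (λ _ v∈X → v∈X)
    ; sym   = λ (p , q) → q , p
    ; trans = λ (p , q) (p′ , q′) →
        (λ v v∈X → p′ v (p v v∈X)) , (λ v v∈Z → q v (q′ v v∈Z))
    }
  }

-- The arguments are projective dimensions: Point F 4 is a point of PG(4, F).

Point Line Plane Hyperplane : Field → ℕ → Set
Point      F d = Subspace F (suc d) 1
Line       F d = Subspace F (suc d) 2
Plane      F d = Subspace F (suc d) 3
Hyperplane F d = Subspace F (suc d) d

PointSet : Field → ℕ → Set₁
PointSet F d = Pred (Point F d) 0ℓ

-- Y is the image of X under f.
IsImage : ∀ {F G m n j k} → (Vector F m → Vector G n) →
          Subspace F m j → Subspace G n k → Set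
IsImage f X Y = ∀ v → v ∈ Y ⇔ (∃ λ u → u ∈ X × f u ≡ v)

-- The element of PGL(n, F) represented by a linear automorphism of Fⁿ.
-- Equality in PGL(n, F), i.e. proportionality, is not needed.

record PGL (n : ℕ) (F : Field) : Set where
  field
    to   : Vector F n → Vector F n
    isLeftModuleIsomorphism :
      LeftModuleMorphisms.IsLeftModuleIsomorphism
        (vectorSpace F n) (vectorSpace F n) to

_⟨$⟩_ : ∀ {F d} → PGL (suc d) F → PointSet F d → PointSet F d
(g ⟨$⟩ U) Q = ∃ λ P → U P × IsImage (PGL.to g) P Q

-- An isomorphism of F-vector spaces from M onto the subspace H of Fⁿ.

record _≅_ {F : Field} {n k : ℕ}
           (M : RawLeftModule (Field.Carrier F) 0ℓ 0ℓ)
           (H : Subspace F n k) : Set where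
  open RawLeftModule M using (Carrierᴹ)
  field
    to    : Carrierᴹ → Vector F n
    isLeftModuleMonomorphism :
      LeftModuleMorphisms.IsLeftModuleMonomorphism M (vectorSpace F n) to
    image : ∀ v → v ∈ H ⇔ (∃ λ u → to u ≡ v)

------------------------------------------------------------------------
-- Incidence structures

record IncidenceStructure : Set₁ where
  field
    points lines : Setoid 0ℓ 0ℓ
    _on_         : Setoid.Carrier points → Setoid.Carrier lines → Set

record Isomorphism (A B : IncidenceStructure) : Set where
  private
    module A = IncidenceStructure A
    module B = IncidenceStructure B
  field
    onPoints : Inverse A.points B.points
    onLines  : Inverse A.lines B.lines
    incident : ∀ P ℓ →
      (P A.on ℓ) ⇔ (Inverse.to onPoints P B.on Inverse.to onLines ℓ)

PG₂ : Field → IncidenceStructure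
PG₂ K = record
  { points = subspaceSetoid K 3 1
  ; lines  = subspaceSetoid K 3 2
  ; _on_   = _⊑_
  }

------------------------------------------------------------------------
-- Unitals

HasCardinality : ∀ {F d} → PointSet F d → ℕ → Set
HasCardinality {F} {d} U n =
  Inverse (On.setoid (subspaceSetoid F (suc d) 1) (proj₁ {B = U}))
          (≡.setoid (Fin n))

record IsUnital (q : ℕ) {K : Field} (U : PointSet K 2) : Set where
  field
    resp-≈        : ∀ {P Q} → P ≈ Q → U P → U Q
    cardinality   : HasCardinality U (q ℕ.^ 3 ℕ.+ 1)
    intersections : ∀ (ℓ : Line K 2) →
      HasCardinality (λ P → U P × P ⊑ ℓ) 1 ⊎
      HasCardinality (λ P → U P × P ⊑ ℓ) (q ℕ.+ 1)

------------------------------------------------------------------------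
-- Tits ovoids and ovoidal cones

-- A point P has homogeneous coordinates v ≢ 0 exactly when v ∈ P.

data IsOnStandardTitsOvoid (σ : ℕ) {F : Field} (P : Point F 3) : Set where
  infinite : (let open Field F) →
             (0# ∷ 0# ∷ 0# ∷ 1# ∷ []) ∈ P → IsOnStandardTitsOvoid σ P
  affine   : (let open Field F) → ∀ s t →
             (1# ∷ s ∷ t ∷ (s ^ (σ ℕ.+ 2) + t ^ σ + s * t) ∷ []) ∈ P →
             IsOnStandardTitsOvoid σ P

-- O is a Tits ovoid of the hyperplane H ≅ PG(3, F) of PG(4, F).

IsTitsOvoid : (σ : ℕ) {F : Field} → Hyperplane F 4 → PointSet F 4 → Set
IsTitsOvoid σ {F} H O = Σ (vectorSpace F 4 ≅ H) λ θ →
  ∀ X → O X ⇔ (∃ λ (P : Point F 3) →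
    IsOnStandardTitsOvoid σ P × IsImage (_≅_.to θ) P X)

Cone : ∀ {F d} → Point F d → PointSet F d → PointSet F d
Cone {F} {d} V O X =
  ∃₂ λ (P : Point F d) (m : Line F d) → O P × V ⊑ m × P ⊑ m × X ⊑ m

record TitsCone (σ : ℕ) (F : Field) : Set₁ where
  field
    vertex      : Point F 4
    hyperplane  : Hyperplane F 4
    vertex∉     : ¬ (vertex ⊑ hyperplane)
    base        : PointSet F 4
    isTitsOvoid : IsTitsOvoid σ hyperplane base

  pointSet : PointSet F 4
  pointSet = Cone vertex base

------------------------------------------------------------------------
-- The André/Bruck–Bose construction

module ABB (F K : Field) (ι : Embedding F K) where

  -- Kⁿ as a vector space over F
  restrictedSpace : ℕ → RawLeftModule (Field.Carrier F) 0ℓ 0ℓ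
  restrictedSpace n = restrictScalars (Embedding.⟦_⟧ ι) (vectorSpace K n)

  -- A line spread of H is Desarguesian when it arises by field reduction:
  -- for some F-linear isomorphism of K² with H, its lines are the images of
  -- the points of PG(1, K).

  record DesarguesianSpread (H : Hyperplane F 4) : Set₁ where
    field
      IsSpreadLine   : Pred (Line F 4) 0ℓ
      resp-≈         : ∀ {ℓ m} → ℓ ≈ m → IsSpreadLine ℓ → IsSpreadLine m
      contained      : ∀ ℓ → IsSpreadLine ℓ → ℓ ⊑ H
      partition      : ∀ (P : Point F 4) → P ⊑ H →
                       ∃! _≈_ (λ ℓ → IsSpreadLine ℓ × P ⊑ ℓ)
      fieldReduction : Σ (restrictedSpace 2 ≅ H) λ ψ →
        ∀ ℓ → IsSpreadLine ℓ ⇔ (∃ λ (P : Point K 1) → IsImage (_≅_.to ψ) P ℓ)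

  module _ {H : Hyperplane F 4} (S : DesarguesianSpread H) where
    open DesarguesianSpread S

    data ABBPoint : Set where
      affine   : (P : Point F 4) → ¬ (P ⊑ H) → ABBPoint
      infinite : (ℓ : Line F 4) → IsSpreadLine ℓ → ABBPoint

    data ABBLine : Set where
      ℓ∞    : ABBLine
      plane : (π : Plane F 4) → ¬ (π ⊑ H) →
              (∃ λ (ℓ : Line F 4) → IsSpreadLine ℓ ×
                 (∀ v → v ∈ ℓ ⇔ (v ∈ π × v ∈ H))) →
              ABBLine

    data _≈ᴾ_ : ABBPoint → ABBPoint → Set where
      affine   : ∀ {P Q p q} → P ≈ Q → affine P p ≈ᴾ affine Q q
      infinite : ∀ {ℓ m p q} → ℓ ≈ m → infinite ℓ p ≈ᴾ infinite m q

    data _≈ᴸ_ : ABBLine → ABBLine → Set where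
      ℓ∞    : ℓ∞ ≈ᴸ ℓ∞
      plane : ∀ {π ρ p q s t} → π ≈ ρ → plane π p s ≈ᴸ plane ρ q t

    private
      module ≈ {k} = Setoid (subspaceSetoid F 5 k)

      reflᴾ : Reflexive _≈ᴾ_
      reflᴾ {affine P _}   = affine (≈.refl {x = P})
      reflᴾ {infinite ℓ _} = infinite (≈.refl {x = ℓ})

      symᴾ : Symmetric _≈ᴾ_
      symᴾ (affine {P} {Q} e)   = affine (≈.sym {x = P} {y = Q} e)
      symᴾ (infinite {ℓ} {m} e) = infinite (≈.sym {x = ℓ} {y = m} e)

      transᴾ : Transitive _≈ᴾ_
      transᴾ (affine {P} {Q} e) (affine {Q = R} f) =
        affine (≈.trans {i = P} {j = Q} {k = R} e f)
      transᴾ (infinite {ℓ} {m} e) (infinite {m = n} f) =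
        infinite (≈.trans {i = ℓ} {j = m} {k = n} e f)

      reflᴸ : Reflexive _≈ᴸ_
      reflᴸ {ℓ∞}          = ℓ∞
      reflᴸ {plane π _ _} = plane (≈.refl {x = π})

      symᴸ : Symmetric _≈ᴸ_
      symᴸ ℓ∞                = ℓ∞
      symᴸ (plane {π} {ρ} e) = plane (≈.sym {x = π} {y = ρ} e)

      transᴸ : Transitive _≈ᴸ_
      transᴸ ℓ∞ ℓ∞ = ℓ∞
      transᴸ (plane {π} {ρ} e) (plane {ρ = τ} f) =
        plane (≈.trans {i = π} {j = ρ} {k = τ} e f)

    _onᴬᴮᴮ_ : ABBPoint → ABBLine → Set
    affine P _   onᴬᴮᴮ ℓ∞          = ⊥
    affine P _   onᴬᴮᴮ plane π _ _ = P ⊑ π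
    infinite ℓ _ onᴬᴮᴮ ℓ∞          = ⊤
    infinite ℓ _ onᴬᴮᴮ plane π _ _ = ℓ ⊑ π

    abbPlane : IncidenceStructure
    abbPlane = record
      { points = record
        { Carrier       = ABBPoint
        ; _≈_           = _≈ᴾ_
        ; isEquivalence = record { refl = reflᴾ ; sym = symᴾ ; trans = transᴾ }
        }
      ; lines  = record
        { Carrier       = ABBLine
        ; _≈_           = _≈ᴸ_
        ; isEquivalence = record { refl = reflᴸ ; sym = symᴸ ; trans = transᴸ }
        }
      ; _on_   = _onᴬᴮᴮ_
      }

    -- The points of C outside H, together with the spread line ℓ.
    abbPointSet : PointSet F 4 → Line F 4 → Pred ABBPoint 0ℓ
    abbPointSet C ℓ (affine P _)   = C P
    abbPointSet C ℓ (infinite m _) = m ≈ ℓ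

  -- U is the unital arising from a Tits cone meeting the hyperplane in a
  -- spread line.  The identification of the ABB plane with PG(2, K) may be any
  -- isomorphism of incidence structures.

  record ArisesFromTitsCone (σ : ℕ) (U : PointSet K 2) : Set₁ where
    field
      hyperplane     : Hyperplane F 4
      spread         : DesarguesianSpread hyperplane
      identification : Isomorphism (abbPlane spread) (PG₂ K)
      cone           : TitsCone σ F
      axis           : Line F 4

      axis∈spread    : DesarguesianSpread.IsSpreadLine spread axis
      cone∩H         : ∀ X → (TitsCone.pointSet cone X × X ⊑ hyperplane) ⇔
                             X ⊑ axis
      pointSet       : ∀ Q → U Q ⇔ (∃ λ X →
        abbPointSet spread (TitsCone.pointSet cone) axis X ×
        Inverse.to (Isomorphism.onPoints identification) X ≈ Q)

-- Here q = 2²ᵉ⁺¹ is the order of F, and σ = 2ᵉ⁺¹.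

record IsBuekenhoutTitsUnital (e : ℕ) {F K : Field} (ι : Embedding F K)
                              (U : PointSet K 2) : Set₁ where
  field
    isUnital           : IsUnital (2 ℕ.^ (2 ℕ.* e ℕ.+ 1)) U
    arisesFromTitsCone : ABB.ArisesFromTitsCone F K ι (2 ℕ.^ (e ℕ.+ 1)) U

{-# OPTIONS --safe #-}
module Submission where

-- Let q be the order of F.  Field reduction identifies the hyperplane at infinity
-- with K², so the affine points of the André/Bruck–Bose plane carry coordinates
-- (x , y) over K.  In suitable coordinates the affine points of a Buekenhout–Tits
-- unital are
--
--   x = s u + t,   y = p + s d + z w,   z = s ^ (σ + 2) + t ^ σ + s t   (s, t, p in F)
--
-- for some u, w outside F and some d in K, and its point at infinity is that of the
-- lines x = constant.  Indeed, the apex of the cone lies at infinity: otherwise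
-- projecting three independent points of the ovoid from the apex would give three
-- independent points of the axis, which is a line (apex∈H).  Hence a point of the
-- ovoid lies on the axis (pole-on-axis), and since the group of the ovoid is
-- transitive on its points, it may be taken to be the pole (0 , 0 , 0 , 1).  No
-- other point of the ovoid is at infinity, so the tangent plane at the pole is, and
-- writing its vectors over a K-basis of K² gives u, d and w (cone-vector).
--
-- The identification of the plane with PG(2, K) is an arbitrary isomorphism of
-- incidence structures.  By the fundamental theorem of projective geometry it is
-- given by a linear map and an automorphism α of K (AffineCollineation).  Now α
-- preserves F, whose elements are the roots of X ^ q + X, and commutes with the
-- formula for z.  It therefore only changes the parameters (u , w , d) into
-- (α u , α w , α d), and every unital is the image of some coordinate form under a
-- linear map (semilinear-image, coordinate-form).
--
-- Finally, all parameters are equivalent under PGL(3, K) (normalise).  The ovoid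
-- has the automorphisms (s , t) ↦ (δ s + a , δ ^ (σ + 1) t + a ^ σ δ s), which
-- multiply z by δ ^ (σ + 2) and add an affine function of s and t.  They realise
-- every change of u by an affine map of F, hence every change of u; adding to y an
-- affine function of x over K removes that function and d, and scaling y changes w.
--
-- Arguments about dimensions are replaced by counting: an injective map between
-- finite sets of the same size is surjective.

open import Defs
open import Algebra.Bundles using (CommutativeRing; RawRing)
open import Algebra.Module.Morphism.Structures using (module LeftModuleMorphisms)
open import Algebra.Morphism.Structures using (module RingMorphisms)
import Algebra.Properties.CommutativeMonoid.Sum as CommutativeMonoidSum
import Algebra.Properties.CommutativeSemiring.Exp as Exp
import Algebra.Properties.Semiring.Mult as Mult
import Algebra.Solver.Ring as RingSolver
open import Algebra.Solver.Ring.AlmostCommutativeRing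
  using (AlmostCommutativeRing; fromCommutativeRing; _-Raw-AlmostCommutative⟶_)
open import Data.Bool.Base using (Bool; true; false; _xor_; _∧_)
open import Data.Empty using (⊥; ⊥-elim)
open import Data.Fin.Base using (Fin; zero; suc; punchIn; punchOut)
open import Data.Fin.Permutation using (Permutation′; _⟨$⟩ʳ_)
import Data.Fin.Properties as Fin
open import Data.Maybe.Base using (Maybe; just; nothing)
open import Data.Nat.Base as ℕ using (ℕ; zero; suc; s≤s; z≤n)
import Data.Nat.Properties as ℕ
open import Data.Product using (∃; ∃₂; _×_; _,_; proj₁; proj₂)
open import Data.Product.Function.NonDependent.Propositional using (_×-↔_)
open import Data.Sum.Base using (_⊎_; inj₁; inj₂)
open import Data.Unit.Base using (tt)
open import Data.Vec.Base using (Vec; []; _∷_; replicate; map; zipWith)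
open import Data.Vec.Properties using (∷-injectiveˡ; ∷-injectiveʳ)
open import Data.Vec.Relation.Unary.All using (All; []; _∷_)
open import Function.Base using (_∘_)
open import Function.Bundles using (_⇔_; _↔_; Equivalence; Inverse; mk⇔; mk↔ₛ′; mk↣)
import Function.Construct.Composition as Compose
import Function.Construct.Symmetry as Symmetry
open import Level using (0ℓ)
open import Relation.Binary.Bundles using (Setoid)
open import Relation.Binary.Definitions using (DecidableEquality)
open import Relation.Binary.PropositionalEquality
open import Relation.Nullary.Decidable using (Dec; yes; no; via-injection)
open import Relation.Nullary.Negation using (¬_; contradiction)
open import Relation.Unary using (_≐_)
open ≡-Reasoning

-- Counting in finite sets

private
  Fin-injective⇒surjective : ∀ {n} (f : Fin n → Fin n) →
    (∀ {i j} → f i ≡ f j → i ≡ j) → ∀ j → ∃ λ i → f i ≡ j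
  Fin-injective⇒surjective {suc n} f inj j with Fin.any? (λ i → f i Fin.≟ j)
  ... | yes hit = hit
  ... | no ¬hit = ⊥-elim
    (Fin.<⇒notInjective {f = λ i → punchOut (avoids i)} (ℕ.n<1+n n)
      λ {i} {k} eq → inj (Fin.punchOut-injective (avoids i) (avoids k) eq))
    where
    avoids : ∀ i → j ≢ f i
    avoids i eq = ¬hit (i , sym eq)

  Fin-missed : ∀ {m n} → m ℕ.< n → (f : Fin m → Fin n) → ∃ λ j → ∀ i → f i ≢ j
  Fin-missed {m} {n} m<n f =
    let j , ¬hit = Fin.¬∀⟶∃¬ n _ (λ j → Fin.any? λ i → f i Fin.≟ j) notOnto
    in j , λ i eq → ¬hit (i , eq)
    where
    notOnto : ¬ (∀ j → ∃ λ i → f i ≡ j)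
    notOnto onto = Fin.<⇒notInjective {f = proj₁ ∘ onto} m<n λ {j} {k} eq →
      trans (sym (proj₂ (onto j))) (trans (cong f eq) (proj₂ (onto k)))

module Counting {A B : Set} {m n : ℕ} (A↔ : A ↔ Fin m) (B↔ : B ↔ Fin n) where

  private
    module A = Inverse A↔
    module B = Inverse B↔

    onFin : (A → B) → Fin m → Fin n
    onFin f i = B.to (f (A.from i))

    onFin-to : ∀ f x → onFin f (A.to x) ≡ B.to (f x)
    onFin-to f x = cong (B.to ∘ f) (A.strictlyInverseʳ x)

    A-from-injective : ∀ {i j} → A.from i ≡ A.from j → i ≡ j
    A-from-injective {i} {j} eq =
      trans (sym (A.strictlyInverseˡ i)) (trans (cong A.to eq) (A.strictlyInverseˡ j))

    B-to-injective : ∀ {x y} → B.to x ≡ B.to y → x ≡ y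
    B-to-injective {x} {y} eq =
      trans (sym (B.strictlyInverseʳ x)) (trans (cong B.from eq) (B.strictlyInverseʳ y))

  abstract
    missed : m ℕ.< n → (f : A → B) → ∃ λ y → ∀ x → f x ≢ y
    missed m<n f with Fin-missed m<n (onFin f)
    ... | j , ¬hit = B.from j , λ x eq → ¬hit (A.to x)
      (trans (onFin-to f x) (trans (cong B.to eq) (B.strictlyInverseˡ j)))

    collision : n ℕ.< m → (f : A → B) → ∃₂ λ x y → x ≢ y × f x ≡ f y
    collision n<m f with Fin.pigeonhole n<m (onFin f)
    ... | i , j , i<j , eq =
      A.from i , A.from j , Fin.<⇒≢ i<j ∘ A-from-injective , B-to-injective eq

    injective⇒surjective : m ≡ n → (f : A → B) → (∀ {x y} → f x ≡ f y → x ≡ y) →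
                           ∀ y → ∃ λ x → f x ≡ y
    injective⇒surjective refl f inj y
      with Fin-injective⇒surjective (onFin f) (A-from-injective ∘ inj ∘ B-to-injective) (B.to y)
    ... | i , eq = A.from i , B-to-injective eq

_×-finite_ : ∀ {A B : Set} {m n} → A ↔ Fin m → B ↔ Fin n → (A × B) ↔ Fin (m ℕ.* n)
A↔ ×-finite B↔ = Compose.inverse (A↔ ×-↔ B↔) (Symmetry.inverse Fin.*↔×)

Vec-finite : ∀ {A : Set} {m} → A ↔ Fin m → ∀ n → Vec A n ↔ Fin (m ℕ.^ n)
Vec-finite A↔ zero    = mk↔ₛ′ (λ _ → zero) (λ _ → []) (λ { zero → refl }) (λ { [] → refl })
Vec-finite A↔ (suc n) = Compose.inverse
  (mk↔ₛ′ (λ { (x ∷ xs) → x , xs }) (λ { (x , xs) → x ∷ xs }) (λ _ → refl) (λ { (x ∷ xs) → refl }))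
  (A↔ ×-finite Vec-finite A↔ n)

-- Fields

module FieldProperties (F : Field) where
  open Field F
  open CommutativeRing commutativeRing public
    using (+-identityˡ; +-identityʳ; *-identityˡ; +-assoc; +-comm;
           *-assoc; *-comm; zeroˡ; zeroʳ; distribˡ; distribʳ; -‿inverseʳ; -‿inverseˡ; *-identityʳ;
           +-commutativeMonoid; *-commutativeMonoid; commutativeSemiring)
  open Exp commutativeSemiring public using (^-homo-*; ^-assocʳ; ^-distrib-*)

  infix 9 1/_
  1/_ : ∀ {x} → x ≢ 0# → Carrier
  1/_ {x} x≢0 = proj₁ (invertible x x≢0)

  *-inverseʳ : ∀ {x} (x≢0 : x ≢ 0#) → x * 1/ x≢0 ≡ 1#
  *-inverseʳ {x} x≢0 = proj₂ (invertible x x≢0)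

  *-inverseˡ : ∀ {x} (x≢0 : x ≢ 0#) → 1/ x≢0 * x ≡ 1#
  *-inverseˡ x≢0 = trans (*-comm _ _) (*-inverseʳ x≢0)

  inverse-cancelˡ : ∀ {x} (x≢0 : x ≢ 0#) y → 1/ x≢0 * (x * y) ≡ y
  inverse-cancelˡ x≢0 y = trans (sym (*-assoc _ _ _))
    (trans (cong (_* y) (*-inverseˡ x≢0)) (*-identityˡ y))

  inverse-cancelʳ : ∀ {x} (x≢0 : x ≢ 0#) y → x * (1/ x≢0 * y) ≡ y
  inverse-cancelʳ x≢0 y = trans (sym (*-assoc _ _ _))
    (trans (cong (_* y) (*-inverseʳ x≢0)) (*-identityˡ y))

  *-cancelˡ : ∀ {x y z} → x ≢ 0# → x * y ≡ x * z → y ≡ z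
  *-cancelˡ {x} {y} {z} x≢0 eq =
    trans (sym (inverse-cancelˡ x≢0 y)) (trans (cong (1/ x≢0 *_) eq) (inverse-cancelˡ x≢0 z))

  x*y≡0⇒y≡0 : ∀ {x y} → x ≢ 0# → x * y ≡ 0# → y ≡ 0#
  x*y≡0⇒y≡0 {x} x≢0 eq = *-cancelˡ x≢0 (trans eq (sym (zeroʳ x)))

  *-nonzero : ∀ {x y} → x ≢ 0# → y ≢ 0# → x * y ≢ 0#
  *-nonzero x≢0 y≢0 = y≢0 ∘ x*y≡0⇒y≡0 x≢0

  1/-nonzero : ∀ {x} (x≢0 : x ≢ 0#) → 1/ x≢0 ≢ 0#
  1/-nonzero {x} x≢0 eq = 0≢1 (trans (sym (zeroʳ x)) (trans (cong (x *_) (sym eq)) (*-inverseʳ x≢0)))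

  ^-nonzero : ∀ {x} → x ≢ 0# → ∀ n → x ^ n ≢ 0#
  ^-nonzero x≢0 zero    = 0≢1 ∘ sym
  ^-nonzero x≢0 (suc n) = *-nonzero x≢0 (^-nonzero x≢0 n)

  1^n≡1 : ∀ n → 1# ^ n ≡ 1#
  1^n≡1 zero    = refl
  1^n≡1 (suc n) = trans (*-identityˡ _) (1^n≡1 n)

HasCharacteristic2 : Field → Set
HasCharacteristic2 F = 1# + 1# ≡ 0#
  where open Field F

-- Coefficients in 𝔽₂ make the solver decide polynomial identities modulo 2.
module Characteristic2 (F : Field) (1+1≡0 : HasCharacteristic2 F) where
  open Field F
  open FieldProperties F public

  private
    𝔽₂ : RawRing 0ℓ 0ℓ
    𝔽₂ = record { Carrier = Bool ; _≈_ = _≡_ ; _+_ = _xor_ ; _*_ = _∧_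
                ; -_ = λ b → b ; 0# = false ; 1# = true }

    -1≡1 : - 1# ≡ 1#
    -1≡1 = begin
      - 1#               ≡⟨ +-identityˡ _ ⟨
      0# + - 1#          ≡⟨ cong (_+ - 1#) 1+1≡0 ⟨
      1# + 1# + - 1#     ≡⟨ +-assoc _ _ _ ⟩
      1# + (1# + - 1#)   ≡⟨ cong (1# +_) (-‿inverseʳ 1#) ⟩
      1# + 0#            ≡⟨ +-identityʳ 1# ⟩
      1#                 ∎

    -0≡0 : - 0# ≡ 0#
    -0≡0 = trans (sym (+-identityˡ _)) (-‿inverseʳ 0#)

    ring : AlmostCommutativeRing 0ℓ 0ℓ
    ring = fromCommutativeRing commutativeRing

    fromBool : Bool → Carrier
    fromBool false = 0#
    fromBool true  = 1#

    morphism : 𝔽₂ -Raw-AlmostCommutative⟶ ring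
    morphism = record
      { ⟦_⟧    = fromBool
      ; +-homo = λ { false false → sym (+-identityˡ _) ; false true → sym (+-identityˡ _)
                   ; true false → sym (+-identityʳ _) ; true true → sym 1+1≡0 }
      ; *-homo = λ { false _ → sym (zeroˡ _) ; true _ → sym (*-identityˡ _) }
      ; -‿homo = λ { false → sym -0≡0 ; true → sym -1≡1 }
      ; 0-homo = refl
      ; 1-homo = refl
      }

    coefficient≟ : (a b : Bool) → Maybe (fromBool a ≡ fromBool b)
    coefficient≟ false false = just refl
    coefficient≟ true  true  = just refl
    coefficient≟ _     _     = nothing

  open RingSolver 𝔽₂ ring morphism coefficient≟ public
    using (solve; _:=_; _:+_; _:*_; _:^_; con; Polynomial)

  :0 :1 : ∀ {n} → Polynomial n
  :0 = con false
  :1 = con true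

  x+x≡0 : ∀ x → x + x ≡ 0#
  x+x≡0 = solve 1 (λ x → x :+ x := :0) refl

  x+y≡0⇒x≡y : ∀ {x y} → x + y ≡ 0# → x ≡ y
  x+y≡0⇒x≡y {x} {y} eq = begin
    x           ≡⟨ solve 2 (λ x y → x := x :+ y :+ y) refl x y ⟩
    x + y + y   ≡⟨ cong (_+ y) eq ⟩
    0# + y      ≡⟨ +-identityˡ y ⟩
    y           ∎

  -x≡x : ∀ x → - x ≡ x
  -x≡x x = sym (x+y≡0⇒x≡y (-‿inverseʳ x))

  ^2^-distrib-+ : ∀ x y n → (x + y) ^ (2 ℕ.^ n) ≡ x ^ (2 ℕ.^ n) + y ^ (2 ℕ.^ n)
  ^2^-distrib-+ x y zero    = solve 2 (λ x y → (x :+ y) :* :1 := x :* :1 :+ y :* :1) refl x y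
  ^2^-distrib-+ x y (suc n) = begin
    (x + y) ^ (2 ℕ.* m)               ≡⟨ ^-assocʳ (x + y) 2 m ⟨
    ((x + y) ^ 2) ^ m                 ≡⟨ cong (_^ m) (solve 2 (λ x y → (x :+ y) :^ 2 := x :^ 2 :+ y :^ 2) refl x y) ⟩
    (x ^ 2 + y ^ 2) ^ m               ≡⟨ ^2^-distrib-+ (x ^ 2) (y ^ 2) n ⟩
    (x ^ 2) ^ m + (y ^ 2) ^ m         ≡⟨ cong₂ _+_ (^-assocʳ x 2 m) (^-assocʳ y 2 m) ⟩
    x ^ (2 ℕ.* m) + y ^ (2 ℕ.* m)     ∎
    where m = 2 ℕ.^ n

-- A monic polynomial is given by its lower coefficients, the constant term first.
module MonicPolynomials (F : Field) (1+1≡0 : HasCharacteristic2 F) where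
  open Field F
  open Characteristic2 F 1+1≡0

  eval : ∀ {n} → Vec Carrier n → Carrier → Carrier
  eval []       x = 1#
  eval (c ∷ cs) x = c + x * eval cs x

  quotient : ∀ {n} → Vec Carrier (suc n) → Carrier → Vec Carrier n
  quotient (_ ∷ [])           a = []
  quotient (_ ∷ cs@(_ ∷ _)) a = eval cs a ∷ quotient cs a

  eval-quotient : ∀ {n} (cs : Vec Carrier (suc n)) a x →
    eval cs x + eval cs a ≡ (x + a) * eval (quotient cs a) x
  eval-quotient (c ∷ []) a x = solve 3 (λ c a x →
    c :+ x :* :1 :+ (c :+ a :* :1) := (x :+ a) :* :1) refl c a x
  eval-quotient (c ∷ cs@(_ ∷ _)) a x = begin
    c + x * p + (c + a * r)        ≡⟨ solve 5 (λ c a x p r →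
      c :+ x :* p :+ (c :+ a :* r) := (x :+ a) :* r :+ x :* (p :+ r)) refl c a x p r ⟩
    (x + a) * r + x * (p + r)      ≡⟨ cong (λ d → (x + a) * r + x * d) (eval-quotient cs a x) ⟩
    (x + a) * r + x * ((x + a) * s) ≡⟨ solve 4 (λ a x r s →
      (x :+ a) :* r :+ x :* ((x :+ a) :* s) := (x :+ a) :* (r :+ x :* s)) refl a x r s ⟩
    (x + a) * (r + x * s)          ∎
    where
    p = eval cs x
    r = eval cs a
    s = eval (quotient cs a) x

  -- Dividing by x - r 0 leaves the other roots as roots of the quotient.
  tooManyRoots : ∀ {n} (cs : Vec Carrier n) (r : Fin (suc n) → Carrier) →
    (∀ {i j} → r i ≡ r j → i ≡ j) → ¬ (∀ i → eval cs (r i) ≡ 0#)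
  tooManyRoots []          r inj root = 0≢1 (sym (root zero))
  tooManyRoots cs@(_ ∷ _) r inj root =
    tooManyRoots (quotient cs (r zero)) (r ∘ suc) (Fin.suc-injective ∘ inj) λ i →
      x*y≡0⇒y≡0 (λ eq → Fin.0≢1+n (sym (inj (x+y≡0⇒x≡y eq)))) (begin
        (r (suc i) + r zero) * eval (quotient cs (r zero)) (r (suc i)) ≡⟨ eval-quotient cs (r zero) (r (suc i)) ⟨
        eval cs (r (suc i)) + eval cs (r zero)                         ≡⟨ cong₂ _+_ (root (suc i)) (root zero) ⟩
        0# + 0#                                                        ≡⟨ +-identityˡ 0# ⟩
        0#                                                             ∎)

  eval-replicate : ∀ m x → eval (replicate m 0#) x ≡ x ^ m
  eval-replicate zero    x = refl
  eval-replicate (suc m) x = trans (+-identityˡ _) (cong (x *_) (eval-replicate m x))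

  -- The fixed points are the roots of X ^ q + X, whose lower coefficients are
  -- 0 , 1 , 0 , … , 0.
  noMoreFixedPoints : ∀ q → 1 ℕ.< q → (r : Fin (suc q) → Carrier) →
    (∀ {i j} → r i ≡ r j → i ≡ j) → ¬ (∀ i → r i ^ q ≡ r i)
  noMoreFixedPoints (suc zero)    (s≤s ()) r inj fixed
  noMoreFixedPoints (suc (suc m)) _ r inj fixed =
    tooManyRoots (0# ∷ 1# ∷ replicate m 0#) r inj λ i → begin
      0# + r i * (1# + r i * eval (replicate m 0#) (r i)) ≡⟨ cong (λ p → 0# + r i * (1# + r i * p)) (eval-replicate m (r i)) ⟩
      0# + r i * (1# + r i * r i ^ m)                     ≡⟨ solve 2 (λ x y →
        :0 :+ x :* (:1 :+ x :* y) := x :+ x :* (x :* y)) refl (r i) (r i ^ m) ⟩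
      r i + r i ^ suc (suc m)                             ≡⟨ cong (r i +_) (fixed i) ⟩
      r i + r i                                           ≡⟨ x+x≡0 (r i) ⟩
      0#                                                  ∎

module FiniteField (F : Field) {q : ℕ} (order : HasOrder F q) where
  open Field F
  open FieldProperties F
  private module E = Inverse order

  _≟_ : DecidableEquality Carrier
  _≟_ = via-injection (mk↣ {to = E.to} λ {x} {y} eq →
    trans (sym (E.strictlyInverseʳ x)) (trans (cong E.from eq) (E.strictlyInverseʳ y))) Fin._≟_

  private
    permutation : (f g : Carrier → Carrier) → (∀ x → f (g x) ≡ x) → (∀ x → g (f x) ≡ x) →
                  Permutation′ q
    permutation f g fg gf = mk↔ₛ′ (E.to ∘ f ∘ E.from) (E.to ∘ g ∘ E.from) (conj f g fg) (conj g f gf)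
      where
      conj : ∀ f g → (∀ x → f (g x) ≡ x) → ∀ i → E.to (f (E.from (E.to (g (E.from i))))) ≡ i
      conj f g fg i = begin
        E.to (f (E.from (E.to (g (E.from i))))) ≡⟨ cong (E.to ∘ f) (E.strictlyInverseʳ _) ⟩
        E.to (f (g (E.from i)))                 ≡⟨ cong E.to (fg _) ⟩
        E.to (E.from i)                         ≡⟨ E.strictlyInverseˡ i ⟩
        i                                       ∎

  private
    module Σ′ = CommutativeMonoidSum +-commutativeMonoid
    module Π′ = CommutativeMonoidSum *-commutativeMonoid
    module Mul = Mult semiring

  -- Translation by 1 permutes the field, hence fixes the sum of all elements.
  order×1≡0 : (q Mul.× 1#) ≡ 0#
  order×1≡0 = begin
    (q Mul.× 1#)                   ≡⟨ +-identityˡ _ ⟨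
    0# + (q Mul.× 1#)              ≡⟨ cong (_+ (q Mul.× 1#)) (-‿inverseˡ total) ⟨
    - total + total + (q Mul.× 1#) ≡⟨ +-assoc _ _ _ ⟩
    - total + (total + (q Mul.× 1#)) ≡⟨ cong (- total +_) (sym shifted) ⟩
    - total + total            ≡⟨ -‿inverseˡ total ⟩
    0#                         ∎
    where
    total = Σ′.sum E.from
    π = permutation (_+ 1#) (_+ - 1#)
      (λ x → trans (+-assoc _ _ _) (trans (cong (x +_) (-‿inverseˡ 1#)) (+-identityʳ x)))
      (λ x → trans (+-assoc _ _ _) (trans (cong (x +_) (-‿inverseʳ 1#)) (+-identityʳ x)))
    shifted : total ≡ total + (q Mul.× 1#)
    shifted = begin
      Σ′.sum E.from                      ≡⟨ Σ′.sum-permute E.from π ⟩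
      Σ′.sum (λ i → E.from (π ⟨$⟩ʳ i))    ≡⟨ Σ′.sum-cong-≗ {q} (λ i → E.strictlyInverseʳ (E.from i + 1#)) ⟩
      Σ′.sum (λ i → E.from i + 1#)       ≡⟨ Σ′.∑-distrib-+ {q} E.from (λ _ → 1#) ⟩
      total + Σ′.sum {q} (λ _ → 1#)      ≡⟨ cong (total +_) (Σ′.sum-replicate q) ⟩
      total + (q Mul.× 1#)                   ∎

  -- Multiplication by x ≢ 0 permutes the nonzero elements, hence fixes their
  -- product; nonzeroPart and atZero keep the products over the whole field.
  frobenius-fixed : ∀ x → x ^ q ≡ x
  frobenius-fixed x with x ≟ 0#
  ... | yes refl = 0^n≡0 (E.to 0#)
    where
    0^n≡0 : ∀ {n} → Fin n → 0# ^ n ≡ 0#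
    0^n≡0 {suc n} _ = zeroˡ _
  ... | no x≢0   = sym (*-cancelˡ total≢0 (begin
      total * x                                     ≡⟨ cong₂ _*_ (permuted x≢0) (sym (product-atZero x)) ⟩
      Π′.sum (λ i → nonzeroPart (x * E.from i)) * Π′.sum (atZero x ∘ E.from)
        ≡⟨ Π′.∑-distrib-+ (λ i → nonzeroPart (x * E.from i)) (atZero x ∘ E.from) ⟨
      Π′.sum (λ i → nonzeroPart (x * E.from i) * atZero x (E.from i))
        ≡⟨ Π′.sum-cong-≗ (λ i → split x≢0 (E.from i)) ⟩
      Π′.sum (λ i → nonzeroPart (E.from i) * x)      ≡⟨ Π′.∑-distrib-+ {q} (nonzeroPart ∘ E.from) (λ _ → x) ⟩
      total * Π′.sum {q} (λ _ → x)                   ≡⟨ cong (total *_) (Π′.sum-replicate q) ⟩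
      total * x ^ q                                 ∎))
    where
    nonzeroPart : Carrier → Carrier
    nonzeroPart y with y ≟ 0#
    ... | yes _ = 1#
    ... | no  _ = y

    atZero : Carrier → Carrier → Carrier
    atZero x y with y ≟ 0#
    ... | yes _ = x
    ... | no  _ = 1#

    total = Π′.sum (nonzeroPart ∘ E.from)

    split : ∀ {x} → x ≢ 0# → ∀ y → nonzeroPart (x * y) * atZero x y ≡ nonzeroPart y * x
    split {x} x≢0 y with y ≟ 0# | (x * y) ≟ 0#
    ... | yes _    | yes _    = refl
    ... | yes refl | no xy≢0  = contradiction (zeroʳ x) xy≢0
    ... | no y≢0   | yes xy≡0 = contradiction xy≡0 (*-nonzero x≢0 y≢0)
    ... | no _     | no _     = trans (*-identityʳ _) (*-comm x y)

    nonzeroPart≢0 : ∀ y → nonzeroPart y ≢ 0#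
    nonzeroPart≢0 y with y ≟ 0#
    ... | yes _  = 0≢1 ∘ sym
    ... | no y≢0 = y≢0

    product≢0 : ∀ {n} (f : Fin n → Carrier) → (∀ i → f i ≢ 0#) → Π′.sum f ≢ 0#
    product≢0 {zero}  f f≢0 = 0≢1 ∘ sym
    product≢0 {suc n} f f≢0 = *-nonzero (f≢0 zero) (product≢0 (f ∘ suc) (f≢0 ∘ suc))

    total≢0 : total ≢ 0#
    total≢0 = product≢0 (nonzeroPart ∘ E.from) (nonzeroPart≢0 ∘ E.from)

    permuted : ∀ {x} → x ≢ 0# → total ≡ Π′.sum (λ i → nonzeroPart (x * E.from i))
    permuted {x} x≢0 = trans
      (Π′.sum-permute (nonzeroPart ∘ E.from)
        (permutation (x *_) (1/ x≢0 *_) (inverse-cancelʳ x≢0) (inverse-cancelˡ x≢0)))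
      (Π′.sum-cong-≗ {q} (λ i → cong nonzeroPart (E.strictlyInverseʳ (x * E.from i))))

    atZero-0 : ∀ x → atZero x 0# ≡ x
    atZero-0 x with 0# ≟ 0#
    ... | yes _  = refl
    ... | no 0≢0 = contradiction refl 0≢0

    atZero-nonzero : ∀ x {y} → y ≢ 0# → atZero x y ≡ 1#
    atZero-nonzero x {y} y≢0 with y ≟ 0#
    ... | yes y≡0 = contradiction y≡0 y≢0
    ... | no _    = refl

    product-single : ∀ {n} (f : Fin n → Carrier) i → (∀ j → i ≢ j → f j ≡ 1#) → Π′.sum f ≡ f i
    product-single {suc n} f i others = begin
      Π′.sum f                              ≡⟨ Π′.sum-remove {i = i} f ⟩
      f i * Π′.sum (λ j → f (punchIn i j))  ≡⟨ cong (f i *_) (Π′.sum-cong-≗ λ j → others (punchIn i j) (Fin.punchInᵢ≢i i j ∘ sym)) ⟩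
      f i * Π′.sum {n} (λ _ → 1#)           ≡⟨ cong (f i *_) (Π′.sum-replicate-zero n) ⟩
      f i * 1#                              ≡⟨ *-identityʳ _ ⟩
      f i                                   ∎

    product-atZero : ∀ x → Π′.sum (atZero x ∘ E.from) ≡ x
    product-atZero x = begin
      Π′.sum (atZero x ∘ E.from)  ≡⟨ product-single (atZero x ∘ E.from) (E.to 0#) (λ j ≢j →
        atZero-nonzero x λ eq → ≢j (trans (cong E.to (sym eq)) (E.strictlyInverseˡ j))) ⟩
      atZero x (E.from (E.to 0#)) ≡⟨ cong (atZero x) (E.strictlyInverseʳ 0#) ⟩
      atZero x 0#                 ≡⟨ atZero-0 x ⟩
      x                           ∎

  1<order : 1 ℕ.< q
  1<order = atLeastTwo order
    where
    Fin1-single : (i j : Fin 1) → i ≡ j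
    Fin1-single zero zero = refl
    atLeastTwo : ∀ {n} → HasOrder F n → 1 ℕ.< n
    atLeastTwo {zero}        b = contradiction (Inverse.to b 0#) λ ()
    atLeastTwo {suc zero}    b = contradiction
      (trans (sym (Inverse.strictlyInverseʳ b 0#))
        (trans (cong (Inverse.from b) (Fin1-single _ _)) (Inverse.strictlyInverseʳ b 1#))) 0≢1
    atLeastTwo {suc (suc _)} b = s≤s (s≤s z≤n)

-- The multiple 2 ^ n of 1 is a power of 1 + 1, and a field has no zero divisors.
order-2^n⇒1+1≡0 : (F : Field) → ∀ n → HasOrder F (2 ℕ.^ n) → HasCharacteristic2 F
order-2^n⇒1+1≡0 F n order = divide n (FiniteField.order×1≡0 F order)
  where
  open Field F
  open FieldProperties F
  module Mul = Mult semiring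
  2×1≡ : (2 Mul.× 1#) ≡ 1# + 1#
  2×1≡ = cong (1# +_) (+-identityʳ 1#)
  divide : ∀ n → ((2 ℕ.^ n) Mul.× 1#) ≡ 0# → 1# + 1# ≡ 0#
  divide zero    eq = contradiction (trans (sym eq) (+-identityʳ 1#)) 0≢1
  divide (suc n) eq with FiniteField._≟_ F order (1# + 1#) 0#
  ... | yes 2≡0 = 2≡0
  ... | no  2≢0 = divide n (x*y≡0⇒y≡0 2≢0 (begin
    (1# + 1#) * ((2 ℕ.^ n) Mul.× 1#)   ≡⟨ cong (_* ((2 ℕ.^ n) Mul.× 1#)) 2×1≡ ⟨
    (2 Mul.× 1#) * ((2 ℕ.^ n) Mul.× 1#)    ≡⟨ Mul.×1-homo-* 2 (2 ℕ.^ n) ⟨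
    ((2 ℕ.* 2 ℕ.^ n) Mul.× 1#)         ≡⟨ eq ⟩
    0#                             ∎))

-- The function defining the Tits ovoid

module TitsForm (F : Field) (e : ℕ) (order : HasOrder F (2 ℕ.^ (2 ℕ.* e ℕ.+ 1))) where
  open Field F

  1+1≡0 : 1# + 1# ≡ 0#
  1+1≡0 = order-2^n⇒1+1≡0 F (2 ℕ.* e ℕ.+ 1) order

  open Characteristic2 F 1+1≡0
  open FiniteField F order using (_≟_; frobenius-fixed)

  infix 9 _^σ
  _^σ : Carrier → Carrier
  x ^σ = x ^ (2 ℕ.^ (e ℕ.+ 1))

  σ-+ : ∀ x y → (x + y) ^σ ≡ x ^σ + y ^σ
  σ-+ x y = ^2^-distrib-+ x y (e ℕ.+ 1)

  σ-* : ∀ x y → (x * y) ^σ ≡ x ^σ * y ^σ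
  σ-* x y = ^-distrib-* x y (2 ℕ.^ (e ℕ.+ 1))

  private
    σ*σ≡2*q : 2 ℕ.^ (e ℕ.+ 1) ℕ.* 2 ℕ.^ (e ℕ.+ 1) ≡ 2 ℕ.^ (2 ℕ.* e ℕ.+ 1) ℕ.* 2
    σ*σ≡2*q = begin
      2 ℕ.^ (e ℕ.+ 1) ℕ.* 2 ℕ.^ (e ℕ.+ 1) ≡⟨ ℕ.^-distribˡ-+-* 2 (e ℕ.+ 1) (e ℕ.+ 1) ⟨
      2 ℕ.^ (e ℕ.+ 1 ℕ.+ (e ℕ.+ 1))       ≡⟨ cong (2 ℕ.^_) (sym (ℕ.+-assoc (e ℕ.+ 1) e 1)) ⟩
      2 ℕ.^ (e ℕ.+ 1 ℕ.+ e ℕ.+ 1)         ≡⟨ cong (λ m → 2 ℕ.^ (m ℕ.+ 1)) (begin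
        e ℕ.+ 1 ℕ.+ e           ≡⟨ ℕ.+-assoc e 1 e ⟩
        e ℕ.+ suc e             ≡⟨ ℕ.+-suc e e ⟩
        suc (e ℕ.+ e)           ≡⟨ ℕ.+-comm 1 (e ℕ.+ e) ⟩
        e ℕ.+ e ℕ.+ 1           ≡⟨ cong (λ d → e ℕ.+ d ℕ.+ 1) (ℕ.+-identityʳ e) ⟨
        2 ℕ.* e ℕ.+ 1           ∎) ⟩
      2 ℕ.^ (2 ℕ.* e ℕ.+ 1 ℕ.+ 1)         ≡⟨ ℕ.^-distribˡ-+-* 2 (2 ℕ.* e ℕ.+ 1) 1 ⟩
      2 ℕ.^ (2 ℕ.* e ℕ.+ 1) ℕ.* 2         ∎

    2^e*σ≡q : 2 ℕ.^ e ℕ.* 2 ℕ.^ (e ℕ.+ 1) ≡ 2 ℕ.^ (2 ℕ.* e ℕ.+ 1)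
    2^e*σ≡q = begin
      2 ℕ.^ e ℕ.* 2 ℕ.^ (e ℕ.+ 1) ≡⟨ ℕ.^-distribˡ-+-* 2 e (e ℕ.+ 1) ⟨
      2 ℕ.^ (e ℕ.+ (e ℕ.+ 1))     ≡⟨ cong (2 ℕ.^_) (sym (ℕ.+-assoc e e 1)) ⟩
      2 ℕ.^ (e ℕ.+ e ℕ.+ 1)       ≡⟨ cong (λ d → 2 ℕ.^ (e ℕ.+ d ℕ.+ 1)) (ℕ.+-identityʳ e) ⟨
      2 ℕ.^ (2 ℕ.* e ℕ.+ 1)       ∎

  -- The exponents satisfy σ * σ = 2 * q, and x ^ q = x.
  σσ : ∀ x → (x ^σ) ^σ ≡ x * x
  σσ x = begin
    (x ^σ) ^σ                                    ≡⟨ ^-assocʳ x (2 ℕ.^ (e ℕ.+ 1)) (2 ℕ.^ (e ℕ.+ 1)) ⟩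
    x ^ (2 ℕ.^ (e ℕ.+ 1) ℕ.* 2 ℕ.^ (e ℕ.+ 1))   ≡⟨ cong (x ^_) σ*σ≡2*q ⟩
    x ^ (2 ℕ.^ (2 ℕ.* e ℕ.+ 1) ℕ.* 2)           ≡⟨ ^-assocʳ x (2 ℕ.^ (2 ℕ.* e ℕ.+ 1)) 2 ⟨
    (x ^ (2 ℕ.^ (2 ℕ.* e ℕ.+ 1))) ^ 2           ≡⟨ cong (_^ 2) (frobenius-fixed x) ⟩
    x ^ 2                                        ≡⟨ solve 1 (λ x → x :^ 2 := x :* x) refl x ⟩
    x * x                                        ∎

  σ-root : ∀ x → ∃ λ y → y ^σ ≡ x
  σ-root x = x ^ (2 ℕ.^ e)
    , trans (^-assocʳ x (2 ℕ.^ e) (2 ℕ.^ (e ℕ.+ 1))) (trans (cong (x ^_) 2^e*σ≡q) (frobenius-fixed x))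

  1^σ : 1# ^σ ≡ 1#
  1^σ = 1^n≡1 (2 ℕ.^ (e ℕ.+ 1))

  0^σ : 0# ^σ ≡ 0#
  0^σ = trans (cong _^σ (sym (+-identityˡ 0#))) (trans (σ-+ 0# 0#) (x+x≡0 (0# ^σ)))

  tits : Carrier → Carrier → Carrier
  tits s t = s ^ (2 ℕ.^ (e ℕ.+ 1) ℕ.+ 2) + t ^σ + s * t

  tits-expand : ∀ s t → tits s t ≡ s ^σ * (s * s) + t ^σ + s * t
  tits-expand s t = cong (λ x → x + t ^σ + s * t)
    (trans (^-homo-* s (2 ℕ.^ (e ℕ.+ 1)) 2) (cong (λ x → s ^σ * (s * x)) (*-identityʳ s)))

  private
    tits-expand′ : ∀ s t {S T} → s ^σ ≡ S → t ^σ ≡ T → tits s t ≡ S * (s * s) + T + s * t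
    tits-expand′ s t refl refl = tits-expand s t

  -- The terms a² s ^σ and a ^σ s² of (s + a) ^ (σ + 2) are cancelled by those that
  -- a ^σ s contributes, so that only a linear form and a constant are added.
  tits-translate : ∀ a b s t → tits (s + a) (t + (a ^σ * s + b)) ≡
                               tits s t + ((b + a ^σ * a) * s + a * t) + tits a b
  tits-translate a b s t = begin
    tits (s + a) (t + (a ^σ * s + b))
      ≡⟨ tits-expand′ (s + a) _ (σ-+ s a) (begin
        (t + (a ^σ * s + b)) ^σ           ≡⟨ σ-+ t _ ⟩
        t ^σ + (a ^σ * s + b) ^σ          ≡⟨ cong (t ^σ +_) (σ-+ _ b) ⟩
        t ^σ + ((a ^σ * s) ^σ + b ^σ)     ≡⟨ cong (λ x → t ^σ + (x + b ^σ)) (σ-* (a ^σ) s) ⟩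
        t ^σ + ((a ^σ) ^σ * s ^σ + b ^σ)  ≡⟨ cong (λ x → t ^σ + (x * s ^σ + b ^σ)) (σσ a) ⟩
        t ^σ + (a * a * s ^σ + b ^σ)      ∎) ⟩
    (s ^σ + a ^σ) * ((s + a) * (s + a)) + (t ^σ + (a * a * s ^σ + b ^σ))
      + (s + a) * (t + (a ^σ * s + b))
      ≡⟨ solve 8 (λ a b s t A B S T →
        (S :+ A) :* ((s :+ a) :* (s :+ a)) :+ (T :+ (a :* a :* S :+ B)) :+ (s :+ a) :* (t :+ (A :* s :+ b)) :=
        (S :* (s :* s) :+ T :+ s :* t) :+ ((b :+ A :* a) :* s :+ a :* t) :+ (A :* (a :* a) :+ B :+ a :* b))
        refl a b s t (a ^σ) (b ^σ) (s ^σ) (t ^σ) ⟩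
    (s ^σ * (s * s) + t ^σ + s * t) + ((b + a ^σ * a) * s + a * t) + (a ^σ * (a * a) + b ^σ + a * b)
      ≡⟨ cong₂ (λ x y → x + ((b + a ^σ * a) * s + a * t) + y) (tits-expand s t) (tits-expand a b) ⟨
    tits s t + ((b + a ^σ * a) * s + a * t) + tits a b ∎

  -- The factors agree because (d ^ (σ + 1)) ^ σ = d ^ (σ + 2).
  tits-scale : ∀ d s t → tits (d * s) (d ^σ * d * t) ≡ d ^σ * (d * d) * tits s t
  tits-scale d s t = begin
    tits (d * s) (d ^σ * d * t)
      ≡⟨ tits-expand′ (d * s) _ (σ-* d s) (begin
        (d ^σ * d * t) ^σ         ≡⟨ σ-* _ t ⟩
        (d ^σ * d) ^σ * t ^σ      ≡⟨ cong (_* t ^σ) (σ-* (d ^σ) d) ⟩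
        (d ^σ) ^σ * d ^σ * t ^σ   ≡⟨ cong (λ x → x * d ^σ * t ^σ) (σσ d) ⟩
        d * d * d ^σ * t ^σ       ∎) ⟩
    d ^σ * s ^σ * (d * s * (d * s)) + d * d * d ^σ * t ^σ + d * s * (d ^σ * d * t)
      ≡⟨ solve 6 (λ d s t D S T →
        D :* S :* (d :* s :* (d :* s)) :+ d :* d :* D :* T :+ d :* s :* (D :* d :* t) :=
        D :* (d :* d) :* (S :* (s :* s) :+ T :+ s :* t))
        refl d s t (d ^σ) (s ^σ) (t ^σ) ⟩
    d ^σ * (d * d) * (s ^σ * (s * s) + t ^σ + s * t)
      ≡⟨ cong (d ^σ * (d * d) *_) (tits-expand s t) ⟨
    d ^σ * (d * d) * tits s t ∎

  tits-00 : tits 0# 0# ≡ 0#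
  tits-00 = trans (tits-expand′ 0# 0# 0^σ 0^σ)
    (solve 0 (:0 :* (:0 :* :0) :+ :0 :+ :0 :* :0 := :0) refl)

  private
    tits^σ : ∀ s t → tits s t ^σ ≡ s * s * (s ^σ * s ^σ) + t * t + s ^σ * t ^σ
    tits^σ s t = begin
      tits s t ^σ                                      ≡⟨ cong _^σ (tits-expand s t) ⟩
      (s ^σ * (s * s) + t ^σ + s * t) ^σ               ≡⟨ trans (σ-+ _ _) (cong (_+ (s * t) ^σ) (σ-+ _ _)) ⟩
      (s ^σ * (s * s)) ^σ + (t ^σ) ^σ + (s * t) ^σ     ≡⟨ cong₂ _+_ (cong₂ _+_
        (trans (σ-* _ _) (cong₂ _*_ (σσ s) (σ-* s s))) (σσ t)) (σ-* s t) ⟩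
      s * s * (s ^σ * s ^σ) + t * t + s ^σ * t ^σ      ∎

  -- The ovoid is invariant under reversing the coordinates: this is the
  -- equation of the ovoid at (t / z , s / z , 1 / z), multiplied by z ^ (σ + 2).
  tits-reverse : ∀ s t → (let z = tits s t) →
    t ^σ * (t * t) + s ^σ * (z * z) + t * s * z ^σ ≡ z * z ^σ
  tits-reverse s t = begin
    T * (t * t) + S * (z * z) + t * s * z ^σ
      ≡⟨ cong₂ (λ z Z → T * (t * t) + S * (z * z) + t * s * Z) (tits-expand s t) (tits^σ s t) ⟩
    T * (t * t) + S * (z′ * z′) + t * s * Z′
      ≡⟨ solve 4 (λ s t S T → let z = S :* (s :* s) :+ T :+ s :* t
                                  Z = s :* s :* (S :* S) :+ t :* t :+ S :* T in
        T :* (t :* t) :+ S :* (z :* z) :+ t :* s :* Z := z :* Z) refl s t S T ⟩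
    z′ * Z′
      ≡⟨ cong₂ _*_ (tits-expand s t) (tits^σ s t) ⟨
    z * z ^σ ∎
    where
    z = tits s t
    S = s ^σ
    T = t ^σ
    z′ = S * (s * s) + T + s * t
    Z′ = s * s * (S * S) + t * t + S * T

  -- For z = 0, tits-reverse leaves t ^ (σ + 2) = 0; then s ^ (σ + 2) = z = 0.
  tits≡0⇒0 : ∀ s t → tits s t ≡ 0# → s ≡ 0# × t ≡ 0#
  tits≡0⇒0 s t z≡0 = s≡0 , t≡0
    where
    z^σ≡0 : tits s t ^σ ≡ 0#
    z^σ≡0 = trans (cong _^σ z≡0) 0^σ
    cube : t ^σ * (t * t) ≡ 0#
    cube = begin
      t ^σ * (t * t)                                         ≡⟨ solve 4 (λ s t S T →
        T :* (t :* t) := T :* (t :* t) :+ S :* (:0 :* :0) :+ t :* s :* :0) refl s t (s ^σ) (t ^σ) ⟩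
      t ^σ * (t * t) + s ^σ * (0# * 0#) + t * s * 0#         ≡⟨ cong₂ (λ z Z → t ^σ * (t * t) + s ^σ * (z * z) + t * s * Z) z≡0 z^σ≡0 ⟨
      t ^σ * (t * t) + s ^σ * (tits s t * tits s t) + t * s * tits s t ^σ ≡⟨ tits-reverse s t ⟩
      tits s t * tits s t ^σ                                 ≡⟨ cong (_* tits s t ^σ) z≡0 ⟩
      0# * tits s t ^σ                                       ≡⟨ zeroˡ _ ⟩
      0#                                                     ∎
    cube≡0⇒0 : ∀ {x} → x ^σ * (x * x) ≡ 0# → x ≡ 0#
    cube≡0⇒0 {x} eq with x ≟ 0#
    ... | yes x≡0 = x≡0
    ... | no x≢0  = contradiction eq (*-nonzero (^-nonzero x≢0 (2 ℕ.^ (e ℕ.+ 1))) (*-nonzero x≢0 x≢0))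
    t≡0 : t ≡ 0#
    t≡0 = cube≡0⇒0 cube
    s≡0 : s ≡ 0#
    s≡0 = cube≡0⇒0 (begin
      s ^σ * (s * s)                  ≡⟨ solve 2 (λ s S → S :* (s :* s) := S :* (s :* s) :+ :0 :+ s :* :0) refl s (s ^σ) ⟩
      s ^σ * (s * s) + 0# + s * 0#    ≡⟨ cong₂ (λ T t → s ^σ * (s * s) + T + s * t) (trans (cong _^σ t≡0) 0^σ) t≡0 ⟨
      s ^σ * (s * s) + t ^σ + s * t   ≡⟨ tits-expand s t ⟨
      tits s t                        ≡⟨ z≡0 ⟩
      0#                              ∎)

  -- This is tits-reverse divided by z ^ (σ + 2).
  tits-invert : ∀ s t (z≢0 : tits s t ≢ 0#) → tits (t * 1/ z≢0) (s * 1/ z≢0) ≡ 1/ z≢0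
  tits-invert s t z≢0 = begin
    tits (t * i) (s * i)
      ≡⟨ tits-expand′ (t * i) (s * i) (σ-* t i) (σ-* s i) ⟩
    T * I * (t * i * (t * i)) + S * I + t * i * (s * i)
      ≡⟨ solve 6 (λ s t i S T I →
        T :* I :* (t :* i :* (t :* i)) :+ S :* I :+ t :* i :* (s :* i) :=
        T :* I :* (t :* i :* (t :* i)) :+ S :* I :* (:1 :* :1) :+ t :* i :* (s :* i) :* :1) refl s t i S T I ⟩
    T * I * (t * i * (t * i)) + S * I * (1# * 1#) + t * i * (s * i) * 1#
      ≡⟨ cong₂ (λ x y → T * I * (t * i * (t * i)) + S * I * (x * x) + t * i * (s * i) * y) zi≡1 ZI≡1 ⟨
    T * I * (t * i * (t * i)) + S * I * ((z * i) * (z * i)) + t * i * (s * i) * (Z * I)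
      ≡⟨ solve 8 (λ s t i S T I z Z →
        T :* I :* (t :* i :* (t :* i)) :+ S :* I :* ((z :* i) :* (z :* i)) :+ t :* i :* (s :* i) :* (Z :* I) :=
        I :* (i :* i) :* (T :* (t :* t) :+ S :* (z :* z) :+ t :* s :* Z)) refl s t i S T I z Z ⟩
    I * (i * i) * (T * (t * t) + S * (z * z) + t * s * Z)
      ≡⟨ cong (I * (i * i) *_) (tits-reverse s t) ⟩
    I * (i * i) * (z * Z)
      ≡⟨ solve 4 (λ i I z Z → I :* (i :* i) :* (z :* Z) := (z :* i) :* ((Z :* I) :* i)) refl i I z Z ⟩
    (z * i) * ((Z * I) * i)
      ≡⟨ cong₂ (λ x y → x * (y * i)) zi≡1 ZI≡1 ⟩
    1# * (1# * i)
      ≡⟨ trans (*-identityˡ _) (*-identityˡ i) ⟩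
    i ∎
    where
    z = tits s t
    i = 1/ z≢0
    S = s ^σ
    T = t ^σ
    I = i ^σ
    Z = z ^σ
    zi≡1 : z * i ≡ 1#
    zi≡1 = *-inverseʳ z≢0
    ZI≡1 : Z * I ≡ 1#
    ZI≡1 = trans (sym (σ-* z i)) (trans (cong _^σ zi≡1) 1^σ)

-- Linear algebra over a finite field of characteristic 2

module LinearAlgebra (F : Field) {q : ℕ} (order : HasOrder F q)
                     (1+1≡0 : HasCharacteristic2 F) where
  open Field F
  open Characteristic2 F 1+1≡0
  open FiniteField F order using (_≟_; 1<order)

  infixl 6 _⊕_
  infixr 7 _⊙_

  _⊕_ : ∀ {n} → Vector F n → Vector F n → Vector F n
  _⊕_ = zipWith _+_

  _⊙_ : ∀ {n} → Carrier → Vector F n → Vector F n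
  c ⊙ v = map (c *_) v

  0ⱽ : ∀ {n} → Vector F n
  0ⱽ {n} = replicate n 0#

  combination : ∀ {n k} → Vector F k → Vec (Vector F n) k → Vector F n
  combination = linearCombination {F}

  ⊕-comm : ∀ {n} (u v : Vector F n) → u ⊕ v ≡ v ⊕ u
  ⊕-comm []      []      = refl
  ⊕-comm (x ∷ u) (y ∷ v) = cong₂ _∷_ (+-comm x y) (⊕-comm u v)

  ⊕-assoc : ∀ {n} (u v w : Vector F n) → (u ⊕ v) ⊕ w ≡ u ⊕ (v ⊕ w)
  ⊕-assoc []      []      []      = refl
  ⊕-assoc (x ∷ u) (y ∷ v) (z ∷ w) = cong₂ _∷_ (+-assoc x y z) (⊕-assoc u v w)

  ⊕-identityˡ : ∀ {n} (v : Vector F n) → 0ⱽ ⊕ v ≡ v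
  ⊕-identityˡ []      = refl
  ⊕-identityˡ (x ∷ v) = cong₂ _∷_ (+-identityˡ x) (⊕-identityˡ v)

  ⊕-identityʳ : ∀ {n} (v : Vector F n) → v ⊕ 0ⱽ ≡ v
  ⊕-identityʳ v = trans (⊕-comm v 0ⱽ) (⊕-identityˡ v)

  ⊕-self : ∀ {n} (v : Vector F n) → v ⊕ v ≡ 0ⱽ
  ⊕-self []      = refl
  ⊕-self (x ∷ v) = cong₂ _∷_ (x+x≡0 x) (⊕-self v)

  ⊙-distribˡ : ∀ {n} c (u v : Vector F n) → c ⊙ (u ⊕ v) ≡ c ⊙ u ⊕ c ⊙ v
  ⊙-distribˡ c []      []      = refl
  ⊙-distribˡ c (x ∷ u) (y ∷ v) = cong₂ _∷_ (distribˡ c x y) (⊙-distribˡ c u v)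

  ⊙-distribʳ : ∀ {n} (v : Vector F n) a b → (a + b) ⊙ v ≡ a ⊙ v ⊕ b ⊙ v
  ⊙-distribʳ []      a b = refl
  ⊙-distribʳ (x ∷ v) a b = cong₂ _∷_ (distribʳ x a b) (⊙-distribʳ v a b)

  ⊙-assoc : ∀ {n} a b (v : Vector F n) → a ⊙ b ⊙ v ≡ (a * b) ⊙ v
  ⊙-assoc a b []      = refl
  ⊙-assoc a b (x ∷ v) = cong₂ _∷_ (sym (*-assoc a b x)) (⊙-assoc a b v)

  ⊙-identity : ∀ {n} (v : Vector F n) → 1# ⊙ v ≡ v
  ⊙-identity []      = refl
  ⊙-identity (x ∷ v) = cong₂ _∷_ (*-identityˡ x) (⊙-identity v)

  ⊙-zeroˡ : ∀ {n} (v : Vector F n) → 0# ⊙ v ≡ 0ⱽ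
  ⊙-zeroˡ []      = refl
  ⊙-zeroˡ (x ∷ v) = cong₂ _∷_ (zeroˡ x) (⊙-zeroˡ v)

  ⊙-zeroʳ : ∀ {n} c → c ⊙ 0ⱽ {n} ≡ 0ⱽ
  ⊙-zeroʳ {zero}  c = refl
  ⊙-zeroʳ {suc n} c = cong₂ _∷_ (zeroʳ c) (⊙-zeroʳ c)

  neg≡id : ∀ {n} (v : Vector F n) → map -_ v ≡ v
  neg≡id []      = refl
  neg≡id (x ∷ v) = cong₂ _∷_ (-x≡x x) (neg≡id v)

  1/-⊙ : ∀ {n c} (c≢0 : c ≢ 0#) (v : Vector F n) → 1/ c≢0 ⊙ c ⊙ v ≡ v
  1/-⊙ c≢0 v = trans (⊙-assoc _ _ v) (trans (cong (_⊙ v) (*-inverseˡ c≢0)) (⊙-identity v))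

  ⊙-cancel-0 : ∀ {n c} → c ≢ 0# → (v : Vector F n) → c ⊙ v ≡ 0ⱽ → v ≡ 0ⱽ
  ⊙-cancel-0 c≢0 v eq = trans (sym (1/-⊙ c≢0 v)) (trans (cong (1/ c≢0 ⊙_) eq) (⊙-zeroʳ _))

  scalar≡0 : ∀ {n} {v : Vector F n} → v ≢ 0ⱽ → ∀ c → c ⊙ v ≡ 0ⱽ → c ≡ 0#
  scalar≡0 {v = v} v≢0 c eq with c ≟ 0#
  ... | yes c≡0 = c≡0
  ... | no c≢0  = contradiction (⊙-cancel-0 c≢0 v eq) v≢0

  u⊕v≡0⇒u≡v : ∀ {n} {u v : Vector F n} → u ⊕ v ≡ 0ⱽ → u ≡ v
  u⊕v≡0⇒u≡v {u = u} {v} eq = begin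
    u             ≡⟨ ⊕-identityʳ u ⟨
    u ⊕ 0ⱽ        ≡⟨ cong (u ⊕_) (⊕-self v) ⟨
    u ⊕ (v ⊕ v)   ≡⟨ ⊕-assoc u v v ⟨
    u ⊕ v ⊕ v     ≡⟨ cong (_⊕ v) eq ⟩
    0ⱽ ⊕ v        ≡⟨ ⊕-identityˡ v ⟩
    v             ∎

  ⊕-cancel-middle : ∀ {n} (u v w : Vector F n) → (u ⊕ v) ⊕ (v ⊕ w) ≡ u ⊕ w
  ⊕-cancel-middle u v w = begin
    (u ⊕ v) ⊕ (v ⊕ w)   ≡⟨ ⊕-assoc u v (v ⊕ w) ⟩
    u ⊕ (v ⊕ (v ⊕ w))   ≡⟨ cong (u ⊕_) (⊕-assoc v v w) ⟨
    u ⊕ ((v ⊕ v) ⊕ w)   ≡⟨ cong (λ x → u ⊕ (x ⊕ w)) (⊕-self v) ⟩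
    u ⊕ (0ⱽ ⊕ w)        ≡⟨ cong (u ⊕_) (⊕-identityˡ w) ⟩
    u ⊕ w               ∎

  ⊕-interchange : ∀ {n} (a b c d : Vector F n) → (a ⊕ b) ⊕ (c ⊕ d) ≡ (a ⊕ c) ⊕ (b ⊕ d)
  ⊕-interchange a b c d = begin
    (a ⊕ b) ⊕ (c ⊕ d)  ≡⟨ ⊕-assoc a b (c ⊕ d) ⟩
    a ⊕ (b ⊕ (c ⊕ d))  ≡⟨ cong (a ⊕_) (trans (sym (⊕-assoc b c d)) (trans (cong (_⊕ d) (⊕-comm b c)) (⊕-assoc c b d))) ⟩
    a ⊕ (c ⊕ (b ⊕ d))  ≡⟨ ⊕-assoc a c (b ⊕ d) ⟨
    (a ⊕ c) ⊕ (b ⊕ d)  ∎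

  combination-⊕ : ∀ {n k} c d (vs : Vec (Vector F n) k) →
    combination (c ⊕ d) vs ≡ combination c vs ⊕ combination d vs
  combination-⊕ []      []      []       = sym (⊕-self 0ⱽ)
  combination-⊕ (x ∷ c) (y ∷ d) (v ∷ vs) = begin
    (x + y) ⊙ v ⊕ combination (c ⊕ d) vs                        ≡⟨ cong₂ _⊕_ (⊙-distribʳ v x y) (combination-⊕ c d vs) ⟩
    (x ⊙ v ⊕ y ⊙ v) ⊕ (combination c vs ⊕ combination d vs)     ≡⟨ ⊕-interchange _ _ _ _ ⟩
    (x ⊙ v ⊕ combination c vs) ⊕ (y ⊙ v ⊕ combination d vs)     ∎

  combination-⊙ : ∀ {n k} a c (vs : Vec (Vector F n) k) →
    combination (a ⊙ c) vs ≡ a ⊙ combination c vs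
  combination-⊙ a []      []       = sym (⊙-zeroʳ a)
  combination-⊙ a (x ∷ c) (v ∷ vs) = begin
    (a * x) ⊙ v ⊕ combination (a ⊙ c) vs   ≡⟨ cong₂ _⊕_ (sym (⊙-assoc a x v)) (combination-⊙ a c vs) ⟩
    a ⊙ x ⊙ v ⊕ a ⊙ combination c vs       ≡⟨ ⊙-distribˡ a _ _ ⟨
    a ⊙ (x ⊙ v ⊕ combination c vs)         ∎

  record IsLinear {m n} (f : Vector F m → Vector F n) : Set where
    field
      ⊕-homo : ∀ u v → f (u ⊕ v) ≡ f u ⊕ f v
      ⊙-homo : ∀ c v → f (c ⊙ v) ≡ c ⊙ f v

    0-homo : f 0ⱽ ≡ 0ⱽ
    0-homo = trans (cong f (sym (⊙-zeroˡ 0ⱽ))) (trans (⊙-homo 0# 0ⱽ) (⊙-zeroˡ (f 0ⱽ)))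

    injective : (∀ v → f v ≡ 0ⱽ → v ≡ 0ⱽ) → ∀ {u v} → f u ≡ f v → u ≡ v
    injective kernel {u} {v} eq = u⊕v≡0⇒u≡v (kernel (u ⊕ v)
      (trans (⊕-homo u v) (trans (cong (_⊕ f v) eq) (⊕-self (f v)))))

    combination-homo : ∀ {k} c (vs : Vec (Vector F m) k) →
      f (combination c vs) ≡ combination c (map f vs)
    combination-homo []      []       = 0-homo
    combination-homo (x ∷ c) (v ∷ vs) =
      trans (⊕-homo _ _) (cong₂ _⊕_ (⊙-homo x v) (combination-homo c vs))

  combination-linear : ∀ {n k} (vs : Vec (Vector F n) k) → IsLinear (λ c → combination c vs)
  combination-linear vs = record
    { ⊕-homo = λ c d → combination-⊕ c d vs ; ⊙-homo = λ a c → combination-⊙ a c vs }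

  ∘-linear : ∀ {l m n} {f : Vector F m → Vector F n} {g : Vector F l → Vector F m} →
    IsLinear f → IsLinear g → IsLinear (f ∘ g)
  ∘-linear {f = f} lf lg = record
    { ⊕-homo = λ u v → trans (cong f (IsLinear.⊕-homo lg u v)) (IsLinear.⊕-homo lf _ _)
    ; ⊙-homo = λ c v → trans (cong f (IsLinear.⊙-homo lg c v)) (IsLinear.⊙-homo lf c _) }

  vectors : ∀ n → Vector F n ↔ Fin (q ℕ.^ n)
  vectors = Vec-finite order

  -- More than k vectors in a k-dimensional subspace are dependent, since there
  -- are more coefficient vectors than elements of the subspace.
  dependent : ∀ {n k m} → k ℕ.< m → (X : Subspace F n k) (vs : Vec (Vector F n) m) →
    All (_∈ X) vs → ∃ λ c → c ≢ 0ⱽ × combination c vs ≡ 0ⱽ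
  dependent {k = k} {m} k<m X vs vs∈X =
    let d , coords = coordinates vs vs∈X
        x , y , x≢y , eq = Counting.collision (vectors m) (vectors k)
                             (ℕ.^-monoʳ-< q 1<order k<m) (λ c → combination c d)
    in x ⊕ y , x≢y ∘ u⊕v≡0⇒u≡v , (begin
      combination (x ⊕ y) vs                           ≡⟨ cong (combination (x ⊕ y)) coords ⟨
      combination (x ⊕ y) (map (λ c → combination c basis) d) ≡⟨ IsLinear.combination-homo (combination-linear basis) (x ⊕ y) d ⟨
      combination (combination (x ⊕ y) d) basis        ≡⟨ cong (λ c → combination c basis) (begin
        combination (x ⊕ y) d                 ≡⟨ combination-⊕ x y d ⟩
        combination x d ⊕ combination y d     ≡⟨ cong (_⊕ combination y d) eq ⟩
        combination y d ⊕ combination y d     ≡⟨ ⊕-self _ ⟩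
        0ⱽ                                    ∎) ⟩
      combination 0ⱽ basis                             ≡⟨ IsLinear.0-homo (combination-linear basis) ⟩
      0ⱽ                                               ∎)
    where
    open Subspace X using (basis)
    coordinates : ∀ {j} (vs : Vec _ j) → All (_∈ X) vs →
      ∃ λ d → map (λ c → combination c basis) d ≡ vs
    coordinates []       []              = [] , refl
    coordinates (v ∷ vs) ((c , eq) ∷ ∈X) =
      let d , eqs = coordinates vs ∈X in c ∷ d , cong₂ _∷_ eq eqs

  -- Subspaces

  module _ {n k : ℕ} (X : Subspace F n k) where
    open Subspace X using (basis; independent)

    ∈-⊕ : ∀ {u v} → u ∈ X → v ∈ X → u ⊕ v ∈ X
    ∈-⊕ (c , refl) (d , refl) = c ⊕ d , combination-⊕ c d basis

    ∈-⊙ : ∀ a {v} → v ∈ X → a ⊙ v ∈ X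
    ∈-⊙ a (c , refl) = a ⊙ c , combination-⊙ a c basis

    ∈-0 : 0ⱽ ∈ X
    ∈-0 = 0ⱽ , IsLinear.0-homo (combination-linear basis)

    ∈-⊙⁻¹ : ∀ {a v} → a ≢ 0# → a ⊙ v ∈ X → v ∈ X
    ∈-⊙⁻¹ a≢0 av∈X = subst (_∈ X) (1/-⊙ a≢0 _) (∈-⊙ (1/ a≢0) av∈X)

    ∉-⊙⇒0 : ∀ {v} → ¬ (v ∈ X) → ∀ a → a ⊙ v ∈ X → a ≡ 0#
    ∉-⊙⇒0 v∉X a av∈X with a ≟ 0#
    ... | yes a≡0 = a≡0
    ... | no a≢0  = contradiction (∈-⊙⁻¹ a≢0 av∈X) v∉X

    ∈-⊕⁻¹ : ∀ {u v} → u ⊕ v ∈ X → u ∈ X → v ∈ X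
    ∈-⊕⁻¹ {u} {v} u⊕v∈X u∈X = subst (_∈ X)
      (trans (sym (⊕-assoc u u v)) (trans (cong (_⊕ v) (⊕-self u)) (⊕-identityˡ v)))
      (∈-⊕ u∈X u⊕v∈X)

  proper : ∀ {n k} → k ℕ.< n → (X : Subspace F n k) → ∃ λ v → ¬ (v ∈ X)
  proper {n} {k} k<n X =
    let v , v≢ = Counting.missed (vectors k) (vectors n) (ℕ.^-monoʳ-< q 1<order k<n)
                   (λ c → combination c (Subspace.basis X))
    in v , λ (c , eq) → v≢ c eq

  combination₁ : ∀ {n} c (v : Vector F n) → combination (c ∷ []) (v ∷ []) ≡ c ⊙ v
  combination₁ c v = ⊕-identityʳ (c ⊙ v)

  vector : ∀ {n} → Subspace F n 1 → Vector F n
  vector record { basis = v ∷ [] } = v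

  ∈-vector : ∀ {n} (P : Subspace F n 1) c → c ⊙ vector P ∈ P
  ∈-vector record { basis = v ∷ [] } c = c ∷ [] , combination₁ c v

  vector∈ : ∀ {n} (P : Subspace F n 1) → vector P ∈ P
  vector∈ P = subst (_∈ P) (⊙-identity _) (∈-vector P 1#)

  ∈-point : ∀ {n} (P : Subspace F n 1) {v} → v ∈ P → ∃ λ c → v ≡ c ⊙ vector P
  ∈-point record { basis = w ∷ [] } (c ∷ [] , eq) = c , trans (sym eq) (combination₁ c w)

  vector≢0 : ∀ {n} (P : Subspace F n 1) → vector P ≢ 0ⱽ
  vector≢0 record { basis = v ∷ [] ; independent = ind } v≡0 with
    ind (1# ∷ []) (trans (combination₁ 1# v) (trans (⊙-identity v) v≡0))
  ... | 1≡0 = 0≢1 (sym (cong (λ { (x ∷ []) → x }) 1≡0))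

  point : ∀ {n} (v : Vector F n) → v ≢ 0ⱽ → Subspace F n 1
  point v v≢0 = record { basis = v ∷ [] ; independent = λ { (c ∷ []) eq →
    cong (_∷ []) (scalar≡0 v≢0 c (trans (sym (combination₁ c v)) eq)) } }

  ⊑-point : ∀ {n k} (P : Subspace F n 1) (X : Subspace F n k) {v} →
    v ≢ 0ⱽ → v ∈ P → v ∈ X → P ⊑ X
  ⊑-point P X {v} v≢0 v∈P v∈X x x∈P =
    let c , v≡ = ∈-point P v∈P
        d , x≡ = ∈-point P x∈P
        c≢0 : c ≢ 0#
        c≢0 c≡0 = v≢0 (trans v≡ (trans (cong (_⊙ vector P) c≡0) (⊙-zeroˡ _)))
    in subst (_∈ X) (sym x≡) (∈-⊙ X d (∈-⊙⁻¹ X c≢0 (subst (_∈ X) v≡ v∈X)))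

  ≈-point : ∀ {n} (P Q : Subspace F n 1) {v} → v ≢ 0ⱽ → v ∈ P → v ∈ Q → P ≈ Q
  ≈-point P Q v≢0 v∈P v∈Q = ⊑-point P Q v≢0 v∈P v∈Q , ⊑-point Q P v≢0 v∈Q v∈P

  ∈-point-nonzero : ∀ {n} (P : Subspace F n 1) {v w} → v ≢ 0ⱽ → v ∈ P → w ∈ P → ∃ λ c → w ≡ c ⊙ v
  ∈-point-nonzero P {v} v≢0 v∈P w∈P =
    let c , v≡ = ∈-point P v∈P
        d , w≡ = ∈-point P w∈P
        c≢0 : c ≢ 0#
        c≢0 c≡0 = v≢0 (trans v≡ (trans (cong (_⊙ vector P) c≡0) (⊙-zeroˡ _)))
    in d * 1/ c≢0 , trans w≡ (trans (cong (d ⊙_) (trans (sym (1/-⊙ c≢0 (vector P)))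
         (cong (1/ c≢0 ⊙_) (sym v≡)))) (⊙-assoc d _ v))

  combination₂ : ∀ {n} a b (u v : Vector F n) → combination (a ∷ b ∷ []) (u ∷ v ∷ []) ≡ a ⊙ u ⊕ b ⊙ v
  combination₂ a b u v = cong (a ⊙ u ⊕_) (combination₁ b v)

  Independent₂ : ∀ {n} → Vector F n → Vector F n → Set
  Independent₂ u v = ∀ a b → a ⊙ u ⊕ b ⊙ v ≡ 0ⱽ → a ≡ 0# × b ≡ 0#

  span₂ : ∀ {n} (u v : Vector F n) → Independent₂ u v → Subspace F n 2
  span₂ u v ind = record { basis = u ∷ v ∷ [] ; independent = λ { (a ∷ b ∷ []) eq →
    let a≡0 , b≡0 = ind a b (trans (sym (combination₂ a b u v)) eq)
    in cong₂ (λ a b → a ∷ b ∷ []) a≡0 b≡0 } }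

  ∈-span₂ : ∀ {n} {u v : Vector F n} (ind : Independent₂ u v) a b → a ⊙ u ⊕ b ⊙ v ∈ span₂ u v ind
  ∈-span₂ ind a b = a ∷ b ∷ [] , combination₂ a b _ _

  -- In a linear relation between the three vectors, w has a nonzero coefficient
  -- because u and v are independent.
  line-spanned : ∀ {n} (m : Subspace F n 2) {u v w} → u ∈ m → v ∈ m → w ∈ m → Independent₂ u v →
    ∃₂ λ a b → w ≡ a ⊙ u ⊕ b ⊙ v
  line-spanned m {u} {v} {w} u∈m v∈m w∈m ind
    with dependent (ℕ.n<1+n 2) m (w ∷ u ∷ v ∷ []) (w∈m ∷ u∈m ∷ v∈m ∷ [])
  ... | c ∷ a ∷ b ∷ [] , c≢0 , eq with c ≟ 0#
  ... | yes refl = contradiction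
    (let a≡0 , b≡0 = ind a b (begin
           a ⊙ u ⊕ b ⊙ v                                    ≡⟨ combination₂ a b u v ⟨
           combination (a ∷ b ∷ []) (u ∷ v ∷ [])            ≡⟨ ⊕-identityˡ _ ⟨
           0ⱽ ⊕ combination (a ∷ b ∷ []) (u ∷ v ∷ [])       ≡⟨ cong (_⊕ _) (⊙-zeroˡ w) ⟨
           0# ⊙ w ⊕ combination (a ∷ b ∷ []) (u ∷ v ∷ [])   ≡⟨ eq ⟩
           0ⱽ                                               ∎)
     in cong₂ (λ a b → 0# ∷ a ∷ b ∷ []) a≡0 b≡0) c≢0
  ... | no c≢0 = 1/ c≢0 * a , 1/ c≢0 * b , (begin
    w                                         ≡⟨ 1/-⊙ c≢0 w ⟨
    1/ c≢0 ⊙ c ⊙ w                            ≡⟨ cong (1/ c≢0 ⊙_) (u⊕v≡0⇒u≡v (trans (cong (c ⊙ w ⊕_) (sym (combination₂ a b u v))) eq)) ⟩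
    1/ c≢0 ⊙ (a ⊙ u ⊕ b ⊙ v)                  ≡⟨ ⊙-distribˡ _ _ _ ⟩
    1/ c≢0 ⊙ a ⊙ u ⊕ 1/ c≢0 ⊙ b ⊙ v           ≡⟨ cong₂ _⊕_ (⊙-assoc _ a u) (⊙-assoc _ b v) ⟩
    (1/ c≢0 * a) ⊙ u ⊕ (1/ c≢0 * b) ⊙ v       ∎)

  combination₃ : ∀ {n} a b c (u v w : Vector F n) →
    combination (a ∷ b ∷ c ∷ []) (u ∷ v ∷ w ∷ []) ≡ a ⊙ u ⊕ (b ⊙ v ⊕ c ⊙ w)
  combination₃ a b c u v w = cong (a ⊙ u ⊕_) (combination₂ b c v w)

  Independent₃ : ∀ {n} → Vector F n → Vector F n → Vector F n → Set
  Independent₃ u v w = ∀ a b c → a ⊙ u ⊕ (b ⊙ v ⊕ c ⊙ w) ≡ 0ⱽ → a ≡ 0# × b ≡ 0# × c ≡ 0#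

  span₃ : ∀ {n} (u v w : Vector F n) → Independent₃ u v w → Subspace F n 3
  span₃ u v w ind = record { basis = u ∷ v ∷ w ∷ [] ; independent = λ { (a ∷ b ∷ c ∷ []) eq →
    let a≡0 , b≡0 , c≡0 = ind a b c (trans (sym (combination₃ a b c u v w)) eq)
    in cong₂ _∷_ a≡0 (cong₂ (λ b c → b ∷ c ∷ []) b≡0 c≡0) } }

  ∈-span₃ : ∀ {n} {u v w : Vector F n} (ind : Independent₃ u v w) a b c →
    a ⊙ u ⊕ (b ⊙ v ⊕ c ⊙ w) ∈ span₃ u v w ind
  ∈-span₃ ind a b c = a ∷ b ∷ c ∷ [] , combination₃ a b c _ _ _

  ∈-span₃⁻¹ : ∀ {n} {u v w : Vector F n} (ind : Independent₃ u v w) {x} →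
    x ∈ span₃ u v w ind → ∃ λ a → ∃₂ λ b c → x ≡ a ⊙ u ⊕ (b ⊙ v ⊕ c ⊙ w)
  ∈-span₃⁻¹ ind (a ∷ b ∷ c ∷ [] , eq) = a , b , c , trans (sym eq) (combination₃ a b c _ _ _)

  -- Linear automorphisms

  record Automorphism (n : ℕ) : Set where
    field
      to     : Vector F n → Vector F n
      linear : IsLinear to
      kernel : ∀ v → to v ≡ 0ⱽ → v ≡ 0ⱽ

    open IsLinear linear public

    to-injective : ∀ {u v} → to u ≡ to v → u ≡ v
    to-injective = injective kernel

    onto : ∀ v → ∃ λ u → to u ≡ v
    onto = Counting.injective⇒surjective (vectors n) (vectors n) refl to to-injective

  inverse : ∀ {n} → Automorphism n → Automorphism n
  inverse A = record
    { to     = λ v → proj₁ (A.onto v)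
    ; linear = record
      { ⊕-homo = λ u v → A.to-injective (trans (proj₂ (A.onto (u ⊕ v)))
          (sym (trans (A.⊕-homo _ _) (cong₂ _⊕_ (proj₂ (A.onto u)) (proj₂ (A.onto v))))))
      ; ⊙-homo = λ c v → A.to-injective (trans (proj₂ (A.onto (c ⊙ v)))
          (sym (trans (A.⊙-homo c _) (cong (c ⊙_) (proj₂ (A.onto v))))))
      }
    ; kernel = λ v eq → trans (sym (proj₂ (A.onto v))) (trans (cong A.to eq) A.0-homo)
    }
    where module A = Automorphism A

  to-inverse : ∀ {n} (A : Automorphism n) v → Automorphism.to A (Automorphism.to (inverse A) v) ≡ v
  to-inverse A v = proj₂ (Automorphism.onto A v)

  inverse-to : ∀ {n} (A : Automorphism n) v → Automorphism.to (inverse A) (Automorphism.to A v) ≡ v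
  inverse-to A v = Automorphism.to-injective A (to-inverse A (Automorphism.to A v))

  identity : ∀ {n} → Automorphism n
  identity = record
    { to = λ v → v ; linear = record { ⊕-homo = λ _ _ → refl ; ⊙-homo = λ _ _ → refl } ; kernel = λ _ eq → eq }

  infixr 9 _∘ᴬ_
  _∘ᴬ_ : ∀ {n} → Automorphism n → Automorphism n → Automorphism n
  A ∘ᴬ B = record
    { to     = A.to ∘ B.to
    ; linear = ∘-linear A.linear B.linear
    ; kernel = λ v eq → B.kernel v (A.kernel (B.to v) eq)
    }
    where
    module A = Automorphism A
    module B = Automorphism B

  toPGL : ∀ {n} → Automorphism n → PGL n F
  toPGL A = record
    { to = to
    ; isLeftModuleIsomorphism = record
      { isLeftModuleMonomorphism = record
        { isLeftModuleHomomorphism = record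
          { +ᴹ-isGroupHomomorphism = record
            { isMonoidHomomorphism = record
              { isMagmaHomomorphism = record
                { isRelHomomorphism = record { cong = cong to }
                ; homo = ⊕-homo }
              ; ε-homo = 0-homo }
            ; ⁻¹-homo = λ v → trans (cong to (neg≡id v)) (sym (neg≡id (to v))) }
          ; *ₗ-homo = ⊙-homo }
        ; injective = to-injective }
      ; surjective = λ v → proj₁ (onto v) , λ { refl → proj₂ (onto v) } }
    }
    where open Automorphism A

  distinct⇒independent : ∀ {n} (P Q : Subspace F n 1) → ¬ (P ≈ Q) → Independent₂ (vector P) (vector Q)
  distinct⇒independent P Q P≉Q a b eq with b ≟ 0#
  ... | yes refl = scalar≡0 (vector≢0 P) a (trans (sym (⊕-identityʳ _)) (trans (cong (a ⊙ vector P ⊕_) (sym (⊙-zeroˡ (vector Q)))) eq)) , refl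
  ... | no b≢0 = contradiction (≈-point P Q (vector≢0 Q)
    (∈-⊙⁻¹ P b≢0 (subst (_∈ P) (u⊕v≡0⇒u≡v eq) (∈-vector P a))) (vector∈ Q)) P≉Q

  -- S and S′ represent sets of points by vectors, so T has to respect them only up
  -- to nonzero scalars.
  record Carries {n} (T : Automorphism n) (S S′ : Vector F n → Set) : Set where
    private module T = Automorphism T
    field
      forth : ∀ {v} → S v → ∃ λ c → ∃ λ v′ → c ≢ 0# × S′ v′ × T.to v ≡ c ⊙ v′
      back  : ∀ {v′} → S′ v′ → ∃ λ c → ∃ λ v → c ≢ 0# × S v × T.to v ≡ c ⊙ v′

  Carries-∘ : ∀ {n} {T T′ : Automorphism n} {S S′ S″} →
    Carries T′ S′ S″ → Carries T S S′ → Carries (T′ ∘ᴬ T) S S″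
  Carries-∘ {T = T} {T′} {S} {S′} {S″} C′ C = record { forth = forth ; back = back }
    where
    module T = Automorphism T
    module T′ = Automorphism T′
    module C = Carries C
    module C′ = Carries C′
    compose : ∀ {v v′ v″ c c′} → T.to v ≡ c ⊙ v′ → T′.to v′ ≡ c′ ⊙ v″ → T′.to (T.to v) ≡ (c * c′) ⊙ v″
    compose {v} {v′} {v″} {c} {c′} eq eq′ = begin
      T′.to (T.to v)   ≡⟨ cong T′.to eq ⟩
      T′.to (c ⊙ v′)   ≡⟨ T′.⊙-homo c v′ ⟩
      c ⊙ T′.to v′     ≡⟨ cong (c ⊙_) eq′ ⟩
      c ⊙ c′ ⊙ v″      ≡⟨ ⊙-assoc c c′ v″ ⟩
      (c * c′) ⊙ v″    ∎
    forth : ∀ {v} → S v → ∃ λ c → ∃ λ v″ → c ≢ 0# × S″ v″ × T′.to (T.to v) ≡ c ⊙ v″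
    forth Sv =
      let c , v′ , c≢0 , S′v′ , eq     = C.forth Sv
          c′ , v″ , c′≢0 , S″v″ , eq′ = C′.forth S′v′
      in c * c′ , v″ , *-nonzero c≢0 c′≢0 , S″v″ , compose eq eq′
    back : ∀ {v″} → S″ v″ → ∃ λ c → ∃ λ v → c ≢ 0# × S v × T′.to (T.to v) ≡ c ⊙ v″
    back S″v″ =
      let c′ , v′ , c′≢0 , S′v′ , eq′ = C′.back S″v″
          c , v , c≢0 , Sv , eq       = C.back S′v′
      in c * c′ , v , *-nonzero c≢0 c′≢0 , Sv , compose eq eq′

-- The group of the Tits ovoid

module TitsOvoid (F : Field) (e : ℕ) (order : HasOrder F (2 ℕ.^ (2 ℕ.* e ℕ.+ 1))) where
  open Field F
  open TitsForm F e order
  open Characteristic2 F 1+1≡0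
  open FiniteField F order using (_≟_)
  open LinearAlgebra F order 1+1≡0

  pole : Vector F 4
  pole = 0# ∷ 0# ∷ 0# ∷ 1# ∷ []

  finiteVector : Carrier → Carrier → Vector F 4
  finiteVector s t = 1# ∷ s ∷ t ∷ tits s t ∷ []

  data OvoidVector : Vector F 4 → Set where
    infinite : OvoidVector pole
    finite   : ∀ s t → OvoidVector (finiteVector s t)

  OvoidVector-nonzero : ∀ {r} → OvoidVector r → r ≢ 0ⱽ
  OvoidVector-nonzero infinite     eq = 0≢1 (sym (∷-injectiveˡ (∷-injectiveʳ (∷-injectiveʳ (∷-injectiveʳ eq)))))
  OvoidVector-nonzero (finite s t) eq = 0≢1 (sym (∷-injectiveˡ eq))

  vec₄ : ∀ {x y z t x′ y′ z′ t′ : Carrier} → x ≡ x′ → y ≡ y′ → z ≡ z′ → t ≡ t′ →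
    _≡_ {A = Vector F 4} (x ∷ y ∷ z ∷ t ∷ []) (x′ ∷ y′ ∷ z′ ∷ t′ ∷ [])
  vec₄ refl refl refl refl = refl

  reversal : Automorphism 4
  reversal = record
    { to     = reverse
    ; linear = record
      { ⊕-homo = λ { (_ ∷ _ ∷ _ ∷ _ ∷ []) (_ ∷ _ ∷ _ ∷ _ ∷ []) → refl }
      ; ⊙-homo = λ { c (_ ∷ _ ∷ _ ∷ _ ∷ []) → refl } }
    ; kernel = λ { (x ∷ y ∷ z ∷ t ∷ []) eq → cong reverse eq }
    }
    where
    reverse : Vector F 4 → Vector F 4
    reverse (x ∷ y ∷ z ∷ t ∷ []) = t ∷ z ∷ y ∷ x ∷ []

  reversal-pole : Automorphism.to reversal pole ≡ finiteVector 0# 0#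
  reversal-pole = vec₄ refl refl refl (sym tits-00)

  reversal-origin : Automorphism.to reversal (finiteVector 0# 0#) ≡ pole
  reversal-origin = vec₄ tits-00 refl refl refl

  -- The reversed vector is z times (1 , t / z , s / z , 1 / z), whose last coordinate
  -- is the right one by tits-invert.
  reversal-finite : ∀ s t (z≢0 : tits s t ≢ 0#) → Automorphism.to reversal (finiteVector s t) ≡
    tits s t ⊙ finiteVector (t * 1/ z≢0) (s * 1/ z≢0)
  reversal-finite s t z≢0 = vec₄
    (sym (*-identityʳ z)) (cancel t) (cancel s)
    (sym (trans (cong (z *_) (tits-invert s t z≢0)) (*-inverseʳ z≢0)))
    where
    z = tits s t
    cancel : ∀ x → x ≡ z * (x * 1/ z≢0)
    cancel x = sym (trans (cong (z *_) (*-comm x _)) (inverse-cancelʳ z≢0 x))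

  private
    reversal-forth : ∀ {r} → OvoidVector r →
      ∃ λ c → ∃ λ r′ → c ≢ 0# × OvoidVector r′ × Automorphism.to reversal r ≡ c ⊙ r′
    reversal-forth infinite = 1# , finiteVector 0# 0# , 0≢1 ∘ sym , finite 0# 0# ,
      trans reversal-pole (sym (⊙-identity _))
    reversal-forth (finite s t) = byCases (tits s t ≟ 0#)
      where
      byCases : Dec (tits s t ≡ 0#) → ∃ λ c → ∃ λ r′ →
        c ≢ 0# × OvoidVector r′ × Automorphism.to reversal (finiteVector s t) ≡ c ⊙ r′
      byCases (yes z≡0) = let s≡0 , t≡0 = tits≡0⇒0 s t z≡0 in
        1# , pole , 0≢1 ∘ sym , infinite ,
        trans (cong₂ (λ s t → Automorphism.to reversal (finiteVector s t)) s≡0 t≡0)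
          (trans reversal-origin (sym (⊙-identity _)))
      byCases (no z≢0) = tits s t , _ , z≢0 , finite _ _ , reversal-finite s t z≢0

  -- Reversal is an involution, so mapping the ovoid into itself suffices.
  reversal-carries : Carries reversal OvoidVector OvoidVector
  reversal-carries = record { forth = reversal-forth ; back = λ Or →
    let c , r′ , c≢0 , Or′ , eq = reversal-forth Or
    in 1/ c≢0 , r′ , 1/-nonzero c≢0 , Or′ , (begin
      R.to r′                       ≡⟨ 1/-⊙ c≢0 _ ⟨
      1/ c≢0 ⊙ c ⊙ R.to r′          ≡⟨ cong (1/ c≢0 ⊙_) (R.⊙-homo c r′) ⟨
      1/ c≢0 ⊙ R.to (c ⊙ r′)        ≡⟨ cong (λ x → 1/ c≢0 ⊙ R.to x) eq ⟨
      1/ c≢0 ⊙ R.to (R.to _)        ≡⟨ cong (1/ c≢0 ⊙_) (involutive _) ⟩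
      1/ c≢0 ⊙ _                    ∎) }
    where
    module R = Automorphism reversal
    involutive : ∀ r → R.to (R.to r) ≡ r
    involutive (_ ∷ _ ∷ _ ∷ _ ∷ []) = refl

  -- The linear map that induces (s , t) ↦ (s + a , t + a ^σ s + b) on the ovoid, by
  -- tits-translate.
  module _ (a b : Carrier) where
    private
      translate : Vector F 4 → Vector F 4
      translate (x ∷ s ∷ t ∷ z ∷ []) =
        x ∷ s + a * x ∷ t + (a ^σ * s + b * x) ∷ z + ((b + a ^σ * a) * s + a * t) + tits a b * x ∷ []

    translation : Automorphism 4
    translation = record
      { to     = translate
      ; linear = record
        { ⊕-homo = λ { (x ∷ s ∷ t ∷ z ∷ []) (x′ ∷ s′ ∷ t′ ∷ z′ ∷ []) → vec₄ refl
            (solve 5 (λ a x s x′ s′ → s :+ s′ :+ a :* (x :+ x′) := (s :+ a :* x) :+ (s′ :+ a :* x′)) refl a x s x′ s′)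
            (solve 8 (λ A b x s t x′ s′ t′ → t :+ t′ :+ (A :* (s :+ s′) :+ b :* (x :+ x′)) :=
              (t :+ (A :* s :+ b :* x)) :+ (t′ :+ (A :* s′ :+ b :* x′))) refl (a ^σ) b x s t x′ s′ t′)
            (solve 11 (λ B a c x s t z x′ s′ t′ z′ →
              z :+ z′ :+ (B :* (s :+ s′) :+ a :* (t :+ t′)) :+ c :* (x :+ x′) :=
              (z :+ (B :* s :+ a :* t) :+ c :* x) :+ (z′ :+ (B :* s′ :+ a :* t′) :+ c :* x′))
              refl (b + a ^σ * a) a (tits a b) x s t z x′ s′ t′ z′) }
        ; ⊙-homo = λ { k (x ∷ s ∷ t ∷ z ∷ []) → vec₄ refl
            (solve 4 (λ k a x s → k :* s :+ a :* (k :* x) := k :* (s :+ a :* x)) refl k a x s)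
            (solve 6 (λ k A b x s t → k :* t :+ (A :* (k :* s) :+ b :* (k :* x)) :=
              k :* (t :+ (A :* s :+ b :* x))) refl k (a ^σ) b x s t)
            (solve 8 (λ k B a c x s t z → k :* z :+ (B :* (k :* s) :+ a :* (k :* t)) :+ c :* (k :* x) :=
              k :* (z :+ (B :* s :+ a :* t) :+ c :* x)) refl k (b + a ^σ * a) a (tits a b) x s t z) }
        }
      ; kernel = λ { (x ∷ s ∷ t ∷ z ∷ []) eq → triangular x s t z
          (∷-injectiveˡ eq) (∷-injectiveˡ (∷-injectiveʳ eq))
          (∷-injectiveˡ (∷-injectiveʳ (∷-injectiveʳ eq)))
          (∷-injectiveˡ (∷-injectiveʳ (∷-injectiveʳ (∷-injectiveʳ eq)))) }
      }
      where
      triangular : ∀ x s t z → x ≡ 0# → s + a * x ≡ 0# → t + (a ^σ * s + b * x) ≡ 0# →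
        z + ((b + a ^σ * a) * s + a * t) + tits a b * x ≡ 0# → x ∷ s ∷ t ∷ z ∷ [] ≡ 0ⱽ
      triangular x s t z refl eq₁ eq₂ eq₃ = vec₄ refl s≡0 t≡0 z≡0
        where
        s≡0 : s ≡ 0#
        s≡0 = trans (solve 2 (λ a s → s := s :+ a :* :0) refl a s) eq₁
        t≡0 : t ≡ 0#
        t≡0 = trans (solve 3 (λ A b t → t := t :+ (A :* :0 :+ b :* :0)) refl (a ^σ) b t)
          (trans (cong (λ s → t + (a ^σ * s + b * 0#)) (sym s≡0)) eq₂)
        z≡0 : z ≡ 0#
        z≡0 = trans (solve 4 (λ B a c z → z := z :+ (B :* :0 :+ a :* :0) :+ c :* :0) refl (b + a ^σ * a) a (tits a b) z)
          (trans (cong₂ (λ s t → z + ((b + a ^σ * a) * s + a * t) + tits a b * 0#) (sym s≡0) (sym t≡0)) eq₃)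

    translation-pole : translate pole ≡ pole
    translation-pole = vec₄ refl
      (solve 1 (λ a → :0 :+ a :* :0 := :0) refl a)
      (solve 2 (λ A b → :0 :+ (A :* :0 :+ b :* :0) := :0) refl (a ^σ) b)
      (solve 3 (λ B a c → :1 :+ (B :* :0 :+ a :* :0) :+ c :* :0 := :1) refl (b + a ^σ * a) a (tits a b))

    translation-finite : ∀ s t → translate (finiteVector s t) ≡ finiteVector (s + a) (t + (a ^σ * s + b))
    translation-finite s t = vec₄ refl (cong (s +_) (*-identityʳ a))
      (cong (λ x → t + (a ^σ * s + x)) (*-identityʳ b))
      (trans (cong (λ x → tits s t + ((b + a ^σ * a) * s + a * t) + x) (*-identityʳ (tits a b)))
        (sym (tits-translate a b s t)))

    translation-carries : Carries translation OvoidVector OvoidVector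
    translation-carries = record { forth = forth ; back = back }
      where
      forth : ∀ {r} → OvoidVector r → ∃ λ c → ∃ λ r′ → c ≢ 0# × OvoidVector r′ × translate r ≡ c ⊙ r′
      forth infinite     = 1# , pole , 0≢1 ∘ sym , infinite , trans translation-pole (sym (⊙-identity _))
      forth (finite s t) = 1# , _ , 0≢1 ∘ sym , finite _ _ , trans (translation-finite s t) (sym (⊙-identity _))
      back : ∀ {r′} → OvoidVector r′ → ∃ λ c → ∃ λ r → c ≢ 0# × OvoidVector r × translate r ≡ c ⊙ r′
      back infinite     = 1# , pole , 0≢1 ∘ sym , infinite , trans translation-pole (sym (⊙-identity _))
      back (finite s t) = 1# , _ , 0≢1 ∘ sym , finite (s + a) (t + (a ^σ * (s + a) + b)) , (begin
        translate (finiteVector (s + a) (t + (a ^σ * (s + a) + b)))  ≡⟨ translation-finite _ _ ⟩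
        finiteVector (s + a + a) (t + (a ^σ * (s + a) + b) + (a ^σ * (s + a) + b))
          ≡⟨ cong₂ finiteVector (twice s a) (twice t _) ⟩
        finiteVector s t                                             ≡⟨ ⊙-identity _ ⟨
        1# ⊙ finiteVector s t                                        ∎)
        where
        twice : ∀ x y → x + y + y ≡ x
        twice = solve 2 (λ x y → x :+ y :+ y := x) refl

  identity-carries : Carries identity OvoidVector OvoidVector
  identity-carries = record
    { forth = λ {r} Or → 1# , r , 0≢1 ∘ sym , Or , sym (⊙-identity r)
    ; back  = λ {r} Or → 1# , r , 0≢1 ∘ sym , Or , sym (⊙-identity r) }

  -- Reversal takes the pole to (1 , 0 , 0 , 0), and translations take that point to
  -- all the others.
  transitive : ∀ {r} → OvoidVector r →
    ∃ λ τ → Carries τ OvoidVector OvoidVector × Automorphism.to τ pole ≡ r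
  transitive infinite     = identity , identity-carries , refl
  transitive (finite a b) = translation a b ∘ᴬ reversal
    , Carries-∘ (translation-carries a b) reversal-carries
    , (begin
      A.to (Automorphism.to reversal pole)  ≡⟨ cong A.to reversal-pole ⟩
      A.to (finiteVector 0# 0#)             ≡⟨ translation-finite a b 0# 0# ⟩
      finiteVector (0# + a) (0# + (a ^σ * 0# + b)) ≡⟨ cong₂ finiteVector (+-identityˡ a)
        (solve 2 (λ A b → :0 :+ (A :* :0 :+ b) := b) refl (a ^σ) b) ⟩
      finiteVector a b                      ∎)
    where module A = Automorphism (translation a b)

-- The fundamental theorem of projective geometry for planes

module Collinearity (K : Field) {q : ℕ} (order : HasOrder K q) (1+1≡0 : HasCharacteristic2 K) where
  open Field K
  open Characteristic2 K 1+1≡0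
  open FiniteField K order using (_≟_)
  open LinearAlgebra K order 1+1≡0

  Collinear : Vector K 3 → Vector K 3 → Vector K 3 → Set
  Collinear u v w = ∃ λ (ℓ : Subspace K 3 2) → u ∈ ℓ × v ∈ ℓ × w ∈ ℓ

  det : Vector K 3 → Vector K 3 → Vector K 3 → Carrier
  det (a ∷ b ∷ c ∷ []) (a′ ∷ b′ ∷ c′ ∷ []) (a″ ∷ b″ ∷ c″ ∷ []) =
    a * (b′ * c″ + c′ * b″) + b * (a′ * c″ + c′ * a″) + c * (a′ * b″ + b′ * a″)

  private
    vanish : ∀ {u₁ u₂ u₃} → u₁ ∷ u₂ ∷ u₃ ∷ [] ≡ 0ⱽ → ∀ a b c → u₁ * a + u₂ * b + u₃ * c ≡ 0#
    vanish refl a b c = solve 3 (λ a b c → :0 :* a :+ :0 :* b :+ :0 :* c := :0) refl a b c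

    cramer : ∀ x y z u v w → x ≢ 0# → combination (x ∷ y ∷ z ∷ []) (u ∷ v ∷ w ∷ []) ≡ 0ⱽ →
             det u v w ≡ 0#
    cramer x y z (a ∷ b ∷ c ∷ []) (a′ ∷ b′ ∷ c′ ∷ []) (a″ ∷ b″ ∷ c″ ∷ []) x≢0 eq =
      x*y≡0⇒y≡0 x≢0 (trans
        (solve 12 (λ x y z a b c a′ b′ c′ a″ b″ c″ →
          x :* (a :* (b′ :* c″ :+ c′ :* b″) :+ b :* (a′ :* c″ :+ c′ :* a″) :+ c :* (a′ :* b″ :+ b′ :* a″)) :=
          (x :* a :+ (y :* a′ :+ (z :* a″ :+ :0))) :* (b′ :* c″ :+ c′ :* b″) :+
          (x :* b :+ (y :* b′ :+ (z :* b″ :+ :0))) :* (a′ :* c″ :+ c′ :* a″) :+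
          (x :* c :+ (y :* c′ :+ (z :* c″ :+ :0))) :* (a′ :* b″ :+ b′ :* a″)) refl x y z a b c a′ b′ c′ a″ b″ c″)
        (vanish eq (b′ * c″ + c′ * b″) (a′ * c″ + c′ * a″) (a′ * b″ + b′ * a″)))

    det-swap : ∀ u v w → det u v w ≡ det v u w
    det-swap (a ∷ b ∷ c ∷ []) (a′ ∷ b′ ∷ c′ ∷ []) (a″ ∷ b″ ∷ c″ ∷ []) =
      solve 9 (λ a b c a′ b′ c′ a″ b″ c″ →
        a :* (b′ :* c″ :+ c′ :* b″) :+ b :* (a′ :* c″ :+ c′ :* a″) :+ c :* (a′ :* b″ :+ b′ :* a″) :=
        a′ :* (b :* c″ :+ c :* b″) :+ b′ :* (a :* c″ :+ c :* a″) :+ c′ :* (a :* b″ :+ b :* a″))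
        refl a b c a′ b′ c′ a″ b″ c″

    det-rotate : ∀ u v w → det u v w ≡ det w u v
    det-rotate (a ∷ b ∷ c ∷ []) (a′ ∷ b′ ∷ c′ ∷ []) (a″ ∷ b″ ∷ c″ ∷ []) =
      solve 9 (λ a b c a′ b′ c′ a″ b″ c″ →
        a :* (b′ :* c″ :+ c′ :* b″) :+ b :* (a′ :* c″ :+ c′ :* a″) :+ c :* (a′ :* b″ :+ b′ :* a″) :=
        a″ :* (b :* c′ :+ c :* b′) :+ b″ :* (a :* c′ :+ c :* a′) :+ c″ :* (a :* b′ :+ b :* a′))
        refl a b c a′ b′ c′ a″ b″ c″

  -- By Cramer, each coefficient of a linear relation annihilates the determinant.
  dependent⇒det≡0 : ∀ c u v w → c ≢ 0ⱽ → combination c (u ∷ v ∷ w ∷ []) ≡ 0ⱽ → det u v w ≡ 0#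
  dependent⇒det≡0 (x ∷ y ∷ z ∷ []) u v w c≢0 eq with x ≟ 0# | y ≟ 0# | z ≟ 0#
  ... | yes refl | yes refl | yes refl = contradiction refl c≢0
  ... | no x≢0   | _        | _        = cramer x y z u v w x≢0 eq
  ... | yes _    | no y≢0   | _        = trans (det-swap u v w) (cramer y x z v u w y≢0 (begin
    y ⊙ v ⊕ (x ⊙ u ⊕ rest)   ≡⟨ ⊕-assoc _ _ rest ⟨
    (y ⊙ v ⊕ x ⊙ u) ⊕ rest   ≡⟨ cong (_⊕ rest) (⊕-comm _ _) ⟩
    (x ⊙ u ⊕ y ⊙ v) ⊕ rest   ≡⟨ ⊕-assoc _ _ rest ⟩
    x ⊙ u ⊕ (y ⊙ v ⊕ rest)   ≡⟨ eq ⟩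
    0ⱽ                       ∎))
    where rest = combination (z ∷ []) (w ∷ [])
  ... | yes _    | yes _    | no z≢0   = trans (det-rotate u v w) (cramer z x y w u v z≢0 (begin
    combination (z ∷ x ∷ y ∷ []) (w ∷ u ∷ v ∷ [])   ≡⟨ combination₃ z x y w u v ⟩
    z ⊙ w ⊕ (x ⊙ u ⊕ y ⊙ v)                         ≡⟨ ⊕-comm _ _ ⟩
    (x ⊙ u ⊕ y ⊙ v) ⊕ z ⊙ w                         ≡⟨ ⊕-assoc _ _ _ ⟩
    x ⊙ u ⊕ (y ⊙ v ⊕ z ⊙ w)                         ≡⟨ combination₃ x y z u v w ⟨
    combination (x ∷ y ∷ z ∷ []) (u ∷ v ∷ w ∷ [])   ≡⟨ eq ⟩
    0ⱽ                                              ∎))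

  module Frame (B : Vector K 3 → Vector K 3) (linear : IsLinear B)
               (kernel : ∀ v → B v ≡ 0ⱽ → v ≡ 0ⱽ) where
    open IsLinear linear

    collinear⇒det≡0 : ∀ {a b c} u v w → a ≢ 0# → b ≢ 0# → c ≢ 0# →
      Collinear (a ⊙ B u) (b ⊙ B v) (c ⊙ B w) → det u v w ≡ 0#
    collinear⇒det≡0 u v w a≢0 b≢0 c≢0 (ℓ , u∈ℓ , v∈ℓ , w∈ℓ) =
      let c , c≢0 , eq = dependent (ℕ.n<1+n 2) ℓ (B u ∷ B v ∷ B w ∷ [])
                           (∈-⊙⁻¹ ℓ a≢0 u∈ℓ ∷ ∈-⊙⁻¹ ℓ b≢0 v∈ℓ ∷ ∈-⊙⁻¹ ℓ c≢0 w∈ℓ ∷ [])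
      in dependent⇒det≡0 c u v w c≢0 (kernel _ (trans (combination-homo c (u ∷ v ∷ w ∷ [])) eq))

  -- A collineation of the affine plane K² into PG(2, K), given by representatives
  -- of the images f x y of the affine points and of the images hx, hy, hd of the
  -- points at infinity in the directions (1, 0), (0, 1) and (1, 1), is semilinear.
  module AffineCollineation
    (f : Carrier → Carrier → Vector K 3) (hx hy hd : Vector K 3)
    (L∞ : Subspace K 3 2)
    (hx∈L∞ : hx ∈ L∞) (hy∈L∞ : hy ∈ L∞) (hd∈L∞ : hd ∈ L∞)
    (f∉L∞ : ∀ x y → ¬ (f x y ∈ L∞))
    (hx-hy-independent : Independent₂ hx hy) (hd≢0 : hd ≢ 0ⱽ)
    (f-injective : ∀ {x y x′ y′} c → f x y ≡ c ⊙ f x′ y′ → x ≡ x′ × y ≡ y′)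
    (horizontal : ∀ x x′ y → Collinear (f x y) (f x′ y) hx)
    (vertical : ∀ x y y′ → Collinear (f x y) (f x y′) hy)
    (diagonal : ∀ c x x′ → Collinear (f x (x + c)) (f x′ (x′ + c)) hd)
    (throughOrigin : ∀ m x → Collinear (f 0# 0#) (f 1# m) (f x (m * x)))
    where

    private
      o = f 0# 0#

      abstract
        B : Vector K 3 → Vector K 3
        B c = combination c (o ∷ hx ∷ hy ∷ [])

        B-linear : IsLinear B
        B-linear = combination-linear (o ∷ hx ∷ hy ∷ [])

        B-expand : ∀ x y z → B (x ∷ y ∷ z ∷ []) ≡ x ⊙ o ⊕ (y ⊙ hx ⊕ z ⊙ hy)
        B-expand x y z = combination₃ x y z o hx hy

      ∈L∞⇒0 : ∀ {x y z} → B (x ∷ y ∷ z ∷ []) ∈ L∞ → x ≡ 0#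
      ∈L∞⇒0 {x} {y} {z} ∈L∞ with x ≟ 0#
      ... | yes x≡0 = x≡0
      ... | no x≢0  = contradiction
        (∈-⊙⁻¹ L∞ x≢0 (∈-⊕⁻¹ L∞ (subst (_∈ L∞) (trans (B-expand x y z) (⊕-comm _ _)) ∈L∞)
          (∈-⊕ L∞ (∈-⊙ L∞ y hx∈L∞) (∈-⊙ L∞ z hy∈L∞)))) (f∉L∞ 0# 0#)

      B-infinite : ∀ y z → B (0# ∷ y ∷ z ∷ []) ≡ y ⊙ hx ⊕ z ⊙ hy
      B-infinite y z = trans (B-expand 0# y z)
        (trans (cong (_⊕ _) (⊙-zeroˡ o)) (⊕-identityˡ _))

      B-kernel : ∀ v → B v ≡ 0ⱽ → v ≡ 0ⱽ
      B-kernel (x ∷ y ∷ z ∷ []) eq with ∈L∞⇒0 (subst (_∈ L∞) (sym eq) (∈-0 L∞))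
      ... | refl = let y≡0 , z≡0 = hx-hy-independent y z (trans (sym (B-infinite y z)) eq)
                   in cong₂ (λ y z → 0# ∷ y ∷ z ∷ []) y≡0 z≡0

      abstract
        B-onto : ∀ v → ∃ λ c → B c ≡ v
        B-onto = Counting.injective⇒surjective (vectors 3) (vectors 3) refl B (IsLinear.injective B-linear B-kernel)

      normalise : ∀ {x} (x≢0 : x ≢ 0#) y z → x ∷ y ∷ z ∷ [] ≡ x ⊙ (1# ∷ 1/ x≢0 * y ∷ 1/ x≢0 * z ∷ [])
      normalise {x} x≢0 y z = cong₂ _∷_ (sym (*-identityʳ x))
        (cong₂ (λ a b → a ∷ b ∷ []) (sym (inverse-cancelʳ x≢0 y)) (sym (inverse-cancelʳ x≢0 z)))

      B-infinite∈L∞ : ∀ y z → B (0# ∷ y ∷ z ∷ []) ∈ L∞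
      B-infinite∈L∞ y z = subst (_∈ L∞) (sym (B-infinite y z))
        (∈-⊕ L∞ (∈-⊙ L∞ y hx∈L∞) (∈-⊙ L∞ z hy∈L∞))

      -- Outside L∞ the first coordinate is nonzero and can be scaled to 1.
      affine-coordinates : ∀ c v → B c ≡ v → ¬ (v ∈ L∞) →
        ∃ λ d → ∃₂ λ a b → d ≢ 0# × v ≡ d ⊙ B (1# ∷ a ∷ b ∷ [])
      affine-coordinates (x ∷ y ∷ z ∷ []) v eq v∉L∞ = x , 1/ x≢0 * y , 1/ x≢0 * z , x≢0 ,
        trans (sym eq) (trans (cong B (normalise x≢0 y z)) (IsLinear.⊙-homo B-linear x (1# ∷ 1/ x≢0 * y ∷ 1/ x≢0 * z ∷ [])))
        where
        x≢0 : x ≢ 0#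
        x≢0 x≡0 = v∉L∞ (subst (_∈ L∞) (trans (cong (λ x → B (x ∷ y ∷ z ∷ [])) (sym x≡0)) eq) (B-infinite∈L∞ y z))

      abstract
        coordinates : ∀ x y → ∃ λ c → ∃₂ λ a b → c ≢ 0# × f x y ≡ c ⊙ B (1# ∷ a ∷ b ∷ [])
        coordinates x y = affine-coordinates (proj₁ (B-onto (f x y))) (f x y) (proj₂ (B-onto (f x y))) (f∉L∞ x y)

      scale : Carrier → Carrier → Carrier
      scale x y = proj₁ (coordinates x y)

      scale≢0 : ∀ x y → scale x y ≢ 0#
      scale≢0 x y = proj₁ (proj₂ (proj₂ (proj₂ (coordinates x y))))

      X Y : Carrier → Carrier → Carrier
      X x y = proj₁ (proj₂ (coordinates x y))
      Y x y = proj₁ (proj₂ (proj₂ (coordinates x y)))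

      f-XY : ∀ x y → f x y ≡ scale x y ⊙ B (1# ∷ X x y ∷ Y x y ∷ [])
      f-XY x y = proj₂ (proj₂ (proj₂ (proj₂ (coordinates x y))))

      hx-B : hx ≡ 1# ⊙ B (0# ∷ 1# ∷ 0# ∷ [])
      hx-B = sym (trans (⊙-identity _) (trans (B-infinite 1# 0#)
        (trans (cong₂ _⊕_ (⊙-identity hx) (⊙-zeroˡ hy)) (⊕-identityʳ hx))))

      hy-B : hy ≡ 1# ⊙ B (0# ∷ 0# ∷ 1# ∷ [])
      hy-B = sym (trans (⊙-identity _) (trans (B-infinite 0# 1#)
        (trans (cong₂ _⊕_ (⊙-zeroˡ hx) (⊙-identity hy)) (⊕-identityˡ hy))))

      Collinear-cong : ∀ {u u′ v v′ w w′} → u ≡ u′ → v ≡ v′ → w ≡ w′ → Collinear u v w → Collinear u′ v′ w′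
      Collinear-cong refl refl refl col = col

      module BFrame = Frame B B-linear B-kernel

      1≢0 : 1# ≢ 0#
      1≢0 = 0≢1 ∘ sym

      -- Two affine points are collinear with (0 : 0 : 1) only if their first affine
      -- coordinates agree: the determinant is the sum of these coordinates.
      X-independent : ∀ x y y′ → X x y ≡ X x y′
      X-independent x y y′ = x+y≡0⇒x≡y (trans
        (solve 4 (λ a b a′ b′ → a :+ a′ :=
          :1 :* (a′ :* :1 :+ b′ :* :0) :+ a :* (:1 :* :1 :+ b′ :* :0) :+ b :* (:1 :* :0 :+ a′ :* :0))
          refl (X x y) (Y x y) (X x y′) (Y x y′))
        (BFrame.collinear⇒det≡0 (1# ∷ X x y ∷ Y x y ∷ []) (1# ∷ X x y′ ∷ Y x y′ ∷ []) (0# ∷ 0# ∷ 1# ∷ [])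
          (scale≢0 x y) (scale≢0 x y′) 1≢0
          (Collinear-cong (f-XY x y) (f-XY x y′) hy-B (vertical x y y′))))

      Y-independent : ∀ x x′ y → Y x y ≡ Y x′ y
      Y-independent x x′ y = x+y≡0⇒x≡y (trans
        (solve 4 (λ a b a′ b′ → b :+ b′ :=
          :1 :* (a′ :* :0 :+ b′ :* :1) :+ a :* (:1 :* :0 :+ b′ :* :0) :+ b :* (:1 :* :1 :+ a′ :* :0))
          refl (X x y) (Y x y) (X x′ y) (Y x′ y))
        (BFrame.collinear⇒det≡0 (1# ∷ X x y ∷ Y x y ∷ []) (1# ∷ X x′ y ∷ Y x′ y ∷ []) (0# ∷ 1# ∷ 0# ∷ [])
          (scale≢0 x y) (scale≢0 x′ y) 1≢0
          (Collinear-cong (f-XY x y) (f-XY x′ y) hx-B (horizontal x x′ y))))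

      f-separated : ∀ x y → f x y ≡ scale x y ⊙ B (1# ∷ X x 0# ∷ Y 0# y ∷ [])
      f-separated x y = trans (f-XY x y)
        (cong₂ (λ a b → scale x y ⊙ B (1# ∷ a ∷ b ∷ [])) (X-independent x y 0#) (Y-independent x 0# y))

      o-B : o ≡ B (1# ∷ 0# ∷ 0# ∷ [])
      o-B = sym (begin
        B (1# ∷ 0# ∷ 0# ∷ [])               ≡⟨ B-expand 1# 0# 0# ⟩
        1# ⊙ o ⊕ (0# ⊙ hx ⊕ 0# ⊙ hy)        ≡⟨ cong₂ _⊕_ (⊙-identity o) (cong₂ _⊕_ (⊙-zeroˡ hx) (⊙-zeroˡ hy)) ⟩
        o ⊕ (0ⱽ ⊕ 0ⱽ)                       ≡⟨ cong (o ⊕_) (⊕-self 0ⱽ) ⟩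
        o ⊕ 0ⱽ                              ≡⟨ ⊕-identityʳ o ⟩
        o                                   ∎)

      origin : X 0# 0# ≡ 0# × Y 0# 0# ≡ 0#
      origin = x*y≡0⇒y≡0 (scale≢0 0# 0#) (sym (∷-injectiveˡ (∷-injectiveʳ coordinates≡)))
             , x*y≡0⇒y≡0 (scale≢0 0# 0#) (sym (∷-injectiveˡ (∷-injectiveʳ (∷-injectiveʳ coordinates≡))))
        where
        coordinates≡ : 1# ∷ 0# ∷ 0# ∷ [] ≡ scale 0# 0# ⊙ (1# ∷ X 0# 0# ∷ Y 0# 0# ∷ [])
        coordinates≡ = IsLinear.injective B-linear B-kernel (trans (sym o-B) (trans (f-XY 0# 0#)
          (sym (IsLinear.⊙-homo B-linear (scale 0# 0#) (1# ∷ X 0# 0# ∷ Y 0# 0# ∷ [])))))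

      same-coordinates : ∀ {x y x′ y′} → X x 0# ≡ X x′ 0# → Y 0# y ≡ Y 0# y′ → x ≡ x′ × y ≡ y′
      same-coordinates {x} {y} {x′} {y′} X≡ Y≡ = f-injective (scale x y * 1/ (scale≢0 x′ y′)) (begin
        f x y                                                ≡⟨ f-separated x y ⟩
        scale x y ⊙ B (1# ∷ X x 0# ∷ Y 0# y ∷ [])            ≡⟨ cong₂ (λ a b → scale x y ⊙ B (1# ∷ a ∷ b ∷ [])) X≡ Y≡ ⟩
        scale x y ⊙ B (1# ∷ X x′ 0# ∷ Y 0# y′ ∷ [])          ≡⟨ cong (scale x y ⊙_) (1/-⊙ (scale≢0 x′ y′) _) ⟨
        scale x y ⊙ 1/ (scale≢0 x′ y′) ⊙ scale x′ y′ ⊙ B (1# ∷ X x′ 0# ∷ Y 0# y′ ∷ [])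
          ≡⟨ ⊙-assoc _ _ _ ⟩
        (scale x y * 1/ (scale≢0 x′ y′)) ⊙ scale x′ y′ ⊙ B (1# ∷ X x′ 0# ∷ Y 0# y′ ∷ [])
          ≡⟨ cong ((scale x y * 1/ (scale≢0 x′ y′)) ⊙_) (f-separated x′ y′) ⟨
        (scale x y * 1/ (scale≢0 x′ y′)) ⊙ f x′ y′           ∎)

      a₁ = X 1# 0#
      b₁ = Y 0# 1#

      a₁≢0 : a₁ ≢ 0#
      a₁≢0 eq = 1≢0 (proj₁ (same-coordinates {y = 0#} {y′ = 0#} (trans eq (sym (proj₁ origin))) refl))

      b₁≢0 : b₁ ≢ 0#
      b₁≢0 eq = 1≢0 (proj₂ (same-coordinates {x = 0#} {x′ = 0#} refl (trans eq (sym (proj₂ origin)))))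

      -- Scaling the second and the third basis vector takes (1 , 1) to (1 : 1 : 1).
      rescale : Vector K 3 → Vector K 3
      rescale (x ∷ y ∷ z ∷ []) = x ∷ a₁ * y ∷ b₁ * z ∷ []

      rescale-linear : IsLinear rescale
      rescale-linear = record
        { ⊕-homo = λ { (x ∷ y ∷ z ∷ []) (x′ ∷ y′ ∷ z′ ∷ []) →
            cong₂ (λ y z → x + x′ ∷ y ∷ z ∷ []) (distribˡ a₁ y y′) (distribˡ b₁ z z′) }
        ; ⊙-homo = λ { c (x ∷ y ∷ z ∷ []) → cong₂ (λ y z → c * x ∷ y ∷ z ∷ [])
            (solve 3 (λ c a y → a :* (c :* y) := c :* (a :* y)) refl c a₁ y)
            (solve 3 (λ c a y → a :* (c :* y) := c :* (a :* y)) refl c b₁ z) }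
        }

      rescale-kernel : ∀ v → rescale v ≡ 0ⱽ → v ≡ 0ⱽ
      rescale-kernel (x ∷ y ∷ z ∷ []) eq = cong₂ _∷_ (∷-injectiveˡ eq) (cong₂ (λ y z → y ∷ z ∷ [])
        (x*y≡0⇒y≡0 a₁≢0 (∷-injectiveˡ (∷-injectiveʳ eq)))
        (x*y≡0⇒y≡0 b₁≢0 (∷-injectiveˡ (∷-injectiveʳ (∷-injectiveʳ eq)))))

    abstract
      G : Vector K 3 → Vector K 3
      G = B ∘ rescale

      G-linear : IsLinear G
      G-linear = ∘-linear B-linear rescale-linear

      G-kernel : ∀ v → G v ≡ 0ⱽ → v ≡ 0ⱽ
      G-kernel v eq = rescale-kernel v (B-kernel (rescale v) eq)

      private
        G-B : ∀ x y z → G (x ∷ y ∷ z ∷ []) ≡ B (x ∷ a₁ * y ∷ b₁ * z ∷ [])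
        G-B x y z = refl

    α : Carrier → Carrier
    α x = 1/ a₁≢0 * X x 0#

    private
      β : Carrier → Carrier
      β y = 1/ b₁≢0 * Y 0# y

      f-αβ : ∀ x y → f x y ≡ scale x y ⊙ G (1# ∷ α x ∷ β y ∷ [])
      f-αβ x y = trans (f-separated x y) (cong (scale x y ⊙_) (trans
        (cong₂ (λ a b → B (1# ∷ a ∷ b ∷ [])) (sym (inverse-cancelʳ a₁≢0 _)) (sym (inverse-cancelʳ b₁≢0 _)))
        (sym (G-B 1# (α x) (β y)))))

      α0≡0 : α 0# ≡ 0#
      α0≡0 = trans (cong (1/ a₁≢0 *_) (proj₁ origin)) (zeroʳ _)

      β0≡0 : β 0# ≡ 0#
      β0≡0 = trans (cong (1/ b₁≢0 *_) (proj₂ origin)) (zeroʳ _)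

      β1≡1 : β 1# ≡ 1#
      β1≡1 = *-inverseˡ b₁≢0

      module GFrame = Frame G G-linear G-kernel

    α-1 : α 1# ≡ 1#
    α-1 = *-inverseˡ a₁≢0

    private
      -- The images of (0, 0), (1, m) and (x, m x) are collinear.
      slope : ∀ m x → β (m * x) ≡ β m * α x
      slope m x = x+y≡0⇒x≡y (begin
        β (m * x) + β m * α x ≡⟨ solve 3 (λ bm ax bmx → bmx :+ bm :* ax :=
          :1 :* (:1 :* bmx :+ bm :* ax) :+ :0 :* (:1 :* bmx :+ bm :* :1) :+ :0 :* (:1 :* ax :+ :1 :* :1))
          refl (β m) (α x) (β (m * x)) ⟩
        det (1# ∷ 0# ∷ 0# ∷ []) (1# ∷ 1# ∷ β m ∷ []) (1# ∷ α x ∷ β (m * x) ∷ [])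
          ≡⟨ cong₂ (λ u v → det u v (1# ∷ α x ∷ β (m * x) ∷ []))
               (cong₂ (λ a b → 1# ∷ a ∷ b ∷ []) α0≡0 β0≡0) (cong (λ a → 1# ∷ a ∷ β m ∷ []) α-1) ⟨
        det (1# ∷ α 0# ∷ β 0# ∷ []) (1# ∷ α 1# ∷ β m ∷ []) (1# ∷ α x ∷ β (m * x) ∷ [])
          ≡⟨ GFrame.collinear⇒det≡0 _ _ _ (scale≢0 0# 0#) (scale≢0 1# m) (scale≢0 x (m * x))
               (Collinear-cong (f-αβ 0# 0#) (f-αβ 1# m) (f-αβ x (m * x)) (throughOrigin m x)) ⟩
        0# ∎)

      β≡α : ∀ x → β x ≡ α x
      β≡α x = begin
        β x          ≡⟨ cong β (*-identityˡ x) ⟨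
        β (1# * x)   ≡⟨ slope 1# x ⟩
        β 1# * α x   ≡⟨ cong (_* α x) β1≡1 ⟩
        1# * α x     ≡⟨ *-identityˡ _ ⟩
        α x          ∎

    α-* : ∀ x y → α (x * y) ≡ α x * α y
    α-* x y = trans (sym (β≡α (x * y))) (trans (slope x y) (cong (_* α y) (β≡α x)))

    f-semilinear : ∀ x y → ∃ λ c → c ≢ 0# × f x y ≡ c ⊙ G (1# ∷ α x ∷ α y ∷ [])
    f-semilinear x y = scale x y , scale≢0 x y ,
      trans (f-αβ x y) (cong (λ b → scale x y ⊙ G (1# ∷ α x ∷ b ∷ [])) (β≡α y))

    private
      f-α : ∀ x y → f x y ≡ scale x y ⊙ G (1# ∷ α x ∷ α y ∷ [])
      f-α x y = proj₂ (proj₂ (f-semilinear x y))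

      hd-coordinates : ∃₂ λ d e → hd ≡ 1# ⊙ G (0# ∷ d ∷ e ∷ [])
      hd-coordinates = let c , eq = B-onto hd in fromL∞ c eq
        where
        fromL∞ : ∀ c → B c ≡ hd → ∃₂ λ d e → hd ≡ 1# ⊙ G (0# ∷ d ∷ e ∷ [])
        fromL∞ (x ∷ y ∷ z ∷ []) eq = 1/ a₁≢0 * y , 1/ b₁≢0 * z , sym (begin
          1# ⊙ G (0# ∷ 1/ a₁≢0 * y ∷ 1/ b₁≢0 * z ∷ [])   ≡⟨ ⊙-identity _ ⟩
          G (0# ∷ 1/ a₁≢0 * y ∷ 1/ b₁≢0 * z ∷ [])        ≡⟨ G-B 0# (1/ a₁≢0 * y) (1/ b₁≢0 * z) ⟩
          B (0# ∷ a₁ * (1/ a₁≢0 * y) ∷ b₁ * (1/ b₁≢0 * z) ∷ [])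
            ≡⟨ cong B (cong₂ _∷_ (sym x≡0) (cong₂ (λ y z → y ∷ z ∷ []) (inverse-cancelʳ a₁≢0 y) (inverse-cancelʳ b₁≢0 z))) ⟩
          B (x ∷ y ∷ z ∷ [])                             ≡⟨ eq ⟩
          hd                                             ∎)
          where
          x≡0 : x ≡ 0#
          x≡0 = ∈L∞⇒0 (subst (_∈ L∞) (sym eq) hd∈L∞)

      d = proj₁ hd-coordinates
      d′ = proj₁ (proj₂ hd-coordinates)

      hd-G : hd ≡ 1# ⊙ G (0# ∷ d ∷ d′ ∷ [])
      hd-G = proj₂ (proj₂ hd-coordinates)

      -- The images of (0, c), (x, x + c) and the diagonal direction are collinear.
      parallel : ∀ c x → d * (α (x + c) + α c) + d′ * α x ≡ 0#
      parallel c x = begin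
        d * (α (x + c) + α c) + d′ * α x ≡⟨ solve 5 (λ ac axc ax d d′ → d :* (axc :+ ac) :+ d′ :* ax :=
          :1 :* (ax :* d′ :+ axc :* d) :+ :0 :* (:1 :* d′ :+ axc :* :0) :+ ac :* (:1 :* d :+ ax :* :0))
          refl (α c) (α (x + c)) (α x) d d′ ⟩
        det (1# ∷ 0# ∷ α c ∷ []) (1# ∷ α x ∷ α (x + c) ∷ []) (0# ∷ d ∷ d′ ∷ [])
          ≡⟨ cong₂ (λ a b → det (1# ∷ a ∷ α b ∷ []) (1# ∷ α x ∷ α (x + c) ∷ []) (0# ∷ d ∷ d′ ∷ [])) α0≡0 (+-identityˡ c) ⟨
        det (1# ∷ α 0# ∷ α (0# + c) ∷ []) (1# ∷ α x ∷ α (x + c) ∷ []) (0# ∷ d ∷ d′ ∷ [])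
          ≡⟨ GFrame.collinear⇒det≡0 _ _ _ (scale≢0 0# (0# + c)) (scale≢0 x (x + c)) 1≢0
               (Collinear-cong (f-α 0# (0# + c)) (f-α x (x + c)) hd-G (diagonal c 0# x)) ⟩
        0# ∎

      d≡d′ : d ≡ d′
      d≡d′ = x+y≡0⇒x≡y (begin
        d + d′                                   ≡⟨ solve 2 (λ d d′ → d :+ d′ := d :* (:1 :+ :0) :+ d′ :* :1) refl d d′ ⟩
        d * (1# + 0#) + d′ * 1#                  ≡⟨ cong₂ (λ a b → d * (a + b) + d′ * a) α-1 α0≡0 ⟨
        d * (α 1# + α 0#) + d′ * α 1#            ≡⟨ cong (λ x → d * (α x + α 0#) + d′ * α 1#) (+-identityʳ 1#) ⟨
        d * (α (1# + 0#) + α 0#) + d′ * α 1#     ≡⟨ parallel 0# 1# ⟩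
        0#                                       ∎)

      d≢0 : d ≢ 0#
      d≢0 d≡0 = hd≢0 (begin
        hd                              ≡⟨ hd-G ⟩
        1# ⊙ G (0# ∷ d ∷ d′ ∷ [])       ≡⟨ ⊙-identity _ ⟩
        G (0# ∷ d ∷ d′ ∷ [])            ≡⟨ cong₂ (λ a b → G (0# ∷ a ∷ b ∷ [])) d≡0 (trans (sym d≡d′) d≡0) ⟩
        G 0ⱽ                            ≡⟨ IsLinear.0-homo G-linear ⟩
        0ⱽ                              ∎)

    α-+ : ∀ x y → α (x + y) ≡ α x + α y
    α-+ x y = x+y≡0⇒x≡y (x*y≡0⇒y≡0 d≢0 (begin
      d * (α (x + y) + (α x + α y))           ≡⟨ solve 4 (λ d axy ax ay →
        d :* (axy :+ (ax :+ ay)) := d :* (axy :+ ay) :+ d :* ax) refl d (α (x + y)) (α x) (α y) ⟩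
      d * (α (x + y) + α y) + d * α x         ≡⟨ cong (λ e → d * (α (x + y) + α y) + e * α x) d≡d′ ⟩
      d * (α (x + y) + α y) + d′ * α x        ≡⟨ parallel y x ⟩
      0#                                      ∎))

    hy-image : ∃ λ c → c ≢ 0# × hy ≡ c ⊙ G (0# ∷ 0# ∷ 1# ∷ [])
    hy-image = 1/ b₁≢0 , 1/-nonzero b₁≢0 , sym (begin
      1/ b₁≢0 ⊙ G (0# ∷ 0# ∷ 1# ∷ [])               ≡⟨ cong (1/ b₁≢0 ⊙_) (G-B 0# 0# 1#) ⟩
      1/ b₁≢0 ⊙ B (0# ∷ a₁ * 0# ∷ b₁ * 1# ∷ [])     ≡⟨ IsLinear.⊙-homo B-linear _ _ ⟨
      B (1/ b₁≢0 ⊙ (0# ∷ a₁ * 0# ∷ b₁ * 1# ∷ []))   ≡⟨ cong B (cong₂ _∷_ (zeroʳ _) (cong₂ (λ y z → y ∷ z ∷ [])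
        (trans (cong (1/ b₁≢0 *_) (zeroʳ a₁)) (zeroʳ _)) (inverse-cancelˡ b₁≢0 1#))) ⟩
      B (0# ∷ 0# ∷ 1# ∷ [])                         ≡⟨ trans hy-B (⊙-identity _) ⟨
      hy                                            ∎)

-- The quadratic extension

module Extension (F K : Field) (e : ℕ) (F-order : HasOrder F (2 ℕ.^ (2 ℕ.* e ℕ.+ 1)))
                 (K-order : HasOrder K ((2 ℕ.^ (2 ℕ.* e ℕ.+ 1)) ℕ.^ 2)) (ι : Embedding F K) where
  module F where
    open Field F public
    open TitsForm F e F-order using (1+1≡0) public
    open Characteristic2 F 1+1≡0 public
    open FiniteField F F-order using (_≟_; frobenius-fixed; 1<order) public
  open TitsForm F e F-order using (_^σ; σ-root; 0^σ; tits; tits-translate; tits-scale)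
  open Field K
  open Embedding ι using (⟦_⟧)
  private
    q = 2 ℕ.^ (2 ℕ.* e ℕ.+ 1)
    module ι = RingMorphisms.IsRingMonomorphism (Embedding.isRingMonomorphism ι)

  ι-injective : ∀ {a b} → ⟦ a ⟧ ≡ ⟦ b ⟧ → a ≡ b
  ι-injective = ι.injective

  ι-+ : ∀ a b → ⟦ a F.+ b ⟧ ≡ ⟦ a ⟧ + ⟦ b ⟧
  ι-+ = ι.+-homo

  ι-* : ∀ a b → ⟦ a F.* b ⟧ ≡ ⟦ a ⟧ * ⟦ b ⟧
  ι-* = ι.*-homo

  ι-0 : ⟦ F.0# ⟧ ≡ 0#
  ι-0 = ι.0#-homo

  ι-1 : ⟦ F.1# ⟧ ≡ 1#
  ι-1 = ι.1#-homo

  ι-^ : ∀ a n → ⟦ a F.^ n ⟧ ≡ ⟦ a ⟧ ^ n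
  ι-^ a zero    = ι-1
  ι-^ a (suc n) = trans (ι-* a (a F.^ n)) (cong (⟦ a ⟧ *_) (ι-^ a n))

  1+1≡0 : 1# + 1# ≡ 0#
  1+1≡0 = begin
    1# + 1#                   ≡⟨ cong₂ _+_ ι-1 ι-1 ⟨
    ⟦ F.1# ⟧ + ⟦ F.1# ⟧       ≡⟨ ι-+ F.1# F.1# ⟨
    ⟦ F.1# F.+ F.1# ⟧         ≡⟨ cong ⟦_⟧ F.1+1≡0 ⟩
    ⟦ F.0# ⟧                  ≡⟨ ι-0 ⟩
    0#                        ∎

  open Characteristic2 K 1+1≡0
  open FiniteField K K-order using (_≟_)
  open LinearAlgebra K K-order 1+1≡0

  ι-nonzero : ∀ {a} → a ≢ F.0# → ⟦ a ⟧ ≢ 0#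
  ι-nonzero a≢0 eq = a≢0 (ι-injective (trans eq (sym ι-0)))

  Outside : Carrier → Set
  Outside u = ∀ a → ⟦ a ⟧ ≢ u

  outside-exists : ∃ Outside
  outside-exists = Counting.missed F-order K-order q<q² ⟦_⟧
    where
    q<q² : q ℕ.< q ℕ.^ 2
    q<q² = subst (ℕ._< q ℕ.^ 2) (ℕ.*-identityʳ q) (ℕ.^-monoʳ-< q F.1<order (ℕ.n<1+n 1))

  module Basis {u : Carrier} (u∉F : Outside u) where

    independent : ∀ a b → ⟦ a ⟧ + ⟦ b ⟧ * u ≡ 0# → a ≡ F.0# × b ≡ F.0#
    independent a b eq with b F.≟ F.0#
    ... | yes refl = ι-injective (trans (begin
        ⟦ a ⟧                     ≡⟨ solve 2 (λ a u → a := a :+ :0 :* u) refl ⟦ a ⟧ u ⟩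
        ⟦ a ⟧ + 0# * u            ≡⟨ cong (λ z → ⟦ a ⟧ + z * u) ι-0 ⟨
        ⟦ a ⟧ + ⟦ F.0# ⟧ * u      ≡⟨ eq ⟩
        0#                        ∎) (sym ι-0)) , refl
    ... | no b≢0 = contradiction (*-cancelˡ (ι-nonzero b≢0) (begin
        ⟦ b ⟧ * ⟦ F.1/ b≢0 F.* a ⟧   ≡⟨ ι-* b _ ⟨
        ⟦ b F.* (F.1/ b≢0 F.* a) ⟧   ≡⟨ cong ⟦_⟧ (F.inverse-cancelʳ b≢0 a) ⟩
        ⟦ a ⟧                        ≡⟨ x+y≡0⇒x≡y eq ⟩
        ⟦ b ⟧ * u                    ∎)) (u∉F _)

    -- By counting, the combinations of 1 and u exhaust K.
    decompose : ∀ k → ∃₂ λ a b → k ≡ ⟦ a ⟧ + ⟦ b ⟧ * u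
    decompose k =
      let (a , b) , eq = Counting.injective⇒surjective (F-order ×-finite F-order) K-order
                           (cong (q ℕ.*_) (sym (ℕ.*-identityʳ q)))
                           (λ (a , b) → ⟦ a ⟧ + ⟦ b ⟧ * u) unique k
      in a , b , sym eq
      where
      unique : ∀ {x y : F.Carrier × F.Carrier} →
        ⟦ proj₁ x ⟧ + ⟦ proj₂ x ⟧ * u ≡ ⟦ proj₁ y ⟧ + ⟦ proj₂ y ⟧ * u → x ≡ y
      unique {a , b} {a′ , b′} eq = cong₂ _,_ (F.x+y≡0⇒x≡y (proj₁ zeros)) (F.x+y≡0⇒x≡y (proj₂ zeros))
        where
        zeros : a F.+ a′ ≡ F.0# × b F.+ b′ ≡ F.0#
        zeros = independent (a F.+ a′) (b F.+ b′) (begin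
          ⟦ a F.+ a′ ⟧ + ⟦ b F.+ b′ ⟧ * u                    ≡⟨ cong₂ (λ x y → x + y * u) (ι-+ a a′) (ι-+ b b′) ⟩
          ⟦ a ⟧ + ⟦ a′ ⟧ + (⟦ b ⟧ + ⟦ b′ ⟧) * u              ≡⟨ solve 5 (λ a a′ b b′ u →
            a :+ a′ :+ (b :+ b′) :* u := a :+ b :* u :+ (a′ :+ b′ :* u)) refl ⟦ a ⟧ ⟦ a′ ⟧ ⟦ b ⟧ ⟦ b′ ⟧ u ⟩
          ⟦ a ⟧ + ⟦ b ⟧ * u + (⟦ a′ ⟧ + ⟦ b′ ⟧ * u)          ≡⟨ cong (_+ (⟦ a′ ⟧ + ⟦ b′ ⟧ * u)) eq ⟩
          ⟦ a′ ⟧ + ⟦ b′ ⟧ * u + (⟦ a′ ⟧ + ⟦ b′ ⟧ * u)        ≡⟨ x+x≡0 _ ⟩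
          0#                                                 ∎)

    decompose-outside : ∀ {v} → Outside v → ∃₂ λ a b → b ≢ F.0# × v ≡ ⟦ a ⟧ + ⟦ b ⟧ * u
    decompose-outside {v} v∉F = let a , b , eq = decompose v in a , b , nonzero a eq , eq
      where
      nonzero : ∀ a {b} → v ≡ ⟦ a ⟧ + ⟦ b ⟧ * u → b ≢ F.0#
      nonzero a eq refl = v∉F a (sym (trans eq (trans (cong (λ z → ⟦ a ⟧ + z * u) ι-0)
        (solve 2 (λ a u → a :+ :0 :* u := a) refl ⟦ a ⟧ u))))

  -- Otherwise x and the q elements of F would be too many roots of X ^ q + X.
  fixed⇒inside : ∀ x → x ^ q ≡ x → ∃ λ a → ⟦ a ⟧ ≡ x
  fixed⇒inside x fixed with Fin.any? (λ i → ⟦ Inverse.from F-order i ⟧ ≟ x)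
  ... | yes (i , eq) = Inverse.from F-order i , eq
  ... | no ¬inside   = ⊥-elim (MonicPolynomials.noMoreFixedPoints K 1+1≡0 q F.1<order roots distinct roots-fixed)
    where
    roots : Fin (suc q) → Carrier
    roots zero    = x
    roots (suc i) = ⟦ Inverse.from F-order i ⟧
    distinct : ∀ {i j} → roots i ≡ roots j → i ≡ j
    distinct {zero}  {zero}  eq = refl
    distinct {zero}  {suc j} eq = contradiction (j , sym eq) ¬inside
    distinct {suc i} {zero}  eq = contradiction (i , eq) ¬inside
    distinct {suc i} {suc j} eq = cong suc (begin
      i                                                  ≡⟨ Inverse.strictlyInverseˡ F-order i ⟨
      Inverse.to F-order (Inverse.from F-order i)        ≡⟨ cong (Inverse.to F-order) (ι-injective eq) ⟩
      Inverse.to F-order (Inverse.from F-order j)        ≡⟨ Inverse.strictlyInverseˡ F-order j ⟩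
      j                                                  ∎)
    roots-fixed : ∀ i → roots i ^ q ≡ roots i
    roots-fixed zero    = fixed
    roots-fixed (suc i) = trans (sym (ι-^ _ q)) (cong ⟦_⟧ (F.frobenius-fixed _))

  -- Coordinate form of the unitals

  -- The parameter p runs along a generator of the cone; s and t determine the
  -- generator.
  unitalPoint : (u w d : Carrier) (s t p : F.Carrier) → Vector K 3
  unitalPoint u w d s t p = 1# ∷ ⟦ s ⟧ * u + ⟦ t ⟧ ∷ ⟦ p ⟧ + ⟦ s ⟧ * d + ⟦ tits s t ⟧ * w ∷ []

  vertexPoint : Vector K 3
  vertexPoint = 0# ∷ 0# ∷ 1# ∷ []

  data CoordinateUnital (u w d : Carrier) : Vector K 3 → Set where
    vertical : CoordinateUnital u w d vertexPoint
    finite   : ∀ s t p → CoordinateUnital u w d (unitalPoint u w d s t p)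

  _HasCoordinates_By_ : PointSet K 2 → (Vector K 3 → Set) → Automorphism 3 → Set
  U HasCoordinates S By G = ∀ Q → U Q ⇔ (∃ λ v → S v × Automorphism.to G v ∈ Q)

  HasCoordinateForm : PointSet K 2 → Set
  HasCoordinateForm U = ∃₂ λ u w → ∃₂ λ d G →
    Outside u × Outside w × U HasCoordinates CoordinateUnital u w d By G

  -- Automorphisms of the extension

  -- F is the only subfield of its order, so that every automorphism α of K
  -- induces an automorphism of F.
  module Restriction (α : Carrier → Carrier) (α-+ : ∀ x y → α (x + y) ≡ α x + α y)
                     (α-* : ∀ x y → α (x * y) ≡ α x * α y) (α-1 : α 1# ≡ 1#) where

    α-^ : ∀ x n → α (x ^ n) ≡ α x ^ n
    α-^ x zero    = α-1
    α-^ x (suc n) = trans (α-* x (x ^ n)) (cong (α x *_) (α-^ x n))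

    α-injective : ∀ {x y} → α x ≡ α y → x ≡ y
    α-injective {x} {y} eq with (x + y) ≟ 0#
    ... | yes x+y≡0 = x+y≡0⇒x≡y x+y≡0
    ... | no x+y≢0  = contradiction (begin
      0#                                 ≡⟨ zeroˡ (α (1/ x+y≢0)) ⟨
      0# * α (1/ x+y≢0)                  ≡⟨ cong (_* α (1/ x+y≢0)) (trans (cong (_+ α y) eq) (x+x≡0 (α y))) ⟨
      (α x + α y) * α (1/ x+y≢0)         ≡⟨ cong (_* α (1/ x+y≢0)) (α-+ x y) ⟨
      α (x + y) * α (1/ x+y≢0)           ≡⟨ α-* _ _ ⟨
      α ((x + y) * 1/ x+y≢0)             ≡⟨ cong α (*-inverseʳ x+y≢0) ⟩
      α 1#                               ≡⟨ α-1 ⟩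
      1#                                 ∎) 0≢1

    private
      restricted : ∀ a → ∃ λ b → ⟦ b ⟧ ≡ α ⟦ a ⟧
      restricted a = fixed⇒inside (α ⟦ a ⟧) (begin
        α ⟦ a ⟧ ^ q        ≡⟨ α-^ ⟦ a ⟧ q ⟨
        α (⟦ a ⟧ ^ q)      ≡⟨ cong α (ι-^ a q) ⟨
        α ⟦ a F.^ q ⟧      ≡⟨ cong (λ x → α ⟦ x ⟧) (F.frobenius-fixed a) ⟩
        α ⟦ a ⟧            ∎)

    abstract
      αᶠ : F.Carrier → F.Carrier
      αᶠ a = proj₁ (restricted a)

      ι-αᶠ : ∀ a → ⟦ αᶠ a ⟧ ≡ α ⟦ a ⟧
      ι-αᶠ a = proj₂ (restricted a)

    αᶠ-+ : ∀ a b → αᶠ (a F.+ b) ≡ αᶠ a F.+ αᶠ b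
    αᶠ-+ a b = ι-injective (begin
      ⟦ αᶠ (a F.+ b) ⟧          ≡⟨ trans (ι-αᶠ _) (cong α (ι-+ a b)) ⟩
      α (⟦ a ⟧ + ⟦ b ⟧)         ≡⟨ α-+ _ _ ⟩
      α ⟦ a ⟧ + α ⟦ b ⟧         ≡⟨ cong₂ _+_ (ι-αᶠ a) (ι-αᶠ b) ⟨
      ⟦ αᶠ a ⟧ + ⟦ αᶠ b ⟧       ≡⟨ ι-+ _ _ ⟨
      ⟦ αᶠ a F.+ αᶠ b ⟧         ∎)

    αᶠ-* : ∀ a b → αᶠ (a F.* b) ≡ αᶠ a F.* αᶠ b
    αᶠ-* a b = ι-injective (begin
      ⟦ αᶠ (a F.* b) ⟧          ≡⟨ trans (ι-αᶠ _) (cong α (ι-* a b)) ⟩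
      α (⟦ a ⟧ * ⟦ b ⟧)         ≡⟨ α-* _ _ ⟩
      α ⟦ a ⟧ * α ⟦ b ⟧         ≡⟨ cong₂ _*_ (ι-αᶠ a) (ι-αᶠ b) ⟨
      ⟦ αᶠ a ⟧ * ⟦ αᶠ b ⟧       ≡⟨ ι-* _ _ ⟨
      ⟦ αᶠ a F.* αᶠ b ⟧         ∎)

    αᶠ-^ : ∀ a n → αᶠ (a F.^ n) ≡ αᶠ a F.^ n
    αᶠ-^ a zero    = ι-injective (trans (ι-αᶠ _) (trans (cong α ι-1) (trans α-1 (sym ι-1))))
    αᶠ-^ a (suc n) = trans (αᶠ-* a (a F.^ n)) (cong (αᶠ a F.*_) (αᶠ-^ a n))

    αᶠ-tits : ∀ s t → αᶠ (tits s t) ≡ tits (αᶠ s) (αᶠ t)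
    αᶠ-tits s t = trans (αᶠ-+ _ _) (cong₂ F._+_ (trans (αᶠ-+ _ _)
      (cong₂ F._+_ (αᶠ-^ s (2 ℕ.^ (e ℕ.+ 1) ℕ.+ 2)) (αᶠ-^ t (2 ℕ.^ (e ℕ.+ 1))))) (αᶠ-* s t))

    αᶠ-onto : ∀ b → ∃ λ a → αᶠ a ≡ b
    αᶠ-onto = Counting.injective⇒surjective F-order F-order refl αᶠ λ {a} {b} eq →
      ι-injective (α-injective (trans (sym (ι-αᶠ a)) (trans (cong ⟦_⟧ eq) (ι-αᶠ b))))

    α-outside : ∀ {u} → Outside u → Outside (α u)
    α-outside u∉F b eq with αᶠ-onto b
    ... | a , refl = u∉F a (α-injective (trans (sym (ι-αᶠ a)) eq))

    α-unitalPoint : ∀ u w d s t p →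
      1# ∷ α (⟦ s ⟧ * u + ⟦ t ⟧) ∷ α (⟦ p ⟧ + ⟦ s ⟧ * d + ⟦ tits s t ⟧ * w) ∷ [] ≡
      unitalPoint (α u) (α w) (α d) (αᶠ s) (αᶠ t) (αᶠ p)
    α-unitalPoint u w d s t p = cong₂ (λ x y → 1# ∷ x ∷ y ∷ [])
      (trans (α-+ _ _) (cong₂ _+_ (α-ι* s u) (sym (ι-αᶠ t))))
      (trans (α-+ _ _) (cong₂ _+_ (trans (α-+ _ _) (cong₂ _+_ (sym (ι-αᶠ p)) (α-ι* s d)))
        (trans (α-ι* (tits s t) w) (cong (λ z → ⟦ z ⟧ * α w) (αᶠ-tits s t)))))
      where
      α-ι* : ∀ a k → α (⟦ a ⟧ * k) ≡ ⟦ αᶠ a ⟧ * α k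
      α-ι* a k = trans (α-* ⟦ a ⟧ k) (cong (_* α k) (sym (ι-αᶠ a)))

    unitalPoint-αᶠ : ∀ u w d s′ t′ p′ → ∃ λ s → ∃₂ λ t p →
      unitalPoint u w d s′ t′ p′ ≡ unitalPoint u w d (αᶠ s) (αᶠ t) (αᶠ p)
    unitalPoint-αᶠ u w d s′ t′ p′ =
      let s , s≡ = αᶠ-onto s′
          t , t≡ = αᶠ-onto t′
          p , p≡ = αᶠ-onto p′
      in s , t , p , same (sym s≡) (sym t≡) (sym p≡)
      where
      same : ∀ {s t p s′ t′ p′} → s ≡ s′ → t ≡ t′ → p ≡ p′ →
        unitalPoint u w d s t p ≡ unitalPoint u w d s′ t′ p′
      same refl refl refl = refl

    -- As α preserves F and commutes with tits, it takes the points with parameters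
    -- (u , w , d) to those with parameters (α u , α w , α d).
    semilinear-image : ∀ {U} (G : Automorphism 3) u w d →
      (∀ Q → U Q ⇔ (Automorphism.to G vertexPoint ∈ Q ⊎ ∃ λ s → ∃₂ λ t p → Automorphism.to G
        (1# ∷ α (⟦ s ⟧ * u + ⟦ t ⟧) ∷ α (⟦ p ⟧ + ⟦ s ⟧ * d + ⟦ tits s t ⟧ * w) ∷ []) ∈ Q)) →
      U HasCoordinates CoordinateUnital (α u) (α w) (α d) By G
    semilinear-image {U} G u w d U⇔ Q = mk⇔ (⇒ ∘ Equivalence.to (U⇔ Q)) (Equivalence.from (U⇔ Q) ∘ ⇐)
      where
      module G = Automorphism G
      Source : Set
      Source = G.to vertexPoint ∈ Q ⊎ ∃ λ s → ∃₂ λ t p →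
        G.to (1# ∷ α (⟦ s ⟧ * u + ⟦ t ⟧) ∷ α (⟦ p ⟧ + ⟦ s ⟧ * d + ⟦ tits s t ⟧ * w) ∷ []) ∈ Q
      ⇒ : Source → ∃ λ v → CoordinateUnital (α u) (α w) (α d) v × G.to v ∈ Q
      ⇒ (inj₁ ∈Q)               = vertexPoint , vertical , ∈Q
      ⇒ (inj₂ (s , t , p , ∈Q)) = _ , finite (αᶠ s) (αᶠ t) (αᶠ p) ,
        subst (λ v → G.to v ∈ Q) (α-unitalPoint u w d s t p) ∈Q
      ⇐ : (∃ λ v → CoordinateUnital (α u) (α w) (α d) v × G.to v ∈ Q) → Source
      ⇐ (_ , vertical , ∈Q)          = inj₁ ∈Q
      ⇐ (_ , finite s′ t′ p′ , ∈Q) =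
        let s , t , p , eq = unitalPoint-αᶠ (α u) (α w) (α d) s′ t′ p′
        in inj₂ (s , t , p , subst (λ v → G.to v ∈ Q) (trans eq (sym (α-unitalPoint u w d s t p))) ∈Q)

  change-coordinates : ∀ {U S S′ G T} → Carries T S S′ → U HasCoordinates S By G →
                       U HasCoordinates S′ By (G ∘ᴬ inverse T)
  change-coordinates {U} {S} {S′} {G} {T} carries U-S Q = mk⇔ ⇒ ⇐
    where
    module G = Automorphism G
    module T⁻¹ = Automorphism (inverse T)
    open Carries carries
    pull : ∀ {c v v′} → Automorphism.to T v ≡ c ⊙ v′ → G.to v ≡ c ⊙ G.to (T⁻¹.to v′)
    pull {c} {v} {v′} eq = begin
      G.to v                                   ≡⟨ cong G.to (inverse-to T v) ⟨
      G.to (T⁻¹.to (Automorphism.to T v))      ≡⟨ cong (G.to ∘ T⁻¹.to) eq ⟩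
      G.to (T⁻¹.to (c ⊙ v′))                   ≡⟨ cong G.to (T⁻¹.⊙-homo c v′) ⟩
      G.to (c ⊙ T⁻¹.to v′)                     ≡⟨ G.⊙-homo c _ ⟩
      c ⊙ G.to (T⁻¹.to v′)                     ∎
    ⇒ : U Q → ∃ λ v′ → S′ v′ × G.to (T⁻¹.to v′) ∈ Q
    ⇒ UQ =
      let v , Sv , ∈Q              = Equivalence.to (U-S Q) UQ
          c , v′ , c≢0 , S′v′ , eq = forth Sv
      in v′ , S′v′ , ∈-⊙⁻¹ Q c≢0 (subst (_∈ Q) (pull eq) ∈Q)
    ⇐ : (∃ λ v′ → S′ v′ × G.to (T⁻¹.to v′) ∈ Q) → U Q
    ⇐ (v′ , S′v′ , ∈Q) =
      let c , v , c≢0 , Sv , eq = back S′v′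
      in Equivalence.from (U-S Q) (v , Sv , subst (_∈ Q) (sym (pull eq)) (∈-⊙ Q c ∈Q))

  same-coordinates⇒equivalent : ∀ {U₁ U₂ S G₁ G₂} → (∀ {v} → S v → v ≢ 0ⱽ) →
    U₁ HasCoordinates S By G₁ → U₂ HasCoordinates S By G₂ →
    ∃ λ (g : PGL 3 K) → (g ⟨$⟩ U₁) ≐ U₂
  same-coordinates⇒equivalent {U₁} {U₂} {S} {G₁} {G₂} S≢0 U₁-S U₂-S =
    toPGL g , (λ {Q} → ⇒ Q) , (λ {Q} → ⇐ Q)
    where
    module G₁ = Automorphism G₁
    module G₂ = Automorphism G₂
    g = G₂ ∘ᴬ inverse G₁
    module g = Automorphism g
    g-G₁ : ∀ v → g.to (G₁.to v) ≡ G₂.to v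
    g-G₁ v = cong G₂.to (inverse-to G₁ v)
    ⇒ : ∀ Q → (toPGL g ⟨$⟩ U₁) Q → U₂ Q
    ⇒ Q (P , U₁P , image) =
      let v , Sv , ∈P = Equivalence.to (U₁-S P) U₁P
      in Equivalence.from (U₂-S Q) (v , Sv , Equivalence.from (image (G₂.to v)) (G₁.to v , ∈P , g-G₁ v))
    ⇐ : ∀ Q → U₂ Q → (toPGL g ⟨$⟩ U₁) Q
    ⇐ Q U₂Q =
      let v , Sv , ∈Q = Equivalence.to (U₂-S Q) U₂Q
          v≢0         = S≢0 Sv
          P           = point (G₁.to v) (v≢0 ∘ G₁.kernel v)
      in P , Equivalence.from (U₁-S P) (v , Sv , vector∈ P) , image Q v v≢0 ∈Q
      where
      image : ∀ Q v (v≢0 : v ≢ 0ⱽ) → G₂.to v ∈ Q → IsImage g.to (point (G₁.to v) (v≢0 ∘ G₁.kernel v)) Q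
      image Q v v≢0 ∈Q x = mk⇔ to from
        where
        P = point (G₁.to v) (v≢0 ∘ G₁.kernel v)
        g-multiple : ∀ c → g.to (c ⊙ G₁.to v) ≡ c ⊙ G₂.to v
        g-multiple c = trans (g.⊙-homo c (G₁.to v)) (cong (c ⊙_) (g-G₁ v))
        to : x ∈ Q → ∃ λ y → y ∈ P × g.to y ≡ x
        to x∈Q =
          let c , eq = ∈-point-nonzero Q (v≢0 ∘ G₂.kernel v) ∈Q x∈Q
          in c ⊙ G₁.to v , ∈-vector P c , trans (g-multiple c) (sym eq)
        from : (∃ λ y → y ∈ P × g.to y ≡ x) → x ∈ Q
        from (y , y∈P , eq) =
          let c , y≡ = ∈-point P y∈P
          in subst (_∈ Q) (trans (sym (g-multiple c)) (trans (cong g.to (sym y≡)) eq)) (∈-⊙ Q c ∈Q)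

  CoordinateUnital-nonzero : ∀ {u w d v} → CoordinateUnital u w d v → v ≢ 0ⱽ
  CoordinateUnital-nonzero vertical       eq = 0≢1 (sym (∷-injectiveˡ (∷-injectiveʳ (∷-injectiveʳ eq))))
  CoordinateUnital-nonzero (finite s t p) eq = 0≢1 (sym (∷-injectiveˡ eq))

  -- Normalising the coordinates

  private
    infixl 6 _⟪+⟫_
    infixl 7 _⟪*⟫_

    _⟪+⟫_ : ∀ {a b x y} → ⟦ a ⟧ ≡ x → ⟦ b ⟧ ≡ y → ⟦ a F.+ b ⟧ ≡ x + y
    _⟪+⟫_ {a} {b} refl refl = ι-+ a b

    _⟪*⟫_ : ∀ {a b x y} → ⟦ a ⟧ ≡ x → ⟦ b ⟧ ≡ y → ⟦ a F.* b ⟧ ≡ x * y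
    _⟪*⟫_ {a} {b} refl refl = ι-* a b

    affine-onto : ∀ {c} → c ≢ F.0# → ∀ b y → ∃ λ x → c F.* x F.+ b ≡ y
    affine-onto {c} c≢0 b y = F.1/ c≢0 F.* (y F.+ b) ,
      trans (cong (F._+ b) (F.inverse-cancelʳ c≢0 (y F.+ b)))
        (F.solve 2 (λ y b → y F.:+ b F.:+ b F.:= y) refl y b)

    -- By tits-scale, (s , t) ↦ (δ s , dilation δ t) multiplies the height of a point of
    -- the ovoid by dilation₂ δ.
    dilation : F.Carrier → F.Carrier
    dilation δ = δ ^σ F.* δ

    dilation₂ : F.Carrier → F.Carrier
    dilation₂ δ = δ ^σ F.* (δ F.* δ)

  -- The automorphism s′ = δ s + a, t′ = k t + a ^σ δ s of the ovoid satisfies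
  -- s′ u′ + t′ = k (s u + t) + a u′ because δ ^ σ m = 1 and a ^ σ = δ ^ σ n.  It multiplies
  -- the height by δ ^ (σ + 2) and adds a linear form in s and t and a constant.  The
  -- factor κ of y turns the component v₁ of w along w′ into δ ^ (σ + 2), the multiple h x
  -- supplies the linear form and removes d along w′, and what remains lies in F and
  -- is absorbed by p′.
  module Normalisation {u w u′ w′ d : Carrier}
    {n m v₀ v₁ e₀ e₁ j₀ j₁ δ a : F.Carrier}
    (u≡ : u ≡ ⟦ n ⟧ + ⟦ m ⟧ * u′)
    (w≡ : w ≡ ⟦ v₀ ⟧ + ⟦ v₁ ⟧ * w′) (v₁≢0 : v₁ ≢ F.0#)
    (u≡′ : u ≡ ⟦ e₀ ⟧ + ⟦ e₁ ⟧ * w′) (e₁≢0 : e₁ ≢ F.0#)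
    (δ≢0 : δ ≢ F.0#) (δ^σ*m≡1 : δ ^σ F.* m ≡ F.1#) (a^σ≡ : a ^σ ≡ δ ^σ F.* n)
    (j≡ : ⟦ a F.* dilation δ ⟧ * w′ * u + ⟦ F.1/ v₁≢0 F.* dilation₂ δ ⟧ * d ≡ ⟦ j₀ ⟧ + ⟦ j₁ ⟧ * w′)
    where

    private
      k κ : F.Carrier
      k = dilation δ
      κ = F.1/ v₁≢0 F.* dilation₂ δ

      -- The condition j₁ + g e₁ = a ^ (σ + 1) δ makes the coefficients of s along w′ agree.
      g : F.Carrier
      g = F.1/ e₁≢0 F.* (a ^σ F.* a F.* δ F.+ j₁)

      h : Carrier
      h = ⟦ g ⟧ + ⟦ a F.* k ⟧ * w′

      k≢0 : k ≢ F.0#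
      k≢0 = F.*-nonzero (F.^-nonzero δ≢0 (2 ℕ.^ (e ℕ.+ 1))) δ≢0

      κ≢0 : κ ≢ F.0#
      κ≢0 = F.*-nonzero (F.1/-nonzero v₁≢0)
        (F.*-nonzero (F.^-nonzero δ≢0 (2 ℕ.^ (e ℕ.+ 1))) (F.*-nonzero δ≢0 δ≢0))

      s′ : F.Carrier → F.Carrier
      s′ s = δ F.* s F.+ a

      t′ : F.Carrier → F.Carrier → F.Carrier
      t′ s t = k F.* t F.+ (a ^σ F.* (δ F.* s) F.+ F.0#)

      p′ : F.Carrier → F.Carrier → F.Carrier → F.Carrier
      p′ s t p = κ F.* p F.+ (κ F.* (tits s t F.* v₀) F.+ (s F.* (j₀ F.+ g F.* e₀) F.+ t F.* g))

      matrix : Vector K 3 → Vector K 3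
      matrix (x ∷ y ∷ z ∷ []) =
        x ∷ ⟦ k ⟧ * y + (⟦ a ⟧ * u′) * x ∷ ⟦ κ ⟧ * z + h * y + (⟦ tits a F.0# ⟧ * w′) * x ∷ []

    T : Automorphism 3
    T = record
      { to     = matrix
      ; linear = record
        { ⊕-homo = λ { (x ∷ y ∷ z ∷ []) (x′ ∷ y′ ∷ z′ ∷ []) → cong₂ (λ y z → x + x′ ∷ y ∷ z ∷ [])
            (solve 6 (λ x y x′ y′ k b → k :* (y :+ y′) :+ b :* (x :+ x′) :=
              (k :* y :+ b :* x) :+ (k :* y′ :+ b :* x′)) refl x y x′ y′ ⟦ k ⟧ (⟦ a ⟧ * u′))
            (solve 9 (λ x y z x′ y′ z′ l h c → l :* (z :+ z′) :+ h :* (y :+ y′) :+ c :* (x :+ x′) :=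
              (l :* z :+ h :* y :+ c :* x) :+ (l :* z′ :+ h :* y′ :+ c :* x′))
              refl x y z x′ y′ z′ ⟦ κ ⟧ h (⟦ tits a F.0# ⟧ * w′)) }
        ; ⊙-homo = λ { r (x ∷ y ∷ z ∷ []) → cong₂ (λ y z → r * x ∷ y ∷ z ∷ [])
            (solve 5 (λ r x y k b → k :* (r :* y) :+ b :* (r :* x) := r :* (k :* y :+ b :* x))
              refl r x y ⟦ k ⟧ (⟦ a ⟧ * u′))
            (solve 7 (λ r x y z l h c → l :* (r :* z) :+ h :* (r :* y) :+ c :* (r :* x) :=
              r :* (l :* z :+ h :* y :+ c :* x)) refl r x y z ⟦ κ ⟧ h (⟦ tits a F.0# ⟧ * w′)) }
        }
      ; kernel = λ { (x ∷ y ∷ z ∷ []) eq → triangular x y z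
          (∷-injectiveˡ eq) (∷-injectiveˡ (∷-injectiveʳ eq)) (∷-injectiveˡ (∷-injectiveʳ (∷-injectiveʳ eq))) }
      }
      where
      triangular : ∀ x y z → x ≡ 0# → ⟦ k ⟧ * y + (⟦ a ⟧ * u′) * x ≡ 0# →
        ⟦ κ ⟧ * z + h * y + (⟦ tits a F.0# ⟧ * w′) * x ≡ 0# → x ∷ y ∷ z ∷ [] ≡ 0ⱽ
      triangular x y z refl eq₂ eq₃ = cong₂ (λ y z → 0# ∷ y ∷ z ∷ []) y≡0 z≡0
        where
        y≡0 : y ≡ 0#
        y≡0 = x*y≡0⇒y≡0 (ι-nonzero k≢0)
          (trans (solve 2 (λ ky b → ky := ky :+ b :* :0) refl (⟦ k ⟧ * y) (⟦ a ⟧ * u′)) eq₂)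
        z≡0 : z ≡ 0#
        z≡0 = x*y≡0⇒y≡0 (ι-nonzero κ≢0) (begin
          ⟦ κ ⟧ * z                                                   ≡⟨ solve 3 (λ κz h b →
            κz := κz :+ h :* :0 :+ b :* :0) refl (⟦ κ ⟧ * z) h (⟦ tits a F.0# ⟧ * w′) ⟩
          ⟦ κ ⟧ * z + h * 0# + (⟦ tits a F.0# ⟧ * w′) * 0#            ≡⟨ cong (λ y → ⟦ κ ⟧ * z + h * y + (⟦ tits a F.0# ⟧ * w′) * 0#) y≡0 ⟨
          ⟦ κ ⟧ * z + h * y + (⟦ tits a F.0# ⟧ * w′) * 0#             ≡⟨ eq₃ ⟩
          0#                                                          ∎)

    private
      x-coordinate : ∀ s t → ⟦ k ⟧ * (⟦ s ⟧ * u + ⟦ t ⟧) + (⟦ a ⟧ * u′) * 1# ≡ ⟦ s′ s ⟧ * u′ + ⟦ t′ s t ⟧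
      x-coordinate s t = begin
        ⟦ k ⟧ * (⟦ s ⟧ * u + ⟦ t ⟧) + (⟦ a ⟧ * u′) * 1#
          ≡⟨ cong₂ (λ k u → k * (⟦ s ⟧ * u + ⟦ t ⟧) + (⟦ a ⟧ * u′) * 1#) (ι-* (δ ^σ) δ) u≡ ⟩
        (D * ⟦ δ ⟧) * (⟦ s ⟧ * (⟦ n ⟧ + ⟦ m ⟧ * u′) + ⟦ t ⟧) + (⟦ a ⟧ * u′) * 1#
          ≡⟨ solve 8 (λ D d s n m u′ t a → (D :* d) :* (s :* (n :+ m :* u′) :+ t) :+ (a :* u′) :* :1 :=
            ((D :* m) :* (d :* s) :+ a) :* u′ :+ (D :* d :* t :+ ((D :* n) :* (d :* s) :+ :0)))
            refl D ⟦ δ ⟧ ⟦ s ⟧ ⟦ n ⟧ ⟦ m ⟧ u′ ⟦ t ⟧ ⟦ a ⟧ ⟩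
        ((D * ⟦ m ⟧) * (⟦ δ ⟧ * ⟦ s ⟧) + ⟦ a ⟧) * u′ + (D * ⟦ δ ⟧ * ⟦ t ⟧ + ((D * ⟦ n ⟧) * (⟦ δ ⟧ * ⟦ s ⟧) + 0#))
          ≡⟨ cong₂ (λ x y → (x * (⟦ δ ⟧ * ⟦ s ⟧) + ⟦ a ⟧) * u′ + (D * ⟦ δ ⟧ * ⟦ t ⟧ + (y * (⟦ δ ⟧ * ⟦ s ⟧) + 0#)))
               (trans (sym (ι-* (δ ^σ) m)) (trans (cong ⟦_⟧ δ^σ*m≡1) ι-1))
               (trans (sym (ι-* (δ ^σ) n)) (cong ⟦_⟧ (sym a^σ≡))) ⟩
        (1# * (⟦ δ ⟧ * ⟦ s ⟧) + ⟦ a ⟧) * u′ + (D * ⟦ δ ⟧ * ⟦ t ⟧ + (⟦ a ^σ ⟧ * (⟦ δ ⟧ * ⟦ s ⟧) + 0#))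
          ≡⟨ cong (λ x → (x + ⟦ a ⟧) * u′ + (D * ⟦ δ ⟧ * ⟦ t ⟧ + (⟦ a ^σ ⟧ * (⟦ δ ⟧ * ⟦ s ⟧) + 0#))) (*-identityˡ _) ⟩
        (⟦ δ ⟧ * ⟦ s ⟧ + ⟦ a ⟧) * u′ + (D * ⟦ δ ⟧ * ⟦ t ⟧ + (⟦ a ^σ ⟧ * (⟦ δ ⟧ * ⟦ s ⟧) + 0#))
          ≡⟨ cong₂ (λ x y → x * u′ + y)
               (refl {x = ⟦ δ ⟧} ⟪*⟫ refl {x = ⟦ s ⟧} ⟪+⟫ refl {x = ⟦ a ⟧})
               (refl {x = D} ⟪*⟫ refl {x = ⟦ δ ⟧} ⟪*⟫ refl {x = ⟦ t ⟧} ⟪+⟫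
                 (refl {x = ⟦ a ^σ ⟧} ⟪*⟫ (refl {x = ⟦ δ ⟧} ⟪*⟫ refl {x = ⟦ s ⟧}) ⟪+⟫ ι-0)) ⟨
        ⟦ s′ s ⟧ * u′ + ⟦ t′ s t ⟧ ∎
        where D = ⟦ δ ^σ ⟧

      κ*v₁≡ : κ F.* v₁ ≡ δ ^σ F.* (δ F.* δ)
      κ*v₁≡ = trans (F.*-comm κ v₁) (F.inverse-cancelʳ v₁≢0 _)

      j₁+g*e₁≡ : j₁ F.+ g F.* e₁ ≡ a ^σ F.* a F.* δ
      j₁+g*e₁≡ = trans (cong (j₁ F.+_) (trans (F.*-comm g e₁) (F.inverse-cancelʳ e₁≢0 _)))
        (F.solve 2 (λ j b → j F.:+ (b F.:+ j) F.:= b) refl j₁ (a ^σ F.* a F.* δ))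

      tits-image : ∀ s t → tits (s′ s) (t′ s t) ≡
        κ F.* v₁ F.* tits s t F.+ (s F.* (j₁ F.+ g F.* e₁) F.+ t F.* (a F.* k)) F.+ tits a F.0#
      tits-image s t = begin
        tits (s′ s) (t′ s t)
          ≡⟨ tits-translate a F.0# (δ F.* s) (k F.* t) ⟩
        tits (δ F.* s) (k F.* t) F.+ ((F.0# F.+ a ^σ F.* a) F.* (δ F.* s) F.+ a F.* (k F.* t)) F.+ tits a F.0#
          ≡⟨ cong₂ (λ x y → x F.+ y F.+ tits a F.0#) (tits-scale δ s t)
               (F.solve 6 (λ A a δ s k t → (F.:0 F.:+ A F.:* a) F.:* (δ F.:* s) F.:+ a F.:* (k F.:* t) F.:=
                 s F.:* (A F.:* a F.:* δ) F.:+ t F.:* (a F.:* k)) refl (a ^σ) a δ s k t) ⟩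
        δ ^σ F.* (δ F.* δ) F.* tits s t F.+ (s F.* (a ^σ F.* a F.* δ) F.+ t F.* (a F.* k)) F.+ tits a F.0#
          ≡⟨ cong₂ (λ x y → x F.* tits s t F.+ (s F.* y F.+ t F.* (a F.* k)) F.+ tits a F.0#) κ*v₁≡ j₁+g*e₁≡ ⟨
        κ F.* v₁ F.* tits s t F.+ (s F.* (j₁ F.+ g F.* e₁) F.+ t F.* (a F.* k)) F.+ tits a F.0# ∎

      y-coordinate : ∀ s t p →
        ⟦ κ ⟧ * (⟦ p ⟧ + ⟦ s ⟧ * d + ⟦ tits s t ⟧ * w) + h * (⟦ s ⟧ * u + ⟦ t ⟧) + (⟦ tits a F.0# ⟧ * w′) * 1#
        ≡ ⟦ p′ s t p ⟧ + ⟦ s′ s ⟧ * 0# + ⟦ tits (s′ s) (t′ s t) ⟧ * w′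
      y-coordinate s t p = begin
        κᴷ * (P + S * d + Z * w) + h * (S * u + T′) + (C * w′) * 1#
          ≡⟨ solve 12 (λ κ P S d Z w G L w′ u T C →
            κ :* (P :+ S :* d :+ Z :* w) :+ (G :+ L :* w′) :* (S :* u :+ T) :+ (C :* w′) :* :1 :=
            κ :* P :+ κ :* Z :* w :+ S :* (L :* w′ :* u :+ κ :* d) :+ S :* (G :* u) :+ T :* G :+ (T :* L :+ C) :* w′)
            refl κᴷ P S d Z w G L w′ u T′ C ⟩
        κᴷ * P + κᴷ * Z * w + S * (L * w′ * u + κᴷ * d) + S * (G * u) + T′ * G + (T′ * L + C) * w′
          ≡⟨ cong₂ (λ w j → κᴷ * P + κᴷ * Z * w + S * j + S * (G * u) + T′ * G + (T′ * L + C) * w′) w≡ j≡ ⟩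
        κᴷ * P + κᴷ * Z * (V₀ + V₁ * w′) + S * (J₀ + J₁ * w′) + S * (G * u) + T′ * G + (T′ * L + C) * w′
          ≡⟨ cong (λ u → κᴷ * P + κᴷ * Z * (V₀ + V₁ * w′) + S * (J₀ + J₁ * w′) + S * (G * u) + T′ * G + (T′ * L + C) * w′) u≡′ ⟩
        κᴷ * P + κᴷ * Z * (V₀ + V₁ * w′) + S * (J₀ + J₁ * w′) + S * (G * (E₀ + E₁ * w′)) + T′ * G + (T′ * L + C) * w′
          ≡⟨ solve 16 (λ κP κ Z V₀ V₁ S J₀ J₁ G E₀ E₁ TG TL C w′ σ →
            κP :+ κ :* Z :* (V₀ :+ V₁ :* w′) :+ S :* (J₀ :+ J₁ :* w′) :+ S :* (G :* (E₀ :+ E₁ :* w′)) :+ TG :+ (TL :+ C) :* w′ :=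
            (κP :+ (κ :* (Z :* V₀) :+ (S :* (J₀ :+ G :* E₀) :+ TG)))
              :+ σ :* :0 :+ (κ :* V₁ :* Z :+ (S :* (J₁ :+ G :* E₁) :+ TL) :+ C) :* w′)
            refl (κᴷ * P) κᴷ Z V₀ V₁ S J₀ J₁ G E₀ E₁ (T′ * G) (T′ * L) C w′ ⟦ s′ s ⟧ ⟩
        (κᴷ * P + (κᴷ * (Z * V₀) + (S * (J₀ + G * E₀) + T′ * G)))
          + ⟦ s′ s ⟧ * 0# + (κᴷ * V₁ * Z + (S * (J₁ + G * E₁) + T′ * L) + C) * w′
          ≡⟨ cong₂ (λ x z → x + ⟦ s′ s ⟧ * 0# + z * w′)
               (κ! ⟪*⟫ p! ⟪+⟫ (κ! ⟪*⟫ (z! ⟪*⟫ v₀!) ⟪+⟫ (s! ⟪*⟫ (j₀! ⟪+⟫ g! ⟪*⟫ e₀!) ⟪+⟫ t! ⟪*⟫ g!)))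
               (trans (cong ⟦_⟧ (tits-image s t))
                 (κ! ⟪*⟫ v₁! ⟪*⟫ z! ⟪+⟫ (s! ⟪*⟫ (j₁! ⟪+⟫ g! ⟪*⟫ e₁!) ⟪+⟫ t! ⟪*⟫ l!) ⟪+⟫ refl {x = C})) ⟨
        ⟦ p′ s t p ⟧ + ⟦ s′ s ⟧ * 0# + ⟦ tits (s′ s) (t′ s t) ⟧ * w′ ∎
        where
        κᴷ = ⟦ κ ⟧ ; P = ⟦ p ⟧ ; S = ⟦ s ⟧ ; T′ = ⟦ t ⟧ ; Z = ⟦ tits s t ⟧ ; G = ⟦ g ⟧
        L = ⟦ a F.* k ⟧ ; C = ⟦ tits a F.0# ⟧ ; V₀ = ⟦ v₀ ⟧ ; V₁ = ⟦ v₁ ⟧ ; J₀ = ⟦ j₀ ⟧ ; J₁ = ⟦ j₁ ⟧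
        E₀ = ⟦ e₀ ⟧ ; E₁ = ⟦ e₁ ⟧
        κ! = refl {x = κᴷ} ; p! = refl {x = P} ; s! = refl {x = S} ; t! = refl {x = T′} ; z! = refl {x = Z}
        g! = refl {x = G} ; l! = refl {x = L} ; v₀! = refl {x = V₀} ; v₁! = refl {x = V₁}
        j₀! = refl {x = J₀} ; j₁! = refl {x = J₁} ; e₀! = refl {x = E₀} ; e₁! = refl {x = E₁}

      T-finite : ∀ s t p → matrix (unitalPoint u w d s t p) ≡ unitalPoint u′ w′ 0# (s′ s) (t′ s t) (p′ s t p)
      T-finite s t p = cong₂ (λ x y → 1# ∷ x ∷ y ∷ []) (x-coordinate s t) (y-coordinate s t p)

      T-vertex : matrix vertexPoint ≡ ⟦ κ ⟧ ⊙ vertexPoint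
      T-vertex = cong₂ _∷_ (sym (zeroʳ _)) (cong₂ (λ y z → y ∷ z ∷ [])
        (solve 3 (λ k b κ → k :* :0 :+ b :* :0 := κ :* :0) refl ⟦ k ⟧ (⟦ a ⟧ * u′) ⟦ κ ⟧)
        (solve 3 (λ κ h b → κ :* :1 :+ h :* :0 :+ b :* :0 := κ :* :1) refl ⟦ κ ⟧ h (⟦ tits a F.0# ⟧ * w′)))

    T-carries : Carries T (CoordinateUnital u w d) (CoordinateUnital u′ w′ 0#)
    T-carries = record { forth = forth ; back = back }
      where
      forth : ∀ {v} → CoordinateUnital u w d v →
        ∃ λ c → ∃ λ v′ → c ≢ 0# × CoordinateUnital u′ w′ 0# v′ × matrix v ≡ c ⊙ v′
      forth vertical       = ⟦ κ ⟧ , vertexPoint , ι-nonzero κ≢0 , vertical , T-vertex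
      forth (finite s t p) = 1# , _ , 0≢1 ∘ sym , finite (s′ s) (t′ s t) (p′ s t p) ,
        trans (T-finite s t p) (sym (⊙-identity _))
      back : ∀ {v′} → CoordinateUnital u′ w′ 0# v′ →
        ∃ λ c → ∃ λ v → c ≢ 0# × CoordinateUnital u w d v × matrix v ≡ c ⊙ v′
      back vertical       = ⟦ κ ⟧ , vertexPoint , ι-nonzero κ≢0 , vertical , T-vertex
      back (finite s₁ t₁ p₁) =
        let s , s-eq = affine-onto δ≢0 a s₁
            t , t-eq = affine-onto k≢0 (a ^σ F.* (δ F.* s) F.+ F.0#) t₁
            p , p-eq = affine-onto κ≢0 (κ F.* (tits s t F.* v₀) F.+ (s F.* (j₀ F.+ g F.* e₀) F.+ t F.* g)) p₁
        in 1# , unitalPoint u w d s t p , 0≢1 ∘ sym , finite s t p , (begin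
          matrix (unitalPoint u w d s t p)                             ≡⟨ T-finite s t p ⟩
          unitalPoint u′ w′ 0# (s′ s) (t′ s t) (p′ s t p)              ≡⟨ cong₂ (λ x y → unitalPoint u′ w′ 0# x y (p′ s t p)) s-eq t-eq ⟩
          unitalPoint u′ w′ 0# s₁ t₁ (p′ s t p)                        ≡⟨ cong (unitalPoint u′ w′ 0# s₁ t₁) p-eq ⟩
          unitalPoint u′ w′ 0# s₁ t₁ p₁                                ≡⟨ ⊙-identity _ ⟨
          1# ⊙ unitalPoint u′ w′ 0# s₁ t₁ p₁                           ∎)

  normalise : ∀ {u w u′ w′} d → Outside u → Outside w → Outside u′ → Outside w′ →
    ∃ λ T → Carries T (CoordinateUnital u w d) (CoordinateUnital u′ w′ 0#)
  normalise {u} {w} {u′} {w′} d u∉F w∉F u′∉F w′∉F =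
    let n , m , m≢0 , u≡     = Basis.decompose-outside u′∉F u∉F
        v₀ , v₁ , v₁≢0 , w≡  = Basis.decompose-outside w′∉F w∉F
        e₀ , e₁ , e₁≢0 , u≡′ = Basis.decompose-outside w′∉F u∉F
        δ , δ^σ≡             = σ-root (F.1/ m≢0)
        a , a^σ≡             = σ-root (δ ^σ F.* n)
        j₀ , j₁ , j≡         = Basis.decompose w′∉F
          (⟦ a F.* dilation δ ⟧ * w′ * u + ⟦ F.1/ v₁≢0 F.* dilation₂ δ ⟧ * d)
        module N = Normalisation {u} {w} {u′} {w′} {d} {n} {m} {v₀} {v₁} {e₀} {e₁} {j₀} {j₁} {δ} {a}
                     u≡ w≡ v₁≢0 u≡′ e₁≢0 (root≢0 m≢0 δ^σ≡)
                     (trans (cong (F._* m) δ^σ≡) (F.*-inverseˡ m≢0)) a^σ≡ j≡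
    in N.T , N.T-carries
    where
    root≢0 : ∀ {δ m} (m≢0 : m ≢ F.0#) → δ ^σ ≡ F.1/ m≢0 → δ ≢ F.0#
    root≢0 m≢0 eq refl = F.1/-nonzero m≢0 (trans (sym eq) 0^σ)

  -- Coordinates for the André/Bruck–Bose plane

  module V = LinearAlgebra F F-order F.1+1≡0
  open ABB F K ι using (DesarguesianSpread; abbPlane; ArisesFromTitsCone;
    ABBPoint; ABBLine; abbPointSet)

  module FieldReduction {H : Hyperplane F 4} (S : DesarguesianSpread H) where
    open DesarguesianSpread S using (fieldReduction)
    private
      module ψ = LeftModuleMorphisms.IsLeftModuleMonomorphism
                   (_≅_.isLeftModuleMonomorphism (proj₁ fieldReduction))

    ψ : Vector K 2 → Vector F 5
    ψ = _≅_.to (proj₁ fieldReduction)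

    ψ-⊕ : ∀ k l → ψ (k ⊕ l) ≡ ψ k V.⊕ ψ l
    ψ-⊕ = ψ.+ᴹ-homo

    ψ-⊙ : ∀ a k → ψ (⟦ a ⟧ ⊙ k) ≡ a V.⊙ ψ k
    ψ-⊙ = ψ.*ₗ-homo

    ψ-0 : ψ 0ⱽ ≡ V.0ⱽ
    ψ-0 = ψ.0ᴹ-homo

    ψ-injective : ∀ {k l} → ψ k ≡ ψ l → k ≡ l
    ψ-injective = ψ.injective

    ψ∈H : ∀ k → ψ k ∈ H
    ψ∈H k = Equivalence.from (_≅_.image (proj₁ fieldReduction) (ψ k)) (k , refl)

    ψ-onto : ∀ {w} → w ∈ H → ∃ λ k → ψ k ≡ w
    ψ-onto = Equivalence.to (_≅_.image (proj₁ fieldReduction) _)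

    module Origin (p₀ : Vector F 5) (p₀∉H : ¬ (p₀ ∈ H)) where

      f⊙p₀∈H⇒0 : ∀ {f} → f V.⊙ p₀ ∈ H → f ≡ F.0#
      f⊙p₀∈H⇒0 {f} = V.∉-⊙⇒0 H p₀∉H f

      finite∈H⇒0 : ∀ {f w} → f V.⊙ p₀ V.⊕ w ∈ H → w ∈ H → f ≡ F.0#
      finite∈H⇒0 {f} {w} ∈H w∈H = f⊙p₀∈H⇒0
        (V.∈-⊕⁻¹ H (subst (_∈ H) (V.⊕-comm _ _) ∈H) w∈H)

      0⊙p₀ : ∀ w → F.0# V.⊙ p₀ V.⊕ w ≡ w
      0⊙p₀ w = trans (cong (V._⊕ w) (V.⊙-zeroˡ p₀)) (V.⊕-identityˡ w)

      split : ∀ {f g w w′} → w ∈ H → w′ ∈ H → f V.⊙ p₀ V.⊕ w ≡ g V.⊙ p₀ V.⊕ w′ → f ≡ g × w ≡ w′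
      split {f} {g} {w} {w′} w∈H w′∈H eq = f≡g , V.u⊕v≡0⇒u≡v (begin
          w V.⊕ w′                                   ≡⟨ 0⊙p₀ _ ⟨
          F.0# V.⊙ p₀ V.⊕ (w V.⊕ w′)                 ≡⟨ cong (λ x → x V.⊙ p₀ V.⊕ (w V.⊕ w′)) f+g≡0 ⟨
          (f F.+ g) V.⊙ p₀ V.⊕ (w V.⊕ w′)            ≡⟨ sum≡0 ⟩
          V.0ⱽ                                       ∎)
        where
        sum≡0 : (f F.+ g) V.⊙ p₀ V.⊕ (w V.⊕ w′) ≡ V.0ⱽ
        sum≡0 = begin
          (f F.+ g) V.⊙ p₀ V.⊕ (w V.⊕ w′)                    ≡⟨ cong (V._⊕ (w V.⊕ w′)) (V.⊙-distribʳ p₀ f g) ⟩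
          (f V.⊙ p₀ V.⊕ g V.⊙ p₀) V.⊕ (w V.⊕ w′)             ≡⟨ V.⊕-interchange _ _ _ _ ⟩
          (f V.⊙ p₀ V.⊕ w) V.⊕ (g V.⊙ p₀ V.⊕ w′)             ≡⟨ cong (V._⊕ (g V.⊙ p₀ V.⊕ w′)) eq ⟩
          (g V.⊙ p₀ V.⊕ w′) V.⊕ (g V.⊙ p₀ V.⊕ w′)            ≡⟨ V.⊕-self _ ⟩
          V.0ⱽ                                               ∎
        f+g≡0 : f F.+ g ≡ F.0#
        f+g≡0 = finite∈H⇒0 (subst (_∈ H) (sym sum≡0) (V.∈-0 H)) (V.∈-⊕ H w∈H w′∈H)
        f≡g : f ≡ g
        f≡g = F.x+y≡0⇒x≡y f+g≡0

      -- By counting, as q * q⁴ = q⁵.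
      decomposition : ∀ w → ∃ λ f → ∃ λ h → h ∈ H × f V.⊙ p₀ V.⊕ h ≡ w
      decomposition w =
        let (f , k) , eq = Counting.injective⇒surjective (F-order ×-finite vectors 2) (V.vectors 5)
                             q*q⁴≡q⁵ (λ (f , k) → f V.⊙ p₀ V.⊕ ψ k) unique w
        in f , ψ k , ψ∈H k , eq
        where
        q*q⁴≡q⁵ : q ℕ.* (q ℕ.^ 2) ℕ.^ 2 ≡ q ℕ.^ 5
        q*q⁴≡q⁵ = cong (q ℕ.*_) (ℕ.^-*-assoc q 2 2)
        unique : ∀ {a b : F.Carrier × Vector K 2} →
          proj₁ a V.⊙ p₀ V.⊕ ψ (proj₂ a) ≡ proj₁ b V.⊙ p₀ V.⊕ ψ (proj₂ b) → a ≡ b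
        unique {a} {b} eq =
          let f≡ , ψ≡ = split (ψ∈H (proj₂ a)) (ψ∈H (proj₂ b)) eq in cong₂ _,_ f≡ (ψ-injective ψ≡)

  -- Coordinates (x, y) with respect to the affine point p₀ and the K-basis v′, v
  -- of the hyperplane at infinity, which is a copy of K².
  module Chart {H : Hyperplane F 4} (S : DesarguesianSpread H)
               (v′ v : Vector K 2) (v′-v-independent : Independent₂ v′ v)
               (p₀ : Vector F 5) (p₀∉H : ¬ (p₀ ∈ H)) where
    open DesarguesianSpread S using (IsSpreadLine; fieldReduction)
    open FieldReduction S
    open Origin p₀ p₀∉H

    coordinates : ∀ k → ∃₂ λ x y → x ⊙ v′ ⊕ y ⊙ v ≡ k
    coordinates k = fromVec (Counting.injective⇒surjective (vectors 2) (vectors 2) refl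
        (λ c → combination c (v′ ∷ v ∷ []))
        (IsLinear.injective (combination-linear (v′ ∷ v ∷ [])) kernel) k)
      where
      kernel : ∀ c → combination c (v′ ∷ v ∷ []) ≡ 0ⱽ → c ≡ 0ⱽ
      kernel (x ∷ y ∷ []) eq =
        let x≡0 , y≡0 = v′-v-independent x y (trans (sym (combination₂ x y v′ v)) eq)
        in cong₂ (λ x y → x ∷ y ∷ []) x≡0 y≡0
      fromVec : (∃ λ c → combination c (v′ ∷ v ∷ []) ≡ k) → ∃₂ λ x y → x ⊙ v′ ⊕ y ⊙ v ≡ k
      fromVec (x ∷ y ∷ [] , eq) = x , y , trans (sym (combination₂ x y v′ v)) eq

    abstract
      Ψ : Carrier → Carrier → Vector F 5
      Ψ x y = ψ (x ⊙ v′ ⊕ y ⊙ v)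

      Ψ-ψ : ∀ x y → Ψ x y ≡ ψ (x ⊙ v′ ⊕ y ⊙ v)
      Ψ-ψ x y = refl

    Ψ-+ : ∀ x y x′ y′ → Ψ (x + x′) (y + y′) ≡ Ψ x y V.⊕ Ψ x′ y′
    Ψ-+ x y x′ y′ = begin
      Ψ (x + x′) (y + y′)                                   ≡⟨ Ψ-ψ _ _ ⟩
      ψ ((x + x′) ⊙ v′ ⊕ (y + y′) ⊙ v)                      ≡⟨ cong ψ (cong₂ _⊕_ (⊙-distribʳ v′ x x′) (⊙-distribʳ v y y′)) ⟩
      ψ ((x ⊙ v′ ⊕ x′ ⊙ v′) ⊕ (y ⊙ v ⊕ y′ ⊙ v))             ≡⟨ cong ψ (⊕-interchange _ _ _ _) ⟩
      ψ ((x ⊙ v′ ⊕ y ⊙ v) ⊕ (x′ ⊙ v′ ⊕ y′ ⊙ v))             ≡⟨ ψ-⊕ _ _ ⟩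
      ψ (x ⊙ v′ ⊕ y ⊙ v) V.⊕ ψ (x′ ⊙ v′ ⊕ y′ ⊙ v)           ≡⟨ cong₂ V._⊕_ (Ψ-ψ x y) (Ψ-ψ x′ y′) ⟨
      Ψ x y V.⊕ Ψ x′ y′                                     ∎

    Ψ-* : ∀ a x y → Ψ (⟦ a ⟧ * x) (⟦ a ⟧ * y) ≡ a V.⊙ Ψ x y
    Ψ-* a x y = begin
      Ψ (⟦ a ⟧ * x) (⟦ a ⟧ * y)                   ≡⟨ Ψ-ψ _ _ ⟩
      ψ ((⟦ a ⟧ * x) ⊙ v′ ⊕ (⟦ a ⟧ * y) ⊙ v)      ≡⟨ cong ψ (cong₂ _⊕_ (⊙-assoc ⟦ a ⟧ x v′) (⊙-assoc ⟦ a ⟧ y v)) ⟨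
      ψ (⟦ a ⟧ ⊙ x ⊙ v′ ⊕ ⟦ a ⟧ ⊙ y ⊙ v)          ≡⟨ cong ψ (⊙-distribˡ ⟦ a ⟧ _ _) ⟨
      ψ (⟦ a ⟧ ⊙ (x ⊙ v′ ⊕ y ⊙ v))                ≡⟨ ψ-⊙ a _ ⟩
      a V.⊙ ψ (x ⊙ v′ ⊕ y ⊙ v)                    ≡⟨ cong (a V.⊙_) (Ψ-ψ x y) ⟨
      a V.⊙ Ψ x y                                 ∎

    Ψ∈H : ∀ x y → Ψ x y ∈ H
    Ψ∈H x y = subst (_∈ H) (sym (Ψ-ψ x y)) (ψ∈H _)

    Ψ-kernel : ∀ {x y} → Ψ x y ≡ V.0ⱽ → x ≡ 0# × y ≡ 0#
    Ψ-kernel {x} {y} eq = v′-v-independent x y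
      (ψ-injective (trans (sym (Ψ-ψ x y)) (trans eq (sym ψ-0))))

    Ψ-injective : ∀ {x y x′ y′} → Ψ x y ≡ Ψ x′ y′ → x ≡ x′ × y ≡ y′
    Ψ-injective {x} {y} {x′} {y′} eq =
      let x+x′≡0 , y+y′≡0 = Ψ-kernel (trans (Ψ-+ x y x′ y′) (trans (cong (V._⊕ Ψ x′ y′) eq) (V.⊕-self _)))
      in x+y≡0⇒x≡y x+x′≡0 , x+y≡0⇒x≡y y+y′≡0

    affineVector : Carrier → Carrier → Vector F 5
    affineVector x y = p₀ V.⊕ Ψ x y

    1⊙p₀ : ∀ w → F.1# V.⊙ p₀ V.⊕ w ≡ p₀ V.⊕ w
    1⊙p₀ w = cong (V._⊕ w) (V.⊙-identity p₀)

    affineVector∉H : ∀ x y → ¬ (affineVector x y ∈ H)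
    affineVector∉H x y ∈H = F.0≢1 (sym (finite∈H⇒0 (subst (_∈ H) (sym (1⊙p₀ _)) ∈H) (Ψ∈H x y)))

    ⊙-affineVector : ∀ c x y → c V.⊙ affineVector x y ≡ c V.⊙ p₀ V.⊕ Ψ (⟦ c ⟧ * x) (⟦ c ⟧ * y)
    ⊙-affineVector c x y = trans (V.⊙-distribˡ c p₀ _) (cong (c V.⊙ p₀ V.⊕_) (sym (Ψ-* c x y)))

    affineVector-⊕ : ∀ x y x′ y′ → affineVector x y V.⊕ Ψ x′ y′ ≡ affineVector (x + x′) (y + y′)
    affineVector-⊕ x y x′ y′ = trans (V.⊕-assoc p₀ _ _) (cong (p₀ V.⊕_) (sym (Ψ-+ x y x′ y′)))

    affineVector≢0 : ∀ x y → affineVector x y ≢ V.0ⱽ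
    affineVector≢0 x y eq = affineVector∉H x y (subst (_∈ H) (sym eq) (V.∈-0 H))

    affineVector-injective : ∀ {c x y x′ y′} → affineVector x y ≡ c V.⊙ affineVector x′ y′ → x ≡ x′ × y ≡ y′
    affineVector-injective {c} {x} {y} {x′} {y′} eq =
      let 1≡c , Ψ≡ = split (Ψ∈H x y) (Ψ∈H (⟦ c ⟧ * x′) (⟦ c ⟧ * y′))
                       (trans (1⊙p₀ _) (trans eq (⊙-affineVector c x′ y′)))
          x≡ , y≡  = Ψ-injective Ψ≡
          ⟦c⟧≡1    = trans (cong ⟦_⟧ (sym 1≡c)) ι-1
      in trans x≡ (trans (cong (_* x′) ⟦c⟧≡1) (*-identityˡ x′))
       , trans y≡ (trans (cong (_* y′) ⟦c⟧≡1) (*-identityˡ y′))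

    affinePoint : Carrier → Carrier → Point F 4
    affinePoint x y = V.point (affineVector x y) (affineVector≢0 x y)

    affinePoint⋢H : ∀ x y → ¬ (affinePoint x y ⊑ H)
    affinePoint⋢H x y ⊑H = affineVector∉H x y (⊑H _ (V.vector∈ (affinePoint x y)))

    private
      u : Carrier
      u = proj₁ outside-exists

      u∉F : Outside u
      u∉F = proj₂ outside-exists

      u-basis : ∀ k → ∃₂ λ a b → k ≡ ⟦ a ⟧ + ⟦ b ⟧ * u
      u-basis = Basis.decompose u∉F

    -- The point at infinity of the K-lines in direction (b₁, b₂).
    module Direction (b₁ b₂ : Carrier) (b≢0 : ¬ (b₁ ≡ 0# × b₂ ≡ 0#)) where

      multiple : Carrier → Vector F 5
      multiple k = Ψ (k * b₁) (k * b₂)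

      multiple∈H : ∀ k → multiple k ∈ H
      multiple∈H k = Ψ∈H _ _

      multiple-basis : ∀ a b → a V.⊙ multiple 1# V.⊕ b V.⊙ multiple u ≡ multiple (⟦ a ⟧ + ⟦ b ⟧ * u)
      multiple-basis a b = begin
        a V.⊙ multiple 1# V.⊕ b V.⊙ multiple u     ≡⟨ cong₂ V._⊕_ (Ψ-* a _ _) (Ψ-* b _ _) ⟨
        Ψ (⟦ a ⟧ * (1# * b₁)) (⟦ a ⟧ * (1# * b₂)) V.⊕ Ψ (⟦ b ⟧ * (u * b₁)) (⟦ b ⟧ * (u * b₂)) ≡⟨ Ψ-+ _ _ _ _ ⟨
        Ψ (⟦ a ⟧ * (1# * b₁) + ⟦ b ⟧ * (u * b₁)) (⟦ a ⟧ * (1# * b₂) + ⟦ b ⟧ * (u * b₂))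
          ≡⟨ cong₂ Ψ (combine ⟦ a ⟧ ⟦ b ⟧ u b₁) (combine ⟦ a ⟧ ⟦ b ⟧ u b₂) ⟩
        multiple (⟦ a ⟧ + ⟦ b ⟧ * u)               ∎
        where
        combine : ∀ a b u c → a * (1# * c) + b * (u * c) ≡ (a + b * u) * c
        combine = solve 4 (λ a b u c → a :* (:1 :* c) :+ b :* (u :* c) := (a :+ b :* u) :* c) refl

      multiple≡0⇒0 : ∀ k → multiple k ≡ V.0ⱽ → k ≡ 0#
      multiple≡0⇒0 k eq with k ≟ 0#
      ... | yes k≡0 = k≡0
      ... | no k≢0  = let kb₁≡0 , kb₂≡0 = Ψ-kernel eq in
        contradiction (x*y≡0⇒y≡0 k≢0 kb₁≡0 , x*y≡0⇒y≡0 k≢0 kb₂≡0) b≢0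

      independent : V.Independent₂ (multiple 1#) (multiple u)
      independent a b eq = Basis.independent u∉F a b
        (multiple≡0⇒0 _ (trans (sym (multiple-basis a b)) eq))

      line : Line F 4
      line = V.span₂ (multiple 1#) (multiple u) independent

      multiple∈line : ∀ k → multiple k ∈ line
      multiple∈line k = let a , b , k≡ = u-basis k in
        subst (_∈ line) (trans (multiple-basis a b) (cong multiple (sym k≡))) (V.∈-span₂ independent a b)

      ∈line⇒multiple : ∀ {w} → w ∈ line → ∃ λ k → w ≡ multiple k
      ∈line⇒multiple (a ∷ b ∷ [] , eq) = ⟦ a ⟧ + ⟦ b ⟧ * u ,
        trans (sym eq) (trans (V.combination₂ a b _ _) (multiple-basis a b))

      private
        bᴷ : Vector K 2
        bᴷ = b₁ ⊙ v′ ⊕ b₂ ⊙ v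

        bᴷ≢0 : bᴷ ≢ 0ⱽ
        bᴷ≢0 eq = b≢0 (v′-v-independent b₁ b₂ eq)

        ψ-multiple : ∀ k → ψ (k ⊙ bᴷ) ≡ multiple k
        ψ-multiple k = trans (cong ψ (trans (⊙-distribˡ k _ _) (cong₂ _⊕_ (⊙-assoc k b₁ v′) (⊙-assoc k b₂ v))))
          (sym (Ψ-ψ _ _))

      isSpreadLine : IsSpreadLine line
      isSpreadLine = Equivalence.from (proj₂ fieldReduction line) (point bᴷ bᴷ≢0 , λ w → mk⇔
        (λ w∈line → let k , w≡ = ∈line⇒multiple w∈line in
          k ⊙ bᴷ , ∈-vector (point bᴷ bᴷ≢0) k , trans (ψ-multiple k) (sym w≡))
        (λ (x , x∈ , ψx≡w) → let k , x≡ = ∈-point (point bᴷ bᴷ≢0) x∈ in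
          subst (_∈ line) (trans (sym (ψ-multiple k)) (trans (cong ψ (sym x≡)) ψx≡w)) (multiple∈line k)))

      abbPoint : ABBPoint S
      abbPoint = ABBPoint.infinite line isSpreadLine

      -- The K-line through the affine point (a₁, a₂) in this direction.
      module Through (a₁ a₂ : Carrier) where
        private
          o = affineVector a₁ a₂

        plane-combination : ∀ a b c → a V.⊙ o V.⊕ (b V.⊙ multiple 1# V.⊕ c V.⊙ multiple u) ≡
          a V.⊙ o V.⊕ multiple (⟦ b ⟧ + ⟦ c ⟧ * u)
        plane-combination a b c = cong (a V.⊙ o V.⊕_) (multiple-basis b c)

        combination∈H⇒0 : ∀ a {w} → w ∈ H → a V.⊙ o V.⊕ w ∈ H → a ≡ F.0#
        combination∈H⇒0 a {w} w∈H ∈H = finite∈H⇒0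
          (subst (_∈ H) (trans (cong (V._⊕ w) (V.⊙-distribˡ a p₀ _)) (V.⊕-assoc _ _ _)) ∈H)
          (V.∈-⊕ H (V.∈-⊙ H a (Ψ∈H _ _)) w∈H)

        0⊙o : ∀ w → F.0# V.⊙ o V.⊕ w ≡ w
        0⊙o w = trans (cong (V._⊕ w) (V.⊙-zeroˡ o)) (V.⊕-identityˡ w)

        independent₃ : V.Independent₃ o (multiple 1#) (multiple u)
        independent₃ a b c eq = a≡0 , independent b c (trans (sym (0⊙o _))
            (trans (cong (λ a → a V.⊙ o V.⊕ _) (sym a≡0)) eq))
          where
          a≡0 : a ≡ F.0#
          a≡0 = combination∈H⇒0 a
            (V.∈-⊕ H (V.∈-⊙ H b (multiple∈H 1#)) (V.∈-⊙ H c (multiple∈H u)))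
            (subst (_∈ H) (sym eq) (V.∈-0 H))

        π : Plane F 4
        π = V.span₃ o (multiple 1#) (multiple u) independent₃

        ∈π : ∀ a k → a V.⊙ o V.⊕ multiple k ∈ π
        ∈π a k = let b , c , k≡ = u-basis k in
          subst (_∈ π) (trans (plane-combination a b c) (cong (λ k → a V.⊙ o V.⊕ multiple k) (sym k≡)))
            (V.∈-span₃ independent₃ a b c)

        affine∈π : ∀ k → affineVector (a₁ + k * b₁) (a₂ + k * b₂) ∈ π
        affine∈π k = subst (_∈ π) (trans (cong (V._⊕ multiple k) (V.⊙-identity o)) (affineVector-⊕ _ _ _ _)) (∈π F.1# k)

        line⊑π : line ⊑ π
        line⊑π w w∈ = let k , w≡ = ∈line⇒multiple w∈ in
          subst (_∈ π) (trans (0⊙o _) (sym w≡)) (∈π F.0# k)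

        π⋢H : ¬ (π ⊑ H)
        π⋢H π⊑H = affineVector∉H _ _ (π⊑H _ (affine∈π 0#))

        line⊑H : line ⊑ H
        line⊑H w w∈ = let k , w≡ = ∈line⇒multiple w∈ in subst (_∈ H) (sym w≡) (multiple∈H k)

        ∈π⇒combination : ∀ {w} → w ∈ π → ∃₂ λ a k → w ≡ a V.⊙ o V.⊕ multiple k
        ∈π⇒combination w∈π =
          let a , b , c , w≡ = V.∈-span₃⁻¹ independent₃ w∈π
          in a , ⟦ b ⟧ + ⟦ c ⟧ * u , trans w≡ (plane-combination a b c)

        combination∈H⇒∈line : ∀ {w} a k → w ≡ a V.⊙ o V.⊕ multiple k → w ∈ H → w ∈ line
        combination∈H⇒∈line {w} a k w≡ w∈H = subst (_∈ line) (sym w≡multiple) (multiple∈line k)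
          where
          a≡0 : a ≡ F.0#
          a≡0 = combination∈H⇒0 a (multiple∈H k) (subst (_∈ H) w≡ w∈H)
          w≡multiple : w ≡ multiple k
          w≡multiple = trans w≡ (trans (cong (λ a → a V.⊙ o V.⊕ multiple k) a≡0) (0⊙o (multiple k)))

        π∩H : ∀ w → w ∈ line ⇔ (w ∈ π × w ∈ H)
        π∩H w = mk⇔ (λ w∈ → line⊑π w w∈ , line⊑H w w∈) λ (w∈π , w∈H) →
          let a , k , w≡ = ∈π⇒combination w∈π in combination∈H⇒∈line a k w≡ w∈H

        abbLine : ABBLine S
        abbLine = ABBLine.plane π π⋢H (line , isSpreadLine , π∩H)

        affine-on : ∀ {x y} k → x ≡ a₁ + k * b₁ → y ≡ a₂ + k * b₂ → affinePoint x y ⊑ π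
        affine-on k refl refl = V.⊑-point (affinePoint _ _) π (affineVector≢0 _ _)
          (V.vector∈ (affinePoint _ _)) (affine∈π k)

  -- An identification of the André/Bruck–Bose plane with PG(2, K) is semilinear
  -- in the coordinates of a chart.
  module Identification {H : Hyperplane F 4} (S : DesarguesianSpread H)
               (v′ v : Vector K 2) (v′-v-independent : Independent₂ v′ v)
               (p₀ : Vector F 5) (p₀∉H : ¬ (p₀ ∈ H))
               (φ : Isomorphism (abbPlane S) (PG₂ K)) where
    open Chart S v′ v v′-v-independent p₀ p₀∉H
    open IncidenceStructure (abbPlane S) using (_on_)
    private
      module φ = Isomorphism φ
      module Points = Inverse φ.onPoints
      module PointsEq = Setoid (IncidenceStructure.points (abbPlane S))
      module Lines = Inverse φ.onLines

    Φ : ABBPoint S → Point K 2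
    Φ = Points.to

    Φ-cong : ∀ {P Q} → P PointsEq.≈ Q → Φ P ≈ Φ Q
    Φ-cong = Points.to-cong

    private
      Φ-injective : ∀ {P Q} → Φ P ≈ Φ Q → P PointsEq.≈ Q
      Φ-injective {P} {Q} eq = PointsEq.trans (PointsEq.sym (Points.strictlyInverseʳ P))
        (PointsEq.trans (Points.from-cong {Φ P} {Φ Q} eq) (Points.strictlyInverseʳ Q))

      A : Carrier → Carrier → ABBPoint S
      A x y = ABBPoint.affine (affinePoint x y) (affinePoint⋢H x y)

      f : Carrier → Carrier → Vector K 3
      f x y = vector (Φ (A x y))

      1≢0 : 1# ≢ 0#
      1≢0 = 0≢1 ∘ sym

      module Horizontal = Direction 1# 0# (1≢0 ∘ proj₁)
      module Vertical   = Direction 0# 1# (1≢0 ∘ proj₂)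
      module Diagonal   = Direction 1# 1# (1≢0 ∘ proj₁)

      image : ABBPoint S → Vector K 3
      image P = vector (Φ P)

      image∈ : ∀ P ℓ → P on ℓ → image P ∈ Lines.to ℓ
      image∈ P ℓ P-on-ℓ = Equivalence.to (φ.incident P ℓ) P-on-ℓ (image P) (vector∈ (Φ P))

      L∞ : Line K 2
      L∞ = Lines.to ABBLine.ℓ∞

      f∉L∞ : ∀ x y → ¬ (f x y ∈ L∞)
      f∉L∞ x y ∈L∞ = Equivalence.from (φ.incident (A x y) ABBLine.ℓ∞)
        (⊑-point (Φ (A x y)) L∞ (vector≢0 (Φ (A x y))) (vector∈ (Φ (A x y))) ∈L∞)

      affine-≈⇒∈ : ∀ {P Q p q} → ABBPoint.affine P p PointsEq.≈ ABBPoint.affine Q q → P ⊑ Q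
      affine-≈⇒∈ (ABB.affine P≈Q) = proj₁ P≈Q

      infinite-≈⇒∈ : ∀ {ℓ m p q} → ABBPoint.infinite ℓ p PointsEq.≈ ABBPoint.infinite m q → ℓ ⊑ m
      infinite-≈⇒∈ (ABB.infinite ℓ≈m) = proj₁ ℓ≈m

      f-injective : ∀ {x y x′ y′} c → f x y ≡ c ⊙ f x′ y′ → x ≡ x′ × y ≡ y′
      f-injective {x} {y} {x′} {y′} c eq =
        let d , eq′ = V.∈-point (affinePoint x′ y′)
              (affine-≈⇒∈ (Φ-injective {A x y} {A x′ y′} images-≈) _ (V.vector∈ (affinePoint x y)))
        in affineVector-injective eq′
        where
        images-≈ : Φ (A x y) ≈ Φ (A x′ y′)
        images-≈ = ≈-point (Φ (A x y)) (Φ (A x′ y′)) (vector≢0 (Φ (A x y))) (vector∈ (Φ (A x y)))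
          (subst (_∈ Φ (A x′ y′)) (sym eq) (∈-vector (Φ (A x′ y′)) c))

      directions-distinct : ¬ (Φ Horizontal.abbPoint ≈ Φ Vertical.abbPoint)
      directions-distinct eq =
        let k , eq′ = Vertical.∈line⇒multiple
              (infinite-≈⇒∈ (Φ-injective {Horizontal.abbPoint} {Vertical.abbPoint} eq) _ (Horizontal.multiple∈line 1#))
        in 1≢0 (trans (sym (*-identityˡ 1#)) (trans (proj₁ (Ψ-injective eq′)) (zeroʳ k)))

      collinear : ∀ {P Q R} (ℓ : ABBLine S) → P on ℓ → Q on ℓ → R on ℓ →
        ∃ λ (m : Line K 2) → image P ∈ m × image Q ∈ m × image R ∈ m
      collinear {P} {Q} {R} ℓ P-on Q-on R-on =
        Lines.to ℓ , image∈ P ℓ P-on , image∈ Q ℓ Q-on , image∈ R ℓ R-on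

      x≡0+x1 : ∀ x → x ≡ 0# + x * 1#
      x≡0+x1 = solve 1 (λ x → x := :0 :+ x :* :1) refl

      y≡y+x0 : ∀ x y → y ≡ y + x * 0#
      y≡y+x0 = solve 2 (λ x y → y := y :+ x :* :0) refl

      y+x≡x+y1 : ∀ x y → y + x ≡ x + y * 1#
      y+x≡x+y1 = solve 2 (λ x y → y :+ x := x :+ y :* :1) refl

      m≡0+1m : ∀ m → m ≡ 0# + 1# * m
      m≡0+1m = solve 1 (λ m → m := :0 :+ :1 :* m) refl

      horizontal : ∀ x x′ y → ∃ λ (m : Line K 2) → f x y ∈ m × f x′ y ∈ m × image Horizontal.abbPoint ∈ m
      horizontal x x′ y = collinear {A x y} {A x′ y} {Horizontal.abbPoint} abbLine
        (affine-on x (x≡0+x1 x) (y≡y+x0 x y)) (affine-on x′ (x≡0+x1 x′) (y≡y+x0 x′ y)) line⊑π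
        where open Horizontal.Through 0# y

      vertical-line : ∀ x y y′ → ∃ λ (m : Line K 2) → f x y ∈ m × f x y′ ∈ m × image Vertical.abbPoint ∈ m
      vertical-line x y y′ = collinear {A x y} {A x y′} {Vertical.abbPoint} abbLine
        (affine-on y (y≡y+x0 y x) (x≡0+x1 y)) (affine-on y′ (y≡y+x0 y′ x) (x≡0+x1 y′)) line⊑π
        where open Vertical.Through x 0#

      diagonal : ∀ c x x′ → ∃ λ (m : Line K 2) → f x (x + c) ∈ m × f x′ (x′ + c) ∈ m × image Diagonal.abbPoint ∈ m
      diagonal c x x′ = collinear {A x (x + c)} {A x′ (x′ + c)} {Diagonal.abbPoint} abbLine
        (affine-on x (x≡0+x1 x) (y+x≡x+y1 c x)) (affine-on x′ (x≡0+x1 x′) (y+x≡x+y1 c x′)) line⊑π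
        where open Diagonal.Through 0# c

      throughOrigin : ∀ m x → ∃ λ (ℓ : Line K 2) → f 0# 0# ∈ ℓ × f 1# m ∈ ℓ × f x (m * x) ∈ ℓ
      throughOrigin m x = collinear {A 0# 0#} {A 1# m} {A x (m * x)} abbLine
        (affine-on 0# (x≡0+x1 0#) (trans (sym (zeroˡ m)) (sym (+-identityˡ _))))
        (affine-on 1# (x≡0+x1 1#) (m≡0+1m m))
        (affine-on x (x≡0+x1 x) (trans (*-comm m x) (sym (+-identityˡ _))))
        where
        open Direction 1# m (1≢0 ∘ proj₁)
        open Through 0# 0#

    open Collinearity.AffineCollineation K K-order 1+1≡0 f
      (image Horizontal.abbPoint) (image Vertical.abbPoint) (image Diagonal.abbPoint) L∞
      (image∈ Horizontal.abbPoint ABBLine.ℓ∞ tt) (image∈ Vertical.abbPoint ABBLine.ℓ∞ tt)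
      (image∈ Diagonal.abbPoint ABBLine.ℓ∞ tt) f∉L∞
      (distinct⇒independent (Φ Horizontal.abbPoint) (Φ Vertical.abbPoint) directions-distinct)
      (vector≢0 (Φ Diagonal.abbPoint)) f-injective horizontal vertical-line diagonal throughOrigin public
      using (α; α-+; α-*; α-1; G; G-linear; G-kernel; f-semilinear; hy-image)

    verticalPoint : ABBPoint S
    verticalPoint = Vertical.abbPoint

    ∈verticalLine : ∀ {w} → w ∈ Vertical.line ⇔ (∃ λ k → w ≡ Ψ 0# k)
    ∈verticalLine {w} = mk⇔
      (λ w∈ → let k , w≡ = Vertical.∈line⇒multiple w∈ in
        k , trans w≡ (cong₂ Ψ (zeroʳ k) (*-identityʳ k)))
      (λ (k , w≡) → subst (_∈ Vertical.line) (trans (cong₂ Ψ (zeroʳ k) (*-identityʳ k)) (sym w≡))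
        (Vertical.multiple∈line k))

    private
      image-of : ∀ {P Q : Point K 2} {c w} → c ≢ 0# → vector P ≡ c ⊙ w → w ≢ 0ⱽ → P ≈ Q ⇔ (w ∈ Q)
      image-of {P} {Q} {c} {w} c≢0 eq w≢0 = mk⇔ (λ P≈Q → proj₁ P≈Q w w∈P) (λ w∈Q → ≈-point P Q w≢0 w∈P w∈Q)
        where
        w∈P : w ∈ P
        w∈P = ∈-⊙⁻¹ P c≢0 (subst (_∈ P) eq (vector∈ P))

    affine-image : ∀ x y (Q : Point K 2) → Φ (A x y) ≈ Q ⇔ (G (1# ∷ α x ∷ α y ∷ []) ∈ Q)
    affine-image x y Q = let c , c≢0 , eq = f-semilinear x y in
      image-of {Φ (A x y)} {Q} c≢0 eq λ eq₀ → 1≢0 (∷-injectiveˡ (G-kernel _ eq₀))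

    affine-image′ : ∀ {P} (P⋢H : ¬ (P ⊑ H)) {x y} → affineVector x y ∈ P → ∀ (Q : Point K 2) →
      Φ (ABBPoint.affine P P⋢H) ≈ Q ⇔ (G (1# ∷ α x ∷ α y ∷ []) ∈ Q)
    affine-image′ {P} P⋢H {x} {y} ∈P Q = mk⇔
      (λ ΦP≈Q → Equivalence.to (affine-image x y Q) (PGEq.trans {Φ (A x y)} {Φ P′} {Q} (Φ-cong {A x y} {P′} (ABB.affine A≈P)) ΦP≈Q))
      (λ ∈Q → PGEq.trans {Φ P′} {Φ (A x y)} {Q} (Φ-cong {P′} {A x y} (ABB.affine (proj₂ A≈P , proj₁ A≈P))) (Equivalence.from (affine-image x y Q) ∈Q))
      where
      P′ = ABBPoint.affine P P⋢H
      module PGEq = Setoid (subspaceSetoid K 3 1)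
      A≈P : affinePoint x y ≈ P
      A≈P = V.≈-point (affinePoint x y) P (affineVector≢0 x y) (V.vector∈ (affinePoint x y)) ∈P

    vertical-image : ∀ (Q : Point K 2) → Φ verticalPoint ≈ Q ⇔ (G vertexPoint ∈ Q)
    vertical-image Q = let c , c≢0 , eq = hy-image in
      image-of {Φ verticalPoint} {Q} c≢0 eq λ eq₀ →
        1≢0 (∷-injectiveˡ (∷-injectiveʳ (∷-injectiveʳ (G-kernel vertexPoint eq₀))))

  -- The cone in suitable coordinates

  open TitsOvoid F e F-order using (pole; finiteVector; OvoidVector; infinite; finite;
    OvoidVector-nonzero; transitive)
  open TitsForm F e F-order using (tits-00)

  vec₅ : ∀ {x y z t p x′ y′ z′ t′ p′ : F.Carrier} → p ≡ p′ → x ≡ x′ → y ≡ y′ → z ≡ z′ → t ≡ t′ →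
    _≡_ {A = Vector F 5} (p ∷ x ∷ y ∷ z ∷ t ∷ []) (p′ ∷ x′ ∷ y′ ∷ z′ ∷ t′ ∷ [])
  vec₅ refl refl refl refl refl = refl

  -- A basis of the space in which the cone with point set C consists of the
  -- points (p , c r) for r on the standard ovoid.
  record IsConeFrame (C : PointSet F 4) (β : V.Automorphism 5) : Set where
    open V.Automorphism β
    field
      cone⇒ : ∀ {P x} → C P → x ≢ V.0ⱽ → x ∈ P →
              ∃ λ r → ∃₂ λ p c → OvoidVector r × x ≡ to (p ∷ c V.⊙ r)
      cone⇐ : ∀ P {r} p c → OvoidVector r → to (p ∷ c V.⊙ r) ≢ V.0ⱽ → to (p ∷ c V.⊙ r) ∈ P → C P

  module ConeFrame (cone : TitsCone (2 ℕ.^ (e ℕ.+ 1)) F) where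
    open TitsCone cone
    private
      module θ = LeftModuleMorphisms.IsLeftModuleMonomorphism (_≅_.isLeftModuleMonomorphism (proj₁ isTitsOvoid))

      θ : Vector F 4 → Vector F 5
      θ = _≅_.to (proj₁ isTitsOvoid)

      V₀ : Vector F 5
      V₀ = V.vector vertex

      θ∈ : ∀ r → θ r ∈ hyperplane
      θ∈ r = Equivalence.from (_≅_.image (proj₁ isTitsOvoid) (θ r)) (r , refl)

      θ-kernel : ∀ {r} → θ r ≡ V.0ⱽ → r ≡ V.0ⱽ
      θ-kernel eq = θ.injective (trans eq (sym θ.0ᴹ-homo))

      V₀∉ : ¬ (V₀ ∈ hyperplane)
      V₀∉ ∈hyperplane = vertex∉ (V.⊑-point vertex hyperplane (V.vector≢0 vertex) (V.vector∈ vertex) ∈hyperplane)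

      join : Vector F 5 → Vector F 5
      join (p ∷ r) = p V.⊙ V₀ V.⊕ θ r

      join-kernel : ∀ p r → p V.⊙ V₀ V.⊕ θ r ≡ V.0ⱽ → p ≡ F.0# × r ≡ V.0ⱽ
      join-kernel p r eq = p≡0 , θ-kernel (trans (sym (V.⊕-identityˡ _))
          (trans (cong (V._⊕ θ r) (sym (trans (cong (V._⊙ V₀) p≡0) (V.⊙-zeroˡ V₀)))) eq))
        where
        p≡0 : p ≡ F.0#
        p≡0 = V.∉-⊙⇒0 hyperplane V₀∉ p (subst (_∈ hyperplane) (sym (V.u⊕v≡0⇒u≡v eq)) (θ∈ r))

    frame : V.Automorphism 5
    frame = record
      { to     = join
      ; linear = record
        { ⊕-homo = λ { (p ∷ r) (p′ ∷ r′) → trans (cong₂ V._⊕_ (V.⊙-distribʳ V₀ p p′) (θ.+ᴹ-homo r r′))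
            (V.⊕-interchange _ _ _ _) }
        ; ⊙-homo = λ { c (p ∷ r) → trans (cong₂ V._⊕_ (sym (V.⊙-assoc c p V₀)) (θ.*ₗ-homo c r))
            (sym (V.⊙-distribˡ c _ _)) }
        }
      ; kernel = λ { (p ∷ r) eq → let p≡0 , r≡0 = join-kernel p r eq in cong₂ _∷_ p≡0 r≡0 }
      }

    private
      ovoid⇒ : ∀ {Q} → base Q → ∃ λ r → OvoidVector r × θ r ∈ Q
      ovoid⇒ {Q} OQ =
        let P , P-on , image = Equivalence.to (proj₂ isTitsOvoid Q) OQ
            r , Or , r∈P     = vectorOf P P-on
        in r , Or , Equivalence.from (image (θ r)) (r , r∈P , refl)
        where
        vectorOf : ∀ P → IsOnStandardTitsOvoid (2 ℕ.^ (e ℕ.+ 1)) P → ∃ λ r → OvoidVector r × r ∈ P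
        vectorOf P (infinite ∈P)   = pole , infinite , ∈P
        vectorOf P (affine s t ∈P) = finiteVector s t , finite s t , ∈P

      ovoid⇐ : ∀ {Q r} → OvoidVector r → θ r ∈ Q → base Q
      ovoid⇐ {Q} {r} Or θr∈Q = Equivalence.from (proj₂ isTitsOvoid Q) (P , isOn Or (V.vector∈ P) , image)
        where
        r≢0 : r ≢ V.0ⱽ
        r≢0 = OvoidVector-nonzero Or
        P : Point F 3
        P = V.point r r≢0
        isOn : ∀ {r P} → OvoidVector r → r ∈ P → IsOnStandardTitsOvoid (2 ℕ.^ (e ℕ.+ 1)) P
        isOn infinite     ∈P = infinite ∈P
        isOn (finite s t) ∈P = affine s t ∈P
        image : IsImage θ P Q
        image x = mk⇔
          (λ x∈Q → let c , x≡ = V.∈-point-nonzero Q (r≢0 ∘ θ-kernel) θr∈Q x∈Q in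
            c V.⊙ r , V.∈-vector P c , trans (θ.*ₗ-homo c r) (sym x≡))
          (λ (y , y∈P , θy≡x) → let c , y≡ = V.∈-point P y∈P in
            subst (_∈ Q) (trans (sym (θ.*ₗ-homo c r)) (trans (cong θ (sym y≡)) θy≡x)) (V.∈-⊙ Q c θr∈Q))

      independent : ∀ {r} → OvoidVector r → V.Independent₂ V₀ (θ r)
      independent {r} Or a b eq =
        let a≡0 , br≡0 = join-kernel a (b V.⊙ r) (trans (cong (a V.⊙ V₀ V.⊕_) (θ.*ₗ-homo b r)) eq)
        in a≡0 , V.scalar≡0 (OvoidVector-nonzero Or) b br≡0

    frame-isConeFrame : IsConeFrame pointSet frame
    frame-isConeFrame = record { cone⇒ = λ {P} → cone⇒ {P} ; cone⇐ = cone⇐ }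
      where
      cone⇒ : ∀ {P x} → pointSet P → x ≢ V.0ⱽ → x ∈ P →
              ∃ λ r → ∃₂ λ p c → OvoidVector r × x ≡ join (p ∷ c V.⊙ r)
      cone⇒ (Q , m , OQ , vertex⊑m , Q⊑m , P⊑m) x≢0 x∈P =
        let r , Or , θr∈Q = ovoid⇒ {Q} OQ
            p , c , x≡    = V.line-spanned m (vertex⊑m V₀ (V.vector∈ vertex)) (Q⊑m (θ r) θr∈Q) (P⊑m _ x∈P) (independent Or)
        in r , p , c , Or , trans x≡ (cong (p V.⊙ V₀ V.⊕_) (sym (θ.*ₗ-homo c r)))
      cone⇐ : ∀ P {r} p c → OvoidVector r → join (p ∷ c V.⊙ r) ≢ V.0ⱽ → join (p ∷ c V.⊙ r) ∈ P → pointSet P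
      cone⇐ P {r} p c Or x≢0 x∈P = Q , m , ovoid⇐ {Q} Or (V.vector∈ Q)
        , V.⊑-point vertex m (V.vector≢0 vertex) (V.vector∈ vertex) V₀∈m
        , V.⊑-point Q m θr≢0 (V.vector∈ Q) θr∈m
        , V.⊑-point P m x≢0 x∈P (subst (_∈ m) (cong (p V.⊙ V₀ V.⊕_) (sym (θ.*ₗ-homo c r)))
            (V.∈-span₂ (independent Or) p c))
        where
        θr≢0 : θ r ≢ V.0ⱽ
        θr≢0 = OvoidVector-nonzero Or ∘ θ-kernel
        Q : Point F 4
        Q = V.point (θ r) θr≢0
        m : Line F 4
        m = V.span₂ V₀ (θ r) (independent Or)
        V₀∈m : V₀ ∈ m
        V₀∈m = subst (_∈ m) (trans (cong₂ V._⊕_ (V.⊙-identity V₀) (V.⊙-zeroˡ (θ r))) (V.⊕-identityʳ V₀))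
          (V.∈-span₂ (independent Or) F.1# F.0#)
        θr∈m : θ r ∈ m
        θr∈m = subst (_∈ m) (trans (cong₂ V._⊕_ (V.⊙-zeroˡ V₀) (V.⊙-identity (θ r))) (V.⊕-identityˡ (θ r)))
          (V.∈-span₂ (independent Or) F.0# F.1#)

  -- Automorphisms of the ovoid act on frames; they are used to move a point of the
  -- ovoid to the pole.
  module _ (τ : V.Automorphism 4) (τ-carries : V.Carries τ OvoidVector OvoidVector) where
    private
      module τ = V.Automorphism τ
      open V.Carries τ-carries

      lift : Vector F 5 → Vector F 5
      lift (p ∷ r) = p ∷ τ.to r

    lifted : V.Automorphism 5
    lifted = record
      { to     = lift
      ; linear = record
        { ⊕-homo = λ { (p ∷ r) (p′ ∷ r′) → cong (p F.+ p′ ∷_) (τ.⊕-homo r r′) }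
        ; ⊙-homo = λ { c (p ∷ r) → cong (c F.* p ∷_) (τ.⊙-homo c r) }
        }
      ; kernel = λ { (p ∷ r) eq → cong₂ _∷_ (∷-injectiveˡ eq) (τ.kernel r (∷-injectiveʳ eq)) }
      }

    lifted-isConeFrame : ∀ {C β} → IsConeFrame C β → IsConeFrame C (β V.∘ᴬ lifted)
    lifted-isConeFrame {C} {β} frame = record { cone⇒ = λ {P} → cone⇒ {P} ; cone⇐ = cone⇐ }
      where
      module β = V.Automorphism β
      module C = IsConeFrame frame
      cone⇒ : ∀ {P x} → C P → x ≢ V.0ⱽ → x ∈ P →
              ∃ λ r → ∃₂ λ p c → OvoidVector r × x ≡ β.to (p ∷ τ.to (c V.⊙ r))
      cone⇒ {P} CP x≢0 x∈P =
        let r , p , c , Or , x≡       = C.cone⇒ {P} CP x≢0 x∈P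
            c′ , r′ , c′≢0 , Or′ , eq = back Or
        in r′ , p , c F.* F.1/ c′≢0 , Or′ , trans x≡ (cong (λ r → β.to (p ∷ r)) (begin
          c V.⊙ r                                  ≡⟨ cong (c V.⊙_) (V.1/-⊙ c′≢0 r) ⟨
          c V.⊙ F.1/ c′≢0 V.⊙ c′ V.⊙ r             ≡⟨ V.⊙-assoc c _ _ ⟩
          (c F.* F.1/ c′≢0) V.⊙ c′ V.⊙ r           ≡⟨ cong ((c F.* F.1/ c′≢0) V.⊙_) eq ⟨
          (c F.* F.1/ c′≢0) V.⊙ τ.to r′            ≡⟨ τ.⊙-homo _ r′ ⟨
          τ.to ((c F.* F.1/ c′≢0) V.⊙ r′)          ∎))
      cone⇐ : ∀ P {r} p c → OvoidVector r → β.to (p ∷ τ.to (c V.⊙ r)) ≢ V.0ⱽ → β.to (p ∷ τ.to (c V.⊙ r)) ∈ P → C P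
      cone⇐ P {r} p c Or x≢0 x∈P =
        let c′ , r′ , c′≢0 , Or′ , eq = forth Or
            τcr≡ = trans (τ.⊙-homo c r) (trans (cong (c V.⊙_) eq) (V.⊙-assoc c c′ r′))
            x≡   = cong (λ r → β.to (p ∷ r)) τcr≡
        in C.cone⇐ P p (c F.* c′) Or′ (x≢0 ∘ trans x≡) (subst (_∈ P) x≡ x∈P)

  module ConeAtInfinity {H : Hyperplane F 4} (S : DesarguesianSpread H) {C : PointSet F 4}
    (axis : Line F 4) (axis∈S : DesarguesianSpread.IsSpreadLine S axis)
    (cone∩H : ∀ X → (C X × X ⊑ H) ⇔ X ⊑ axis) where

    open FieldReduction S

    module _ {β : V.Automorphism 5} (frame : IsConeFrame C β) where
      private module β = V.Automorphism β
      open IsConeFrame frame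

      cone∩H⇒axis : ∀ {r} p c → OvoidVector r → β.to (p ∷ c V.⊙ r) ≢ V.0ⱽ →
        β.to (p ∷ c V.⊙ r) ∈ H → β.to (p ∷ c V.⊙ r) ∈ axis
      cone∩H⇒axis {r} p c Or x≢0 x∈H = Equivalence.to (cone∩H P)
          (cone⇐ P p c Or x≢0 (V.vector∈ P) , V.⊑-point P H x≢0 (V.vector∈ P) x∈H)
          (β.to (p ∷ c V.⊙ r)) (V.vector∈ P)
        where P = V.point (β.to (p ∷ c V.⊙ r)) x≢0

      axis⇒cone : ∀ {x} → x ≢ V.0ⱽ → x ∈ axis →
        ∃ λ r → ∃₂ λ p c → OvoidVector r × x ≡ β.to (p ∷ c V.⊙ r)
      axis⇒cone {x} x≢0 x∈axis = cone⇒ {P}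
        (proj₁ (Equivalence.from (cone∩H P) (V.⊑-point P axis x≢0 (V.vector∈ P) x∈axis))) x≢0 (V.vector∈ P)
        where P = V.point x x≢0

      β-nonzero : ∀ {p r} → (p ≡ F.0# → r ≡ V.0ⱽ → ⊥) → β.to (p ∷ r) ≢ V.0ⱽ
      β-nonzero nonzero eq = let eq′ = β.kernel _ eq in nonzero (∷-injectiveˡ eq′) (∷-injectiveʳ eq′)

      apex : Vector F 5
      apex = β.to (F.1# ∷ V.0ⱽ)

      β-split : ∀ p r → β.to (p ∷ r) ≡ p V.⊙ apex V.⊕ β.to (F.0# ∷ r)
      β-split p r = begin
        β.to (p ∷ r)                                             ≡⟨ cong β.to (cong₂ _∷_
          (F.solve 1 (λ p → p F.:= p F.:* F.:1 F.:+ F.:0) refl p)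
          (sym (trans (cong (V._⊕ r) (V.⊙-zeroʳ p)) (V.⊕-identityˡ r)))) ⟩
        β.to (p V.⊙ (F.1# ∷ V.0ⱽ) V.⊕ (F.0# ∷ r))                ≡⟨ β.⊕-homo _ _ ⟩
        β.to (p V.⊙ (F.1# ∷ V.0ⱽ)) V.⊕ β.to (F.0# ∷ r)           ≡⟨ cong (V._⊕ β.to (F.0# ∷ r)) (β.⊙-homo p _) ⟩
        p V.⊙ apex V.⊕ β.to (F.0# ∷ r)                           ∎

      private
        -- Projecting three independent points of the ovoid from an apex outside H
        -- would give three independent points of the axis.
        projection-impossible : (∀ {r} → OvoidVector r → ∃ λ p → β.to (p ∷ r) ∈ axis) → ⊥
        projection-impossible project =
          let p₁ , x₁∈ = project infinite
              p₂ , x₂∈ = project (finite F.0# F.0#)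
              p₃ , x₃∈ = project (finite F.1# F.0#)
              c , c≢0 , eq = V.dependent (ℕ.n<1+n 2) axis (_ ∷ _ ∷ _ ∷ []) (x₁∈ ∷ x₂∈ ∷ x₃∈ ∷ [])
          in independent p₁ p₂ p₃ c c≢0 eq
          where
          vectors′ : F.Carrier → F.Carrier → F.Carrier → Vec (Vector F 5) 3
          vectors′ p₁ p₂ p₃ = (p₁ ∷ pole) ∷ (p₂ ∷ finiteVector F.0# F.0#) ∷ (p₃ ∷ finiteVector F.1# F.0#) ∷ []
          independent : ∀ p₁ p₂ p₃ c → c ≢ V.0ⱽ → V.combination c (map β.to (vectors′ p₁ p₂ p₃)) ≡ V.0ⱽ → ⊥
          independent p₁ p₂ p₃ (a ∷ b ∷ c ∷ []) c≢0 eq = c≢0 (cong₂ _∷_ a≡0 (cong₂ (λ b c → b ∷ c ∷ []) b≡0 c≡0))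
            where
            coordinates≡0 : V.combination (a ∷ b ∷ c ∷ []) (vectors′ p₁ p₂ p₃) ≡ V.0ⱽ
            coordinates≡0 = β.kernel _ (trans (β.combination-homo (a ∷ b ∷ c ∷ []) (vectors′ p₁ p₂ p₃)) eq)
            c≡0 : c ≡ F.0#
            c≡0 = trans (F.solve 3 (λ a b c → c F.:= a F.:* F.:0 F.:+ (b F.:* F.:0 F.:+ (c F.:* F.:1 F.:+ F.:0))) refl a b c)
              (∷-injectiveˡ (∷-injectiveʳ (∷-injectiveʳ coordinates≡0)))
            b≡0 : b ≡ F.0#
            b≡0 = trans (F.solve 2 (λ a b → b F.:= a F.:* F.:0 F.:+ (b F.:* F.:1 F.:+ (F.:0 F.:* F.:1 F.:+ F.:0))) refl a b)
              (trans (cong (λ c → a F.* F.0# F.+ (b F.* F.1# F.+ (c F.* F.1# F.+ F.0#))) (sym c≡0))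
                (∷-injectiveˡ (∷-injectiveʳ coordinates≡0)))
            a≡0 : a ≡ F.0#
            a≡0 = trans (F.solve 3 (λ a y z → a F.:= a F.:* F.:1 F.:+ (F.:0 F.:* y F.:+ (F.:0 F.:* z F.:+ F.:0))) refl
                a (tits F.0# F.0#) (tits F.1# F.0#))
              (trans (cong₂ (λ b c → a F.* F.1# F.+ (b F.* tits F.0# F.0# F.+ (c F.* tits F.1# F.0# F.+ F.0#))) (sym b≡0) (sym c≡0))
                (∷-injectiveˡ (∷-injectiveʳ (∷-injectiveʳ (∷-injectiveʳ (∷-injectiveʳ coordinates≡0))))))

        finite-origin : ∃ λ p₀ → ¬ (p₀ ∈ H)
        finite-origin = V.proper (ℕ.n<1+n 4) H

      -- Otherwise every point of the ovoid could be projected from the apex into H,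
      -- hence onto the axis.
      apex∈H : apex ∈ H
      apex∈H = let f , h , h∈H , eq = decomposition apex in byCases f h h∈H eq (f F.≟ F.0#)
        where
        p₀ = proj₁ finite-origin
        open Origin p₀ (proj₂ finite-origin)
        byCases : ∀ f h → h ∈ H → f V.⊙ p₀ V.⊕ h ≡ apex → Dec (f ≡ F.0#) → apex ∈ H
        byCases f h h∈H eq (yes f≡0) = subst (_∈ H)
          (trans (sym (0⊙p₀ h)) (trans (cong (λ f → f V.⊙ p₀ V.⊕ h) (sym f≡0)) eq)) h∈H
        byCases f h h∈H eq (no f≢0) = ⊥-elim (projection-impossible project)
          where
          project : ∀ {r} → OvoidVector r → ∃ λ p → β.to (p ∷ r) ∈ axis
          project {r} Or =
            let f′ , h′ , h′∈H , eq′ = decomposition (β.to (F.0# ∷ r))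
                p = f′ F.* F.1/ f≢0
            in p , subst (λ r → β.to (p ∷ r) ∈ axis) (V.⊙-identity r)
              (cone∩H⇒axis p F.1# Or
                (β-nonzero λ _ 1r≡0 → OvoidVector-nonzero Or (trans (sym (V.⊙-identity r)) 1r≡0))
                (subst (_∈ H) (trans (sum p f′ h′ (f′/f*f f′) eq′) (cong (λ r → β.to (p ∷ r)) (sym (V.⊙-identity r))))
                  (V.∈-⊕ H (V.∈-⊙ H p h∈H) h′∈H)))
            where
            f′/f*f : ∀ f′ → f′ F.* F.1/ f≢0 F.* f ≡ f′
            f′/f*f f′ = trans (F.*-assoc f′ _ f) (trans (cong (f′ F.*_) (F.*-inverseˡ f≢0)) (F.*-identityʳ f′))
            sum : ∀ p f′ h′ → p F.* f ≡ f′ → f′ V.⊙ p₀ V.⊕ h′ ≡ β.to (F.0# ∷ r) →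
              p V.⊙ h V.⊕ h′ ≡ β.to (p ∷ r)
            sum p f′ h′ pf≡f′ eq′ = sym (begin
              β.to (p ∷ r)                                          ≡⟨ β-split p r ⟩
              p V.⊙ apex V.⊕ β.to (F.0# ∷ r)                        ≡⟨ cong₂ (λ x y → p V.⊙ x V.⊕ y) eq eq′ ⟨
              p V.⊙ (f V.⊙ p₀ V.⊕ h) V.⊕ (f′ V.⊙ p₀ V.⊕ h′)         ≡⟨ cong (V._⊕ (f′ V.⊙ p₀ V.⊕ h′)) (V.⊙-distribˡ p _ h) ⟩
              (p V.⊙ f V.⊙ p₀ V.⊕ p V.⊙ h) V.⊕ (f′ V.⊙ p₀ V.⊕ h′)   ≡⟨ cong (λ x → (x V.⊕ p V.⊙ h) V.⊕ (f′ V.⊙ p₀ V.⊕ h′))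
                (trans (V.⊙-assoc p f p₀) (cong (V._⊙ p₀) pf≡f′)) ⟩
              (f′ V.⊙ p₀ V.⊕ p V.⊙ h) V.⊕ (f′ V.⊙ p₀ V.⊕ h′)        ≡⟨ cong (V._⊕ (f′ V.⊙ p₀ V.⊕ h′)) (V.⊕-comm _ _) ⟩
              (p V.⊙ h V.⊕ f′ V.⊙ p₀) V.⊕ (f′ V.⊙ p₀ V.⊕ h′)        ≡⟨ V.⊕-cancel-middle _ _ _ ⟩
              p V.⊙ h V.⊕ h′                                        ∎)

      apex≢0 : apex ≢ V.0ⱽ
      apex≢0 = β-nonzero λ 1≡0 _ → F.0≢1 (sym 1≡0)

      apex∈axis : apex ∈ axis
      apex∈axis = subst (_∈ axis) apex≡ (cone∩H⇒axis F.1# F.0# infinite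
          (apex≢0 ∘ trans (sym apex≡)) (subst (_∈ H) (sym apex≡) apex∈H))
        where
        apex≡ : β.to (F.1# ∷ F.0# V.⊙ pole) ≡ apex
        apex≡ = cong (λ r → β.to (F.1# ∷ r)) (V.⊙-zeroˡ pole)

      -- The axis as the point ⟨v⟩ of the projective line over K.
      axis-vector : ∃ λ v → ψ v ≡ apex × (∀ x → x ∈ axis ⇔ (∃ λ k → ψ (k ⊙ v) ≡ x))
      axis-vector =
        let P , image        = Equivalence.to (proj₂ (DesarguesianSpread.fieldReduction S) axis) axis∈S
            v , v∈P , ψv≡    = Equivalence.to (image apex) apex∈axis
            v≢0              = λ v≡0 → apex≢0 (trans (sym ψv≡) (trans (cong ψ v≡0) ψ-0))
        in v , ψv≡ , λ x → mk⇔
          (λ x∈axis → let y , y∈P , ψy≡x = Equivalence.to (image x) x∈axis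
                          k , y≡         = ∈-point-nonzero P v≢0 v∈P y∈P
                      in k , trans (cong ψ (sym y≡)) ψy≡x)
          (λ (k , ψkv≡x) → Equivalence.from (image x) (k ⊙ v , ∈-⊙ P k v∈P , ψkv≡x))

      v≢0-of : ∀ {v} → ψ v ≡ apex → v ≢ 0ⱽ
      v≢0-of ψv≡ v≡0 = apex≢0 (trans (sym ψv≡) (trans (cong ψ v≡0) ψ-0))

      -- For u outside F, the point ψ (u v) of the axis is not the apex and lies on a
      -- generator of the cone.  This generator is the axis, and so the point of the
      -- ovoid on it is of the form ψ (w v), with w outside F.
      pole-on-axis : ∀ {v} → ψ v ≡ apex → (∀ x → x ∈ axis ⇔ (∃ λ k → ψ (k ⊙ v) ≡ x)) →
        ∃₂ λ r w → OvoidVector r × Outside w × β.to (F.0# ∷ r) ≡ ψ (w ⊙ v)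
      pole-on-axis {v} ψv≡ axis⇔ =
        let u , u∉F            = outside-exists
            r , p , c , Or , eq = axis⇒cone (uv≢0 u∉F) (Equivalence.from (axis⇔ (ψ (u ⊙ v))) (u , refl))
        in solution u∉F Or eq
        where
        v≢0 : v ≢ 0ⱽ
        v≢0 = v≢0-of ψv≡
        uv≢0 : ∀ {u} → Outside u → ψ (u ⊙ v) ≢ V.0ⱽ
        uv≢0 {u} u∉F eq = v≢0 (⊙-cancel-0 (λ u≡0 → u∉F F.0# (trans ι-0 (sym u≡0))) v (ψ-injective (trans eq (sym ψ-0))))
        apex-multiple : ∀ a → a V.⊙ apex ≡ ψ (⟦ a ⟧ ⊙ v)
        apex-multiple a = trans (cong (a V.⊙_) (sym ψv≡)) (sym (ψ-⊙ a v))
        β0≡ : ∀ {u r p c} → ψ (u ⊙ v) ≡ β.to (p ∷ c V.⊙ r) → c V.⊙ β.to (F.0# ∷ r) ≡ ψ ((⟦ p ⟧ + u) ⊙ v)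
        β0≡ {u} {r} {p} {c} eq = sym (begin
          ψ ((⟦ p ⟧ + u) ⊙ v)                                   ≡⟨ cong ψ (⊙-distribʳ v ⟦ p ⟧ u) ⟩
          ψ (⟦ p ⟧ ⊙ v ⊕ u ⊙ v)                                 ≡⟨ ψ-⊕ _ _ ⟩
          ψ (⟦ p ⟧ ⊙ v) V.⊕ ψ (u ⊙ v)                           ≡⟨ cong₂ V._⊕_ (sym (apex-multiple p)) (trans eq (β-split p _)) ⟩
          p V.⊙ apex V.⊕ (p V.⊙ apex V.⊕ β.to (F.0# ∷ c V.⊙ r)) ≡⟨ trans (sym (V.⊕-assoc _ _ _)) (trans (cong (V._⊕ _) (V.⊕-self _)) (V.⊕-identityˡ _)) ⟩
          β.to (F.0# ∷ c V.⊙ r)                                 ≡⟨ cong (λ x → β.to (x ∷ c V.⊙ r)) (sym (F.zeroʳ c)) ⟩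
          β.to (c V.⊙ (F.0# ∷ r))                               ≡⟨ β.⊙-homo c _ ⟩
          c V.⊙ β.to (F.0# ∷ r)                                 ∎)
        solution : ∀ {u r p c} → Outside u → OvoidVector r → ψ (u ⊙ v) ≡ β.to (p ∷ c V.⊙ r) →
          ∃₂ λ r w → OvoidVector r × Outside w × β.to (F.0# ∷ r) ≡ ψ (w ⊙ v)
        solution {u} {r} {p} {c} u∉F Or eq = r , ⟦ F.1/ c≢0 ⟧ * (⟦ p ⟧ + u) , Or , w∉F , β0≡ψw
          where
          c≢0 : c ≢ F.0#
          c≢0 c≡0 = v≢0 (⊙-cancel-0 p+u≢0 v (ψ-injective (trans (sym (β0≡ {u} {r} {p} {c} eq))
            (trans (cong (V._⊙ β.to (F.0# ∷ r)) c≡0) (trans (V.⊙-zeroˡ _) (sym ψ-0))))))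
            where
            p+u≢0 : ⟦ p ⟧ + u ≢ 0#
            p+u≢0 p+u≡0 = u∉F p (x+y≡0⇒x≡y p+u≡0)
          β0≡ψw : β.to (F.0# ∷ r) ≡ ψ ((⟦ F.1/ c≢0 ⟧ * (⟦ p ⟧ + u)) ⊙ v)
          β0≡ψw = begin
            β.to (F.0# ∷ r)                              ≡⟨ V.1/-⊙ c≢0 _ ⟨
            F.1/ c≢0 V.⊙ c V.⊙ β.to (F.0# ∷ r)           ≡⟨ cong (F.1/ c≢0 V.⊙_) (β0≡ eq) ⟩
            F.1/ c≢0 V.⊙ ψ ((⟦ p ⟧ + u) ⊙ v)             ≡⟨ ψ-⊙ _ _ ⟨
            ψ (⟦ F.1/ c≢0 ⟧ ⊙ (⟦ p ⟧ + u) ⊙ v)           ≡⟨ cong ψ (⊙-assoc _ _ v) ⟩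
            ψ ((⟦ F.1/ c≢0 ⟧ * (⟦ p ⟧ + u)) ⊙ v)         ∎
          w∉F : Outside (⟦ F.1/ c≢0 ⟧ * (⟦ p ⟧ + u))
          w∉F a a≡w = OvoidVector-nonzero Or (∷-injectiveʳ (β.to-injective {F.0# ∷ r} {a ∷ V.0ⱽ} (begin
            β.to (F.0# ∷ r)                              ≡⟨ β0≡ψw ⟩
            ψ ((⟦ F.1/ c≢0 ⟧ * (⟦ p ⟧ + u)) ⊙ v)         ≡⟨ cong (λ w → ψ (w ⊙ v)) a≡w ⟨
            ψ (⟦ a ⟧ ⊙ v)                                ≡⟨ apex-multiple a ⟨
            a V.⊙ apex                                   ≡⟨ β.⊙-homo a _ ⟨
            β.to (a V.⊙ (F.1# ∷ V.0ⱽ))                   ≡⟨ cong β.to (cong₂ _∷_ (F.*-identityʳ a) (V.⊙-zeroʳ a)) ⟩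
            β.to (a ∷ V.0ⱽ)                              ∎)))

    -- The coordinates of a cone whose pole and apex span the axis.
    module ConeCoordinates {β : V.Automorphism 5} (frame : IsConeFrame C β)
      (v : Vector K 2) (w : Carrier) (ψv≡ : ψ v ≡ apex frame)
      (axis⇔ : ∀ x → x ∈ axis ⇔ (∃ λ k → ψ (k ⊙ v) ≡ x))
      (w∉F : Outside w) (pole≡ : V.Automorphism.to β (F.0# ∷ pole) ≡ ψ (w ⊙ v)) where

      private
        module β = V.Automorphism β

      private
        open IsConeFrame frame

        e₀ e₁ e₂ : Vector F 4
        e₀ = F.1# ∷ F.0# ∷ F.0# ∷ F.0# ∷ []
        e₁ = F.0# ∷ F.1# ∷ F.0# ∷ F.0# ∷ []
        e₂ = F.0# ∷ F.0# ∷ F.1# ∷ F.0# ∷ []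

        apex-multiple : ∀ a → ψ (⟦ a ⟧ ⊙ v) ≡ a V.⊙ apex frame
        apex-multiple a = trans (ψ-⊙ a v) (cong (a V.⊙_) ψv≡)

        pole-multiple : ∀ b → ψ ((⟦ b ⟧ * w) ⊙ v) ≡ β.to (F.0# ∷ b V.⊙ pole)
        pole-multiple b = begin
          ψ ((⟦ b ⟧ * w) ⊙ v)           ≡⟨ cong ψ (⊙-assoc ⟦ b ⟧ w v) ⟨
          ψ (⟦ b ⟧ ⊙ w ⊙ v)             ≡⟨ ψ-⊙ b _ ⟩
          b V.⊙ ψ (w ⊙ v)               ≡⟨ cong (b V.⊙_) pole≡ ⟨
          b V.⊙ β.to (F.0# ∷ pole)      ≡⟨ β.⊙-homo b _ ⟨
          β.to (b V.⊙ (F.0# ∷ pole))    ≡⟨ cong (λ x → β.to (x ∷ b V.⊙ pole)) (F.zeroʳ b) ⟩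
          β.to (F.0# ∷ b V.⊙ pole)      ∎

        ψ-line : ∀ k → ∃₂ λ a b → ψ (k ⊙ v) ≡ β.to (a ∷ b V.⊙ pole)
        ψ-line k = let a , b , k≡ = Basis.decompose w∉F k in a , b , (begin
          ψ (k ⊙ v)                                        ≡⟨ cong (λ k → ψ (k ⊙ v)) k≡ ⟩
          ψ ((⟦ a ⟧ + ⟦ b ⟧ * w) ⊙ v)                      ≡⟨ cong ψ (⊙-distribʳ v _ _) ⟩
          ψ (⟦ a ⟧ ⊙ v ⊕ (⟦ b ⟧ * w) ⊙ v)                  ≡⟨ ψ-⊕ _ _ ⟩
          ψ (⟦ a ⟧ ⊙ v) V.⊕ ψ ((⟦ b ⟧ * w) ⊙ v)            ≡⟨ cong₂ V._⊕_ (apex-multiple a) (pole-multiple b) ⟩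
          a V.⊙ apex frame V.⊕ β.to (F.0# ∷ b V.⊙ pole)    ≡⟨ β-split frame a _ ⟨
          β.to (a ∷ b V.⊙ pole)                            ∎)

        apex-line : ∀ {p r k} → β.to (p ∷ r) ≡ ψ (k ⊙ v) → ∃ λ b → r ≡ b V.⊙ pole
        apex-line {p} {r} {k} eq = let a , b , ψ≡ = ψ-line k in
          b , ∷-injectiveʳ (β.to-injective {p ∷ r} {a ∷ b V.⊙ pole} (trans eq ψ≡))

        -- A point of the cone at infinity lies on the axis, which is spanned by the apex
        -- and the pole.
        finite∉H : ∀ p s t → ¬ (β.to (p ∷ finiteVector s t) ∈ H)
        finite∉H p s t ∈H =
          let k , ψk≡ = Equivalence.to (axis⇔ _) ∈axis
              b , r≡  = apex-line (sym ψk≡)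
          in F.0≢1 (sym (trans (∷-injectiveˡ r≡) (F.zeroʳ b)))
          where
          r = finiteVector s t
          1r≡ : β.to (p ∷ F.1# V.⊙ r) ≡ β.to (p ∷ r)
          1r≡ = cong (λ r → β.to (p ∷ r)) (V.⊙-identity r)
          ∈axis : β.to (p ∷ r) ∈ axis
          ∈axis = subst (_∈ axis) 1r≡ (cone∩H⇒axis frame p F.1# (finite s t)
            (β-nonzero frame λ _ 1r≡0 → OvoidVector-nonzero (finite s t) (trans (sym (V.⊙-identity r)) 1r≡0))
            (subst (_∈ H) (sym 1r≡) ∈H))

        pole∈H : ∀ p b → β.to (p ∷ b V.⊙ pole) ∈ H
        pole∈H p b = subst (_∈ H) (sym (trans (β-split frame p _) (cong (p V.⊙ apex frame V.⊕_) (sym (pole-multiple b)))))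
          (V.∈-⊕ H (V.∈-⊙ H p (apex∈H frame)) (ψ∈H _))

      p₀ : Vector F 5
      p₀ = β.to (F.0# ∷ e₀)

      p₀∉H : ¬ (p₀ ∈ H)
      p₀∉H ∈H = finite∉H F.0# F.0# F.0# (subst (_∈ H)
        (cong (λ z → β.to (F.0# ∷ F.1# ∷ F.0# ∷ F.0# ∷ z ∷ [])) (sym tits-00)) ∈H)

      private
        open Origin p₀ p₀∉H

        -- If b had a component f ≢ 0 along p₀, then e₀ + b / f would be at infinity.  For
        -- b = e₁ or e₂, adding a multiple of the pole gives a point of the ovoid, which
        -- is not at infinity.
        direction∈H : ∀ b → (∀ {f} (f≢0 : f ≢ F.0#) → ∃₂ λ s t →
            finiteVector s t ≡ F.1/ f≢0 V.⊙ (b V.⊕ f V.⊙ e₀) V.⊕ tits s t V.⊙ pole) →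
          β.to (F.0# ∷ b) ∈ H
        direction∈H b ovoidPoint =
          let f , h , h∈H , eq = decomposition (β.to (F.0# ∷ b)) in byCases f h h∈H eq (f F.≟ F.0#)
          where
          byCases : ∀ f h → h ∈ H → f V.⊙ p₀ V.⊕ h ≡ β.to (F.0# ∷ b) → Dec (f ≡ F.0#) → β.to (F.0# ∷ b) ∈ H
          byCases f h h∈H eq (yes f≡0) = subst (_∈ H)
            (trans (sym (0⊙p₀ h)) (trans (cong (λ f → f V.⊙ p₀ V.⊕ h) (sym f≡0)) eq)) h∈H
          byCases f h h∈H eq (no f≢0) = let s , t , r≡ = ovoidPoint f≢0 in
            ⊥-elim (finite∉H F.0# s t (subst (_∈ H) (sym (sum s t r≡))
              (V.∈-⊕ H (V.∈-⊙ H (F.1/ f≢0) h∈H) (pole∈H F.0# (tits s t)))))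
            where
            h≡ : h ≡ β.to ((F.0# ∷ b) V.⊕ f V.⊙ (F.0# ∷ e₀))
            h≡ = begin
              h                                                    ≡⟨ V.⊕-identityˡ h ⟨
              V.0ⱽ V.⊕ h                                           ≡⟨ cong (V._⊕ h) (V.⊕-self _) ⟨
              (f V.⊙ p₀ V.⊕ f V.⊙ p₀) V.⊕ h                        ≡⟨ V.⊕-assoc _ _ h ⟩
              f V.⊙ p₀ V.⊕ (f V.⊙ p₀ V.⊕ h)                        ≡⟨ V.⊕-comm _ _ ⟩
              (f V.⊙ p₀ V.⊕ h) V.⊕ f V.⊙ p₀                        ≡⟨ cong₂ V._⊕_ eq (sym (β.⊙-homo f _)) ⟩
              β.to (F.0# ∷ b) V.⊕ β.to (f V.⊙ (F.0# ∷ e₀))         ≡⟨ β.⊕-homo _ _ ⟨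
              β.to ((F.0# ∷ b) V.⊕ f V.⊙ (F.0# ∷ e₀))              ∎
            sum : ∀ s t → finiteVector s t ≡ F.1/ f≢0 V.⊙ (b V.⊕ f V.⊙ e₀) V.⊕ tits s t V.⊙ pole →
              β.to (F.0# ∷ finiteVector s t) ≡ F.1/ f≢0 V.⊙ h V.⊕ β.to (F.0# ∷ tits s t V.⊙ pole)
            sum s t r≡ = sym (begin
              F.1/ f≢0 V.⊙ h V.⊕ β.to (F.0# ∷ tits s t V.⊙ pole)
                ≡⟨ cong (λ h → F.1/ f≢0 V.⊙ h V.⊕ β.to (F.0# ∷ tits s t V.⊙ pole)) h≡ ⟩
              F.1/ f≢0 V.⊙ β.to ((F.0# ∷ b) V.⊕ f V.⊙ (F.0# ∷ e₀)) V.⊕ β.to (F.0# ∷ tits s t V.⊙ pole)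
                ≡⟨ cong (V._⊕ β.to (F.0# ∷ tits s t V.⊙ pole)) (β.⊙-homo (F.1/ f≢0) _) ⟨
              β.to (F.1/ f≢0 V.⊙ ((F.0# ∷ b) V.⊕ f V.⊙ (F.0# ∷ e₀))) V.⊕ β.to (F.0# ∷ tits s t V.⊙ pole)
                ≡⟨ β.⊕-homo _ _ ⟨
              β.to (F.1/ f≢0 V.⊙ ((F.0# ∷ b) V.⊕ f V.⊙ (F.0# ∷ e₀)) V.⊕ (F.0# ∷ tits s t V.⊙ pole))
                ≡⟨ cong β.to (cong₂ _∷_ (F.solve 2 (λ i f → i F.:* (F.:0 F.:+ f F.:* F.:0) F.:+ F.:0 F.:= F.:0) refl (F.1/ f≢0) f) (sym r≡)) ⟩
              β.to (F.0# ∷ finiteVector s t) ∎)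

        one : ∀ {f} (f≢0 : f ≢ F.0#) z → F.1# ≡ F.1/ f≢0 F.* (F.0# F.+ f F.* F.1#) F.+ z F.* F.0#
        one {f} f≢0 z = trans (sym (F.*-inverseˡ f≢0))
          (F.solve 3 (λ i f z → i F.:* f F.:= i F.:* (F.:0 F.:+ f F.:* F.:1) F.:+ z F.:* F.:0) refl (F.1/ f≢0) f z)

        kept : ∀ i f z → i ≡ i F.* (F.1# F.+ f F.* F.0#) F.+ z F.* F.0#
        kept = F.solve 3 (λ i f z → i F.:= i F.:* (F.:1 F.:+ f F.:* F.:0) F.:+ z F.:* F.:0) refl

        vanishing : ∀ i f z → F.0# ≡ i F.* (F.0# F.+ f F.* F.0#) F.+ z F.* F.0#
        vanishing = F.solve 3 (λ i f z → F.:0 F.:= i F.:* (F.:0 F.:+ f F.:* F.:0) F.:+ z F.:* F.:0) refl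

        height : ∀ i f z → z ≡ i F.* (F.0# F.+ f F.* F.0#) F.+ z F.* F.1#
        height = F.solve 3 (λ i f z → z F.:= i F.:* (F.:0 F.:+ f F.:* F.:0) F.:+ z F.:* F.:1) refl

        b₁∈H : β.to (F.0# ∷ e₁) ∈ H
        b₁∈H = direction∈H e₁ λ {f} f≢0 → let i = F.1/ f≢0 ; z = tits i F.0# in
          i , F.0# , ∷-injectiveʳ (vec₅ {p = F.0#} refl (one f≢0 z) (kept i f z) (vanishing i f z) (height i f z))

        b₂∈H : β.to (F.0# ∷ e₂) ∈ H
        b₂∈H = direction∈H e₂ λ {f} f≢0 → let i = F.1/ f≢0 ; z = tits F.0# i in
          F.0# , i , ∷-injectiveʳ (vec₅ {p = F.0#} refl (one f≢0 z) (vanishing i f z) (kept i f z) (height i f z))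

        abstract
          v₁ : Vector K 2
          v₁ = proj₁ (ψ-onto b₁∈H)

          ψv₁≡ : ψ v₁ ≡ β.to (F.0# ∷ e₁)
          ψv₁≡ = proj₂ (ψ-onto b₁∈H)

      abstract
        v′ : Vector K 2
        v′ = proj₁ (ψ-onto b₂∈H)

        private
          ψv′≡ : ψ v′ ≡ β.to (F.0# ∷ e₂)
          ψv′≡ = proj₂ (ψ-onto b₂∈H)

      private
        v≢0 : v ≢ 0ⱽ
        v≢0 = v≢0-of frame ψv≡

      -- If v′ were a K-multiple of v, then e₂ would lie on the axis.
      v′-v-independent : Independent₂ v′ v
      v′-v-independent x y eq = byCases (x ≟ 0#)
        where
        byCases : Dec (x ≡ 0#) → x ≡ 0# × y ≡ 0#
        byCases (yes x≡0) = x≡0 , scalar≡0 v≢0 y (trans (sym (⊕-identityˡ _))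
          (trans (cong (_⊕ y ⊙ v) (sym (trans (cong (_⊙ v′) x≡0) (⊙-zeroˡ v′)))) eq))
        byCases (no x≢0) =
          let b , e₂≡ = apex-line (trans (sym ψv′≡) (cong ψ v′≡))
          in contradiction (sym (trans (∷-injectiveˡ (∷-injectiveʳ (∷-injectiveʳ e₂≡))) (F.zeroʳ b))) F.0≢1
          where
          v′≡ : v′ ≡ (1/ x≢0 * y) ⊙ v
          v′≡ = trans (sym (1/-⊙ x≢0 v′)) (trans (cong (1/ x≢0 ⊙_) (u⊕v≡0⇒u≡v eq)) (⊙-assoc _ y v))

      open Chart S v′ v v′-v-independent p₀ p₀∉H

      private
        v₁-coordinates : ∃₂ λ u d → u ⊙ v′ ⊕ d ⊙ v ≡ v₁
        v₁-coordinates = coordinates v₁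

      u d : Carrier
      u = proj₁ v₁-coordinates
      d = proj₁ (proj₂ v₁-coordinates)

      private
        v₁≡ : u ⊙ v′ ⊕ d ⊙ v ≡ v₁
        v₁≡ = proj₂ (proj₂ v₁-coordinates)

      -- For u in F, e₁ + u e₂ would lie on the axis.
      u∉F : Outside u
      u∉F a a≡u =
        let b , r≡ = apex-line {F.0# F.+ a F.* F.0#} {e₁ V.⊕ a V.⊙ e₂} {d} on-axis
        in F.0≢1 (sym (begin
          F.1#                    ≡⟨ F.solve 1 (λ a → F.:1 F.:= F.:1 F.:+ a F.:* F.:0) refl a ⟩
          F.1# F.+ a F.* F.0#     ≡⟨ ∷-injectiveˡ (∷-injectiveʳ r≡) ⟩
          b F.* F.0#              ≡⟨ F.zeroʳ b ⟩
          F.0#                    ∎))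
        where
        on-axis : β.to ((F.0# ∷ e₁) V.⊕ a V.⊙ (F.0# ∷ e₂)) ≡ ψ (d ⊙ v)
        on-axis = begin
          β.to ((F.0# ∷ e₁) V.⊕ a V.⊙ (F.0# ∷ e₂))          ≡⟨ β.⊕-homo _ _ ⟩
          β.to (F.0# ∷ e₁) V.⊕ β.to (a V.⊙ (F.0# ∷ e₂))     ≡⟨ cong₂ V._⊕_ (sym ψv₁≡) (trans (β.⊙-homo a _) (cong (a V.⊙_) (sym ψv′≡))) ⟩
          ψ v₁ V.⊕ a V.⊙ ψ v′                               ≡⟨ cong (ψ v₁ V.⊕_) (ψ-⊙ a v′) ⟨
          ψ v₁ V.⊕ ψ (⟦ a ⟧ ⊙ v′)                           ≡⟨ ψ-⊕ _ _ ⟨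
          ψ (v₁ ⊕ ⟦ a ⟧ ⊙ v′)                               ≡⟨ cong ψ (begin
            v₁ ⊕ ⟦ a ⟧ ⊙ v′                        ≡⟨ cong₂ (λ x c → x ⊕ c ⊙ v′) (sym v₁≡) a≡u ⟩
            (u ⊙ v′ ⊕ d ⊙ v) ⊕ u ⊙ v′              ≡⟨ ⊕-comm _ _ ⟩
            u ⊙ v′ ⊕ (u ⊙ v′ ⊕ d ⊙ v)              ≡⟨ ⊕-assoc _ _ _ ⟨
            (u ⊙ v′ ⊕ u ⊙ v′) ⊕ d ⊙ v              ≡⟨ cong (_⊕ d ⊙ v) (⊕-self _) ⟩
            0ⱽ ⊕ d ⊙ v                             ≡⟨ ⊕-identityˡ _ ⟩
            d ⊙ v                                  ∎) ⟩
          ψ (d ⊙ v)                                         ∎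

      private
        regroup : ∀ {n} (a b : Vector K n) u d s t p zw →
          (s * u + t) ⊙ a ⊕ (p + s * d + zw) ⊙ b ≡ s ⊙ (u ⊙ a ⊕ d ⊙ b) ⊕ (t ⊙ a ⊕ (p ⊙ b ⊕ zw ⊙ b))
        regroup []      []      u d s t p zw = refl
        regroup (x ∷ a) (y ∷ b) u d s t p zw = cong₂ _∷_
          (solve 8 (λ x y u d s t p zw → (s :* u :+ t) :* x :+ (p :+ s :* d :+ zw) :* y :=
            s :* (u :* x :+ d :* y) :+ (t :* x :+ (p :* y :+ zw :* y))) refl x y u d s t p zw)
          (regroup a b u d s t p zw)

      -- In K² the directions e₁, e₂, pole and apex are v₁ = u v′ + d v, v′, w v and v.
      cone-vector : ∀ s t p →
        affineVector (⟦ s ⟧ * u + ⟦ t ⟧) (⟦ p ⟧ + ⟦ s ⟧ * d + ⟦ tits s t ⟧ * w) ≡ β.to (p ∷ finiteVector s t)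
      cone-vector s t p = begin
        p₀ V.⊕ Ψ _ _
          ≡⟨ cong (p₀ V.⊕_) (trans (Ψ-ψ _ _) (cong ψ (trans (regroup v′ v u d ⟦ s ⟧ ⟦ t ⟧ ⟦ p ⟧ (⟦ z ⟧ * w))
               (cong (λ x → ⟦ s ⟧ ⊙ x ⊕ rest) v₁≡)))) ⟩
        p₀ V.⊕ ψ (⟦ s ⟧ ⊙ v₁ ⊕ rest)
          ≡⟨ cong (p₀ V.⊕_) (trans (ψ-⊕ _ _) (cong₂ V._⊕_ (ψ-⊙ s v₁)
               (trans (ψ-⊕ _ _) (cong₂ V._⊕_ (ψ-⊙ t v′) (trans (ψ-⊕ _ _) (cong₂ V._⊕_ (apex-multiple p) (pole-multiple z))))))) ⟩
        p₀ V.⊕ (s V.⊙ ψ v₁ V.⊕ (t V.⊙ ψ v′ V.⊕ (p V.⊙ apex frame V.⊕ β.to (F.0# ∷ z V.⊙ pole))))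
          ≡⟨ cong₂ (λ x y → p₀ V.⊕ (s V.⊙ x V.⊕ (t V.⊙ y V.⊕ (p V.⊙ apex frame V.⊕ β.to (F.0# ∷ z V.⊙ pole))))) ψv₁≡ ψv′≡ ⟩
        p₀ V.⊕ (s V.⊙ β.to (F.0# ∷ e₁) V.⊕ (t V.⊙ β.to (F.0# ∷ e₂) V.⊕ (p V.⊙ apex frame V.⊕ β.to (F.0# ∷ z V.⊙ pole))))
          ≡⟨ cong (p₀ V.⊕_) (cong₂ V._⊕_ (β.⊙-homo s (F.0# ∷ e₁)) (cong₂ V._⊕_ (β.⊙-homo t (F.0# ∷ e₂)) (β-split frame p (z V.⊙ pole)))) ⟨
        p₀ V.⊕ (β.to (s V.⊙ (F.0# ∷ e₁)) V.⊕ (β.to (t V.⊙ (F.0# ∷ e₂)) V.⊕ β.to (p ∷ z V.⊙ pole)))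
          ≡⟨ trans (β.⊕-homo (F.0# ∷ e₀) _) (cong (p₀ V.⊕_) (trans (β.⊕-homo (s V.⊙ (F.0# ∷ e₁)) _)
               (cong (β.to (s V.⊙ (F.0# ∷ e₁)) V.⊕_) (β.⊕-homo (t V.⊙ (F.0# ∷ e₂)) (p ∷ z V.⊙ pole))))) ⟨
        β.to ((F.0# ∷ e₀) V.⊕ (s V.⊙ (F.0# ∷ e₁) V.⊕ (t V.⊙ (F.0# ∷ e₂) V.⊕ (p ∷ z V.⊙ pole))))
          ≡⟨ cong β.to (vec₅
               (F.solve 3 (λ s t p → F.:0 F.:+ (s F.:* F.:0 F.:+ (t F.:* F.:0 F.:+ p)) F.:= p) refl s t p)
               (F.solve 3 (λ s t z → F.:1 F.:+ (s F.:* F.:0 F.:+ (t F.:* F.:0 F.:+ z F.:* F.:0)) F.:= F.:1) refl s t z)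
               (F.solve 3 (λ s t z → F.:0 F.:+ (s F.:* F.:1 F.:+ (t F.:* F.:0 F.:+ z F.:* F.:0)) F.:= s) refl s t z)
               (F.solve 3 (λ s t z → F.:0 F.:+ (s F.:* F.:0 F.:+ (t F.:* F.:1 F.:+ z F.:* F.:0)) F.:= t) refl s t z)
               (F.solve 3 (λ s t z → F.:0 F.:+ (s F.:* F.:0 F.:+ (t F.:* F.:0 F.:+ z F.:* F.:1)) F.:= z) refl s t z)) ⟩
        β.to (p ∷ finiteVector s t) ∎
        where
        z = tits s t
        rest : Vector K 2
        rest = ⟦ t ⟧ ⊙ v′ ⊕ (⟦ p ⟧ ⊙ v ⊕ (⟦ z ⟧ * w) ⊙ v)

      private
        OnGenerator : Point F 4 → Set
        OnGenerator P = ∃ λ s → ∃₂ λ t p → β.to (p ∷ finiteVector s t) ∈ P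

        generator-scale : ∀ {p c r} → (c≢0 : c ≢ F.0#) →
          β.to (p ∷ c V.⊙ r) ≡ c V.⊙ β.to (F.1/ c≢0 F.* p ∷ r)
        generator-scale {p} {c} {r} c≢0 = trans
          (cong (λ p → β.to (p ∷ c V.⊙ r)) (sym (F.inverse-cancelʳ c≢0 p))) (β.⊙-homo c (F.1/ c≢0 F.* p ∷ r))

        0⊙-apex : ∀ p r → β.to (p ∷ F.0# V.⊙ r) ≡ p V.⊙ apex frame
        0⊙-apex p r = begin
          β.to (p ∷ F.0# V.⊙ r)                        ≡⟨ β-split frame p _ ⟩
          p V.⊙ apex frame V.⊕ β.to (F.0# ∷ F.0# V.⊙ r) ≡⟨ cong (λ r → p V.⊙ apex frame V.⊕ β.to (F.0# ∷ r)) (V.⊙-zeroˡ r) ⟩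
          p V.⊙ apex frame V.⊕ β.to V.0ⱽ               ≡⟨ cong (p V.⊙ apex frame V.⊕_) β.0-homo ⟩
          p V.⊙ apex frame V.⊕ V.0ⱽ                    ≡⟨ V.⊕-identityʳ _ ⟩
          p V.⊙ apex frame                             ∎

        onGenerator : ∀ {P r p c} → OvoidVector r → ¬ (β.to (p ∷ c V.⊙ r) ∈ H) → β.to (p ∷ c V.⊙ r) ∈ P →
          OnGenerator P
        onGenerator {P} {r} {p} {c} infinite     ∉H ∈P = contradiction (pole∈H p c) ∉H
        onGenerator {P} {r} {p} {c} (finite s t) ∉H ∈P =
          s , t , F.1/ c≢0 F.* p , V.∈-⊙⁻¹ P c≢0 (subst (_∈ P) (generator-scale c≢0) ∈P)
          where
          c≢0 : c ≢ F.0#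
          c≢0 c≡0 = ∉H (subst (_∈ H) (sym (trans (cong (λ c → β.to (p ∷ c V.⊙ r)) c≡0) (0⊙-apex p r)))
            (V.∈-⊙ H p (apex∈H frame)))

        cone⇒generator : ∀ P → ¬ (P ⊑ H) → C P → OnGenerator P
        cone⇒generator P P⋢H CP =
          let r , p , c , Or , eq = cone⇒ {P} CP (V.vector≢0 P) (V.vector∈ P)
          in onGenerator {P} {r} {p} {c} Or
               (λ ∈H → P⋢H (V.⊑-point P H (V.vector≢0 P) (V.vector∈ P) (subst (_∈ H) (sym eq) ∈H)))
               (subst (_∈ P) eq (V.vector∈ P))

        generator⇒cone : ∀ P s t p → β.to (p ∷ finiteVector s t) ∈ P → C P
        generator⇒cone P s t p ∈P = cone⇐ P p F.1# (finite s t) nonzero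
            (subst (_∈ P) (cong (λ r → β.to (p ∷ r)) (sym 1r≡)) ∈P)
          where
          1r≡ : F.1# V.⊙ finiteVector s t ≡ finiteVector s t
          1r≡ = V.⊙-identity (finiteVector s t)
          nonzero : β.to (p ∷ F.1# V.⊙ finiteVector s t) ≢ V.0ⱽ
          nonzero = β-nonzero frame λ _ 1r≡0 → OvoidVector-nonzero (finite s t) (trans (sym 1r≡) 1r≡0)

      private
        toCoordinates : ∀ (P : Point F 4) s t p → β.to (p ∷ finiteVector s t) ∈ P →
          affineVector (⟦ s ⟧ * u + ⟦ t ⟧) (⟦ p ⟧ + ⟦ s ⟧ * d + ⟦ tits s t ⟧ * w) ∈ P
        toCoordinates P s t p = subst (_∈ P) (sym (cone-vector s t p))

        fromCoordinates : ∀ (P : Point F 4) s t p →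
          affineVector (⟦ s ⟧ * u + ⟦ t ⟧) (⟦ p ⟧ + ⟦ s ⟧ * d + ⟦ tits s t ⟧ * w) ∈ P →
          β.to (p ∷ finiteVector s t) ∈ P
        fromCoordinates P s t p = subst (_∈ P) (cone-vector s t p)

      cone⇒coordinates : ∀ (P : Point F 4) → ¬ (P ⊑ H) → C P → ∃ λ s → ∃₂ λ t p →
        affineVector (⟦ s ⟧ * u + ⟦ t ⟧) (⟦ p ⟧ + ⟦ s ⟧ * d + ⟦ tits s t ⟧ * w) ∈ P
      cone⇒coordinates P P⋢H CP =
        let s , t , p , ∈P = cone⇒generator P P⋢H CP in s , t , p , toCoordinates P s t p ∈P

      coordinates⇒cone : ∀ (P : Point F 4) s t p →
        affineVector (⟦ s ⟧ * u + ⟦ t ⟧) (⟦ p ⟧ + ⟦ s ⟧ * d + ⟦ tits s t ⟧ * w) ∈ P → C P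
      coordinates⇒cone P s t p ∈P = generator⇒cone P s t p (fromCoordinates P s t p ∈P)

      ∈axis⇔ : ∀ x → x ∈ axis ⇔ (∃ λ k → x ≡ Ψ 0# k)
      ∈axis⇔ x = mk⇔
        (λ x∈ → let k , eq = Equivalence.to (axis⇔ x) x∈ in k , trans (sym eq) (sym (Ψ0 k)))
        (λ (k , eq) → Equivalence.from (axis⇔ x) (k , sym (trans eq (Ψ0 k))))
        where
        Ψ0 : ∀ k → Ψ 0# k ≡ ψ (k ⊙ v)
        Ψ0 k = trans (Ψ-ψ 0# k) (cong ψ (trans (cong (_⊕ k ⊙ v) (⊙-zeroˡ v′)) (⊕-identityˡ _)))

    -- The unital of a cone

    module UnitalCoordinates (φ : Isomorphism (abbPlane S) (PG₂ K))
      {β : V.Automorphism 5} (frame : IsConeFrame C β)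
      (v : Vector K 2) (w : Carrier) (ψv≡ : ψ v ≡ apex frame)
      (axis⇔ : ∀ x → x ∈ axis ⇔ (∃ λ k → ψ (k ⊙ v) ≡ x))
      (w∉F : Outside w) (pole≡ : V.Automorphism.to β (F.0# ∷ pole) ≡ ψ (w ⊙ v)) where

      open ConeCoordinates frame v w ψv≡ axis⇔ w∉F pole≡
      open Chart S v′ v v′-v-independent p₀ p₀∉H
      open Identification S v′ v v′-v-independent p₀ p₀∉H φ
      open Restriction α α-+ α-* α-1

      u′ w′ d′ : Carrier
      u′ = α u
      w′ = α w
      d′ = α d

      u′∉F : Outside u′
      u′∉F = α-outside u∉F

      w′∉F : Outside w′
      w′∉F = α-outside w∉F

      Gᴬ : Automorphism 3
      Gᴬ = record { to = G ; linear = G-linear ; kernel = G-kernel }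

      private
        x y : F.Carrier → F.Carrier → F.Carrier → Carrier
        x s t p = ⟦ s ⟧ * u + ⟦ t ⟧
        y s t p = ⟦ p ⟧ + ⟦ s ⟧ * d + ⟦ tits s t ⟧ * w

        axis-≈-vertical : ∀ {m : Line F 4} {m∈S} → m ≈ axis →
          Setoid._≈_ (IncidenceStructure.points (abbPlane S)) (ABBPoint.infinite m m∈S) verticalPoint
        axis-≈-vertical (m⊑axis , axis⊑m) = ABB.infinite
          ( (λ x x∈ → Equivalence.from ∈verticalLine (Equivalence.to (∈axis⇔ x) (m⊑axis x x∈)))
          , (λ x x∈ → axis⊑m x (Equivalence.from (∈axis⇔ x) (Equivalence.to ∈verticalLine x∈))))

        module PG = Setoid (subspaceSetoid K 3 1)

        vertical-image′ : ∀ {m : Line F 4} {m∈S} → m ≈ axis → ∀ (Q : Point K 2) →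
          Φ (ABBPoint.infinite m m∈S) ≈ Q ⇔ (G vertexPoint ∈ Q)
        vertical-image′ {m} {m∈S} m≈axis Q = mk⇔
          (λ ΦX≈Q → Equivalence.to (vertical-image Q) (PG.trans {Φ verticalPoint} {Φ X} {Q} (PG.sym {Φ X} {Φ verticalPoint} ΦX≈) ΦX≈Q))
          (λ ∈Q → PG.trans {Φ X} {Φ verticalPoint} {Q} ΦX≈ (Equivalence.from (vertical-image Q) ∈Q))
          where
          X = ABBPoint.infinite m m∈S
          ΦX≈ : Φ X ≈ Φ verticalPoint
          ΦX≈ = Φ-cong {X} {verticalPoint} (axis-≈-vertical m≈axis)

      private
        Preimage Image : Point K 2 → Set
        Preimage Q = ∃ λ X → abbPointSet S C axis X × Φ X ≈ Q
        Image Q = G vertexPoint ∈ Q ⊎ ∃ λ s → ∃₂ λ t p → G (1# ∷ α (x s t p) ∷ α (y s t p) ∷ []) ∈ Q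

        affine⇒ : ∀ (P : Point F 4) (P⋢H : ¬ (P ⊑ H)) (Q : Point K 2) → C P →
          Φ (ABBPoint.affine P P⋢H) ≈ Q → Image Q
        affine⇒ P P⋢H Q CP ΦX≈Q = let s , t , p , ∈P = cone⇒coordinates P P⋢H CP in
          inj₂ (s , t , p , Equivalence.to (affine-image′ P⋢H {x s t p} {y s t p} ∈P Q) ΦX≈Q)

        ⇒ : ∀ (Q : Point K 2) → Preimage Q → Image Q
        ⇒ Q (ABBPoint.affine P P⋢H , CP , ΦX≈Q) = affine⇒ P P⋢H Q CP ΦX≈Q
        ⇒ Q (ABBPoint.infinite m m∈S , m≈axis , ΦX≈Q) =
          inj₁ (Equivalence.to (vertical-image′ {m} {m∈S} m≈axis Q) ΦX≈Q)

        vertex⇐ : ∀ (Q : Point K 2) → G vertexPoint ∈ Q → Preimage Q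
        vertex⇐ Q ∈Q = ABBPoint.infinite axis axis∈S , axis≈axis
          , Equivalence.from (vertical-image′ {axis} {axis∈S} axis≈axis Q) ∈Q
          where
          axis≈axis : axis ≈ axis
          axis≈axis = (λ _ x∈ → x∈) , (λ _ x∈ → x∈)

        finite⇐ : ∀ (Q : Point K 2) s t p → G (1# ∷ α (x s t p) ∷ α (y s t p) ∷ []) ∈ Q → Preimage Q
        finite⇐ Q s t p ∈Q = ABBPoint.affine P P⋢H
          , coordinates⇒cone P s t p (V.vector∈ P)
          , Equivalence.from (affine-image (x s t p) (y s t p) Q) ∈Q
          where
          P : Point F 4
          P = affinePoint (x s t p) (y s t p)
          P⋢H : ¬ (P ⊑ H)
          P⋢H = affinePoint⋢H (x s t p) (y s t p)

        ⇐ : ∀ (Q : Point K 2) → Image Q → Preimage Q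
        ⇐ Q (inj₁ ∈Q)               = vertex⇐ Q ∈Q
        ⇐ Q (inj₂ (s , t , p , ∈Q)) = finite⇐ Q s t p ∈Q

      hasCoordinates : ∀ {U} → (∀ Q → U Q ⇔ (∃ λ X → abbPointSet S C axis X × Φ X ≈ Q)) →
        U HasCoordinates CoordinateUnital u′ w′ d′ By Gᴬ
      hasCoordinates {U} U⇔ = semilinear-image {U} Gᴬ u w d λ Q →
        mk⇔ (λ UQ → ⇒ Q (Equivalence.to (U⇔ Q) UQ)) (λ v → Equivalence.from (U⇔ Q) (⇐ Q v))

    module _ (φ : Isomorphism (abbPlane S) (PG₂ K)) {U : PointSet K 2}
      (U⇔ : ∀ Q → U Q ⇔ (∃ λ X → abbPointSet S C axis X × Inverse.to (Isomorphism.onPoints φ) X ≈ Q)) where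
      abstract
        private
          pole-form : ∀ {β} (frame : IsConeFrame C β) v w → ψ v ≡ apex frame →
            (∀ x → x ∈ axis ⇔ (∃ λ k → ψ (k ⊙ v) ≡ x)) → Outside w →
            V.Automorphism.to β (F.0# ∷ pole) ≡ ψ (w ⊙ v) → HasCoordinateForm U
          pole-form frame v w ψv≡ axis⇔ w∉F pole≡ = u′ , w′ , d′ , Gᴬ , u′∉F , w′∉F , hasCoordinates {U} U⇔
            where open UnitalCoordinates φ frame v w ψv≡ axis⇔ w∉F pole≡

          -- By transitivity, the frame may be changed so that r becomes the pole.
          ovoid-form : ∀ {β} (frame : IsConeFrame C β) v → ψ v ≡ apex frame →
            (∀ x → x ∈ axis ⇔ (∃ λ k → ψ (k ⊙ v) ≡ x)) →
            (∃₂ λ r w → OvoidVector r × Outside w × V.Automorphism.to β (F.0# ∷ r) ≡ ψ (w ⊙ v)) →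
            HasCoordinateForm U
          ovoid-form {β} frame v ψv≡ axis⇔ (r , w , Or , w∉F , r≡) =
            let τ , τ-carries , τpole≡r = transitive Or
            in pole-form (lifted-isConeFrame τ τ-carries frame) v w
                 (trans ψv≡ (cong (λ r → V.Automorphism.to β (F.1# ∷ r)) (sym (V.Automorphism.0-homo τ))))
                 axis⇔ w∉F
                 (trans (cong (λ r → V.Automorphism.to β (F.0# ∷ r)) τpole≡r) r≡)

        cone-form : ∀ {β} → IsConeFrame C β → HasCoordinateForm U
        cone-form frame =
          let v , ψv≡ , axis⇔ = axis-vector frame
          in ovoid-form frame v ψv≡ axis⇔ (pole-on-axis frame ψv≡ axis⇔)

  coordinate-form : ∀ {U} → ArisesFromTitsCone (2 ℕ.^ (e ℕ.+ 1)) U → HasCoordinateForm U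
  coordinate-form {U} arises = ConeAtInfinity.cone-form spread axis axis∈spread cone∩H identification {U} pointSet
      (ConeFrame.frame-isConeFrame cone)
    where open ArisesFromTitsCone arises

  -- The parameters of U₁ are outside F, so both unitals can be normalised to them.
  unitals-equivalent : ∀ {U₁ U₂} → ArisesFromTitsCone (2 ℕ.^ (e ℕ.+ 1)) U₁ →
    ArisesFromTitsCone (2 ℕ.^ (e ℕ.+ 1)) U₂ → ∃ λ (g : PGL 3 K) → (g ⟨$⟩ U₁) ≐ U₂
  unitals-equivalent {U₁} {U₂} arises₁ arises₂ =
    let u₁ , w₁ , d₁ , G₁ , u₁∉F , w₁∉F , U₁-coordinates = coordinate-form {U₁} arises₁
        u₂ , w₂ , d₂ , G₂ , u₂∉F , w₂∉F , U₂-coordinates = coordinate-form {U₂} arises₂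
        T₁ , T₁-carries = normalise d₁ u₁∉F w₁∉F u₁∉F w₁∉F
        T₂ , T₂-carries = normalise d₂ u₂∉F w₂∉F u₁∉F w₁∉F
    in same-coordinates⇒equivalent {U₁} {U₂} {G₁ = G₁ ∘ᴬ inverse T₁} {G₂ = G₂ ∘ᴬ inverse T₂}
         CoordinateUnital-nonzero
         (change-coordinates {U₁} {G = G₁} {T = T₁} T₁-carries U₁-coordinates)
         (change-coordinates {U₂} {G = G₂} {T = T₂} T₂-carries U₂-coordinates)

-- Equivalence of all Buekenhout–Tits unitals

open import Data.Nat.Base using (_≤_; _+_; _*_; _^_)

theorem1 : (e : ℕ) → 1 ≤ e →
    (F K : Field) →
    HasOrder F (2 ^ (2 * e + 1)) →
    HasOrder K ((2 ^ (2 * e + 1)) ^ 2) →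
    (ι : Embedding F K) →
    (U₁ U₂ : PointSet K 2) →
    IsBuekenhoutTitsUnital e ι U₁ →
    IsBuekenhoutTitsUnital e ι U₂ →
    ∃ λ (g : PGL 3 K) → (g ⟨$⟩ U₁) ≐ U₂
theorem1 e _ F K F-order K-order ι U₁ U₂ unital₁ unital₂ =
  Extension.unitals-equivalent F K e F-order K-order ι {U₁} {U₂}
    (IsBuekenhoutTitsUnital.arisesFromTitsCone unital₁)
    (IsBuekenhoutTitsUnital.arisesFromTitsCone unital₂)
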